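{- There exists an absolute constant $c>0$ such that the following holds for all integers $n,m\ge1$. Let $F:\{ -1,+1\}^n\to\{ -1,+1\}$ and $f_i:X_i\to\{ -1,+1\}$, $i=1,2,\dots,n$, be nonconstant functions, for some finite sets $X_1,X_2,\dots,X_n\subset\mathbb{R}^m$. Then $$\deg_{1/3}(F(f_1,\dots,f_n))\ \ge\ c\,\deg_{1/3}(F)\min_{i=1,\dots,n}\left\{\deg_{1-\frac{1}{30n}\deg_{0.99}(F)}(f_i)\right\}$$ and $$\deg_{1/3}(F(f_1,\dots,f_n))\ \ge\ c\,\frac{\deg_{1/3}(F)^2}{n}\cdot\min_{i=1,\dots,n}\{\deg_{1/3}(f_i)\},$$ the right-hand side of the first bound being at least a positive absolute constant times the right-hand side of the second. In particular, taking $f_1=f_2=\cdots=f_n=f$, $$\deg_{1/3}(F(f,f,\dots,f))\ \ge\ c\,\frac{\deg_{1/3}(F)^2}{n}\cdot\deg_{1/3}(f).$$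
   Context: For a finite set $X\subset\mathbb{R}^N$ and $f:X\to\{ -1,+1\}$, $\deg_\epsilon(f)$ is the least degree of a real polynomial $p$ with $|f(x)-p(x)|\le\epsilon$ for all $x\in X$. $F(f_1,\dots,f_n):\prod X_i\to\{ -1,+1\}$ is the composed function $(x_1,\dots,x_n)\mapsto F(f_1(x_1),\dots,f_n(x_n))$, with $\prod X_i\subset\mathbb{R}^{mn}$. -}

module Defs where

open import Algebra.Bundles using (CommutativeRing; Semiring)
open import Data.Fin.Base using (Fin)
open import Data.List.Base using (List; foldr)
open import Data.List.Relation.Unary.All using (All)
open import Data.Nat.Base as ℕ using (ℕ; suc; NonZero)
open import Data.Product.Base using (∃; ∃₂; _×_; _,_; proj₂)
open import Data.Sign.Base as Sign using (Sign)
open import Data.Vec.Base as Vec using (Vec; tabulate)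
import Data.Vec.Functional as Vector
import Data.Vec.Relation.Binary.Equality.Setoid
import Algebra.Construct.NaturalChoice.Max as Max
import Algebra.Definitions.RawSemiring as RawSemiringOps
open import Function.Definitions using (Injective)
open import Level using (Level; _⊔_) renaming (suc to lsuc)
open import Relation.Binary.Bundles using (TotalOrder)
open import Relation.Binary.Core using (Rel)
open import Relation.Binary.PropositionalEquality.Core using (_≡_; _≢_)
import Relation.Binary.Construct.NonStrictToStrict as ToStrict
open import Relation.Binary.Structures using (IsDecTotalOrder)

-- The real numbers, given axiomatically as a Dedekind-complete ordered field
-- (unique up to isomorphism).  As in classical mathematics the order is
-- decidable.

record RealNumbers (c ℓ : Level) : Set (lsuc (c ⊔ ℓ)) where
  infix  4 _≤_
  infix  9 _⁻¹
  field
    commutativeRing : CommutativeRing c ℓ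

  open CommutativeRing commutativeRing public

  field
    _≤_             : Rel Carrier ℓ
    isDecTotalOrder : IsDecTotalOrder _≈_ _≤_
    +-monoˡ-≤       : ∀ {x y} z → x ≤ y → x + z ≤ y + z
    *-nonNegative   : ∀ {x y} → 0# ≤ x → 0# ≤ y → 0# ≤ x * y
    1≉0             : 1# ≉ 0#
    -- The value of 0# ⁻¹ is left unspecified.
    _⁻¹             : Carrier → Carrier
    ⁻¹-inverse      : ∀ {x} → x ≉ 0# → x * x ⁻¹ ≈ 1#

  UpperBound : (Carrier → Set (c ⊔ ℓ)) → Carrier → Set (c ⊔ ℓ)
  UpperBound P u = ∀ {x} → P x → x ≤ u

  field
    supremum : (P : Carrier → Set (c ⊔ ℓ)) → ∃ P → ∃ (UpperBound P) →
               ∃ λ s → UpperBound P s × (∀ {u} → UpperBound P u → s ≤ u)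

-- Polynomials in N variables are formal sums of terms (coefficient, exponent
-- vector).  Terms may repeat or have coefficient zero: collecting terms never
-- raises the bound in HasDegree≤, so a function is given by some p with
-- HasDegree≤ d p exactly when it is a polynomial function of degree at most d.

Polynomial : ∀ {c} → Set c → ℕ → Set c
Polynomial A N = List (A × Vec ℕ N)

HasDegree≤ : ∀ {c} {A : Set c} {N} → ℕ → Polynomial A N → Set c
HasDegree≤ d = All (λ term → Vec.sum (proj₂ term) ℕ.≤ d)

NonConstant : ∀ {a} {A : Set a} → (A → Sign) → Set a
NonConstant f = ∃₂ λ x y → f x ≢ f y

minimum : ∀ {n} .{{_ : NonZero n}} → (Fin n → ℕ) → ℕ
minimum {suc n} a = Vector.foldr ℕ._⊓_ (Vector.head a) (Vector.tail a)

module Approximation {c ℓ} (ℝ : RealNumbers c ℓ) where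

  open RealNumbers ℝ public
  open RawSemiringOps (Semiring.rawSemiring semiring) public using (_^_) renaming (_×_ to _times_)
  open ToStrict _≈_ _≤_ public using (_<_)

  totalOrder : TotalOrder c ℓ ℓ
  totalOrder = record
    { isTotalOrder = IsDecTotalOrder.isTotalOrder isDecTotalOrder }

  open Max totalOrder public using () renaming (_⊔_ to max)

  infixl 7 _/_
  _/_ : Carrier → Carrier → Carrier
  x / y = x * y ⁻¹

  fromℕ : ℕ → Carrier
  fromℕ k = k times 1#

  abs : Carrier → Carrier
  abs x = max x (- x)

  fromSign : Sign → Carrier
  fromSign Sign.+ = 1#
  fromSign Sign.- = - 1#

  Point : ℕ → Set c
  Point N = Vec Carrier N

  monomial : ∀ {N} → Vec ℕ N → Point N → Carrier
  monomial e x = Vec.foldr′ _*_ 1# (Vec.zipWith _^_ x e)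

  eval : ∀ {N} → Polynomial Carrier N → Point N → Carrier
  eval p x = foldr (λ (a , e) s → a * monomial e x + s) 0# p

  -- A function on a set of points in ℝ^N is presented by an indexing
  -- pt : A → Point N of that set together with f : A → Sign.

  Approximable : ∀ {a} {A : Set a} {N} →
                 (A → Point N) → Carrier → (A → Sign) → ℕ → Set (a ⊔ c ⊔ ℓ)
  Approximable pt ε f d = ∃ λ p →
    HasDegree≤ d p × (∀ x → abs (fromSign (f x) - eval p (pt x)) ≤ ε)

  -- IsDeg pt ε f d says that deg_ε(f) = d.

  IsDeg : ∀ {a} {A : Set a} {N} →
          (A → Point N) → Carrier → (A → Sign) → ℕ → Set (a ⊔ c ⊔ ℓ)
  IsDeg pt ε f d =
    Approximable pt ε f d × (∀ {k} → Approximable pt ε f k → d ℕ.≤ k)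

  record FiniteSet (m : ℕ) : Set (c ⊔ ℓ) where
    open Data.Vec.Relation.Binary.Equality.Setoid setoid using (_≋_)
    field
      size      : ℕ
      point     : Fin size → Point m
      injective : Injective _≡_ _≋_ point

    Element : Set
    Element = Fin size

  open FiniteSet public using (point; Element)

  cube : ∀ {n} → Vec Sign n → Point n
  cube = Vec.map fromSign

  Product : ∀ {n m} → (Fin n → FiniteSet m) → Set
  Product X = ∀ i → Element (X i)

  productPoint : ∀ {n m} (X : Fin n → FiniteSet m) → Product X → Point (n ℕ.* m)
  productPoint X x = Vec.concat (tabulate (λ i → point (X i) (x i)))

  compose : ∀ {n m} {X : Fin n → FiniteSet m} →
            (Vec Sign n → Sign) → (∀ i → Element (X i) → Sign) →
            Product X → Sign
  compose F f x = F (tabulate (λ i → f i (x i)))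

  1/3 : Carrier
  1/3 = fromℕ 1 / fromℕ 3

  0‧99 : Carrier
  0‧99 = fromℕ 99 / fromℕ 100

{-# OPTIONS --safe #-}
module Submission where

-- Let d = deg_{0.99}(F), δ = d / 30n and let D be the least deg_{1−δ}(fᵢ).  By
-- Farkas' lemma each Xᵢ carries two probability weights, one for either sign σ,
-- that agree on polynomials of degree less than D, while fᵢ = σ outside mass δ of
-- the weight of σ.  Averaging an approximant of F(f₁, …, fₙ) over the product
-- weight of z₁, …, zₙ would give an approximant of F at z, were it not for the
-- points with fᵢ ≠ zᵢ.  So only the good part of each weight is used, written as
-- weight minus bad part, and the product is expanded by inclusion–exclusion and
-- truncated at about d / 2 bad factors.  The bad parts having the same mass δ
-- throughout, Bonferroni's inequality bounds the loss by C(n, k) δᵏ with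
-- k ≈ d / 2, which is small against the mass (1 − δ)ⁿ of the good part.  A block of
-- a monomial enters the z-degree only if its weight was replaced by a bad part or
-- if its degree is at least D, whence d ≤ d / 2 + deg / D.
--
-- The levels of accuracy are compared by composing approximants with a
-- univariate polynomial of degree O(1/δ) that is close to the sign function
-- outside (−δ, δ).

open import Defs
open import Algebra.Bundles using (CommutativeRing)
import Algebra.Construct.NaturalChoice.Max
import Algebra.Construct.NaturalChoice.Min
import Algebra.Properties.CommutativeSemigroup
import Algebra.Properties.Ring
import Algebra.Properties.Semiring.Exp
import Algebra.Properties.Semiring.Mult
import Algebra.Properties.Semiring.Sum
import Algebra.Solver.Ring
open import Algebra.Solver.Ring.AlmostCommutativeRing
  using (AlmostCommutativeRing; fromCommutativeRing; _-Raw-AlmostCommutative⟶_)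
open import Data.Empty using (⊥-elim)
open import Data.Fin.Base using (Fin; zero; suc)
open import Data.Integer.Base as ℤ using (ℤ; -[1+_]) renaming (+_ to pos)
import Data.Integer.Properties as ℤₚ
open import Data.List.Base as List using (List; []; _∷_; _++_; foldr; filter; cartesianProductWith; allFin)
open import Data.List.Membership.Propositional using (_∈_)
open import Data.List.Membership.Propositional.Properties
  using (∈-map⁻; ∈-map⁺; ∈-++⁺ˡ; ∈-++⁺ʳ; ∈-++⁻; ∈-filter⁺; ∈-filter⁻; ∈-allFin;
         ∈-cartesianProductWith⁺; ∈-cartesianProductWith⁻)
open import Data.List.Relation.Unary.All as All using (All; []; _∷_)
import Data.List.Relation.Unary.All.Properties as Allₚ
open import Data.List.Relation.Unary.Any using (here; there)
open import Data.Maybe.Base using (Maybe; just; nothing)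
open import Data.Nat.Base as ℕ using (ℕ; zero; suc; NonZero)
import Data.Nat.DivMod as ℕ
import Data.Nat.Properties as ℕₚ
import Data.Nat.Solver
open import Data.Product.Base using (∃; _×_; _,_; proj₁; proj₂)
open import Data.Sign.Base as Sign using (Sign)
import Data.Sign.Properties as Signₚ
open import Data.Sum.Base as Sum using (_⊎_; inj₁; inj₂; [_,_]′)
open import Data.Vec.Base as Vec using (Vec; []; _∷_; lookup)
import Data.Vec.Functional as Vector
open import Function.Base using (_∘_; id)
open import Level using (_⊔_)
open import Relation.Binary.Bundles using (Poset)
open import Relation.Binary.PropositionalEquality.Core as ≡ using (_≡_; _≢_)
import Relation.Binary.Reasoning.PartialOrder
import Relation.Binary.Reasoning.Setoid
open import Relation.Binary.Structures using (IsDecTotalOrder)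
open import Relation.Nullary using (yes; no; ¬_)
open import Relation.Nullary.Decidable using (¬?; _×-dec_)

open Data.Nat.Solver.+-*-Solver using ()
  renaming (solve to solveℕ; _:+_ to infixl 7 _⊕_; _:*_ to infixl 8 _⊗_; _:=_ to infix 4 _⊜_; con to lit)

-- Expanding the product of good parts in full would let every factor depend on `z`, so that the
-- degree could reach `n`; the truncation caps this, at the price of an error spread over all points
-- of the product set. The price is affordable because an approximant is at most `4/3` in absolute
-- value everywhere, not only where it is known to be near `F z`. The first omitted layer has at
-- most a third of the good mass, so that the total error relative to that mass is at most
-- `4/9 + 1/3 = 7/9`, below `0.99`. The choice of `δ` balances two needs: it is small enough for
-- this estimate, and large enough that passing from accuracy `1 - δ` to `1/3` costs only a factor
-- `O(n / d)`. Against a degree `O(d)` of `F` this produces the `n` in the denominator of the second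
-- bound. For equal `fᵢ`, neither the `0.99`-degree of `F` nor the `(1 - δ)`-degree of `f` is given.
-- The main inequality is therefore stated for any lower bounds `d` and `D` on these degrees, and
-- rounded-up quotients of the given `1/3`-degrees serve as such bounds.

module Composition {r ℓ} (ℝ : RealNumbers r ℓ) where

  open Approximation ℝ hiding (zero)

  open Algebra.Properties.Ring ring using (-‿involutive; -‿distribˡ-*; -‿distribʳ-*; -‿+-comm; -0#≈0#)
  open Algebra.Properties.Semiring.Mult semiring using (×-homo-+; ×1-homo-*)
  open Algebra.Properties.Semiring.Exp semiring using (^-homo-*; ^-congˡ; ^-congʳ)
  open Algebra.Properties.Semiring.Sum semiring
    using (sum; sum-cong-≋; ∑-distrib-+; *-distribˡ-sum; sum-replicate-zero)
  module Ord = IsDecTotalOrder isDecTotalOrder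

  poset : Poset r ℓ ℓ
  poset = record { isPartialOrder = Ord.isPartialOrder }

  module ≈R where
    open Relation.Binary.Reasoning.Setoid setoid public
  module ≤R where
    open Relation.Binary.Reasoning.PartialOrder poset public

  -- Numerals and a ring solver

  fromℕ-+ : ∀ m n → fromℕ (m ℕ.+ n) ≈ fromℕ m + fromℕ n
  fromℕ-+ = ×-homo-+ 1#

  fromℕ-* : ∀ m n → fromℕ (m ℕ.* n) ≈ fromℕ m * fromℕ n
  fromℕ-* = ×1-homo-*

  -- The ring solver below has integer coefficients; 1 is sent to 1# on the
  -- nose and every n ≥ 2 to fromℕ n, so that numerals in goals are recognised.

  fromℤ : ℤ → Carrier
  fromℤ (pos 1) = 1#
  fromℤ (pos n) = fromℕ n
  fromℤ -[1+ n ] = - fromℕ (suc n)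

  private
    fromℤ-pos : ∀ n → fromℤ (pos n) ≈ fromℕ n
    fromℤ-pos 0 = refl
    fromℤ-pos 1 = sym (+-identityʳ 1#)
    fromℤ-pos (suc (suc n)) = refl

    cancel-1 : ∀ x y → (1# + x) - (1# + y) ≈ x - y
    cancel-1 x y = begin
      (1# + x) + - (1# + y)      ≈⟨ +-congˡ (sym (-‿+-comm 1# y)) ⟩
      (1# + x) + (- 1# + - y)    ≈⟨ +-congʳ (+-comm 1# x) ⟩
      (x + 1#) + (- 1# + - y)    ≈⟨ +-assoc x 1# _ ⟩
      x + (1# + (- 1# + - y))    ≈⟨ +-congˡ (sym (+-assoc 1# (- 1#) (- y))) ⟩
      x + ((1# + - 1#) + - y)    ≈⟨ +-congˡ (+-congʳ (-‿inverseʳ 1#)) ⟩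
      x + (0# + - y)             ≈⟨ +-congˡ (+-identityˡ (- y)) ⟩
      x - y                      ∎
      where open ≈R

    fromℤ-⊖ : ∀ m n → fromℤ (m ℤ.⊖ n) ≈ fromℕ m - fromℕ n
    fromℤ-⊖ zero zero = sym (-‿inverseʳ 0#)
    fromℤ-⊖ zero (suc n) = sym (+-identityˡ _)
    fromℤ-⊖ (suc m) zero = trans (fromℤ-pos (suc m)) (sym (trans (+-congˡ -0#≈0#) (+-identityʳ _)))
    fromℤ-⊖ (suc m) (suc n) = begin
      fromℤ (suc m ℤ.⊖ suc n)              ≡⟨ ≡.cong fromℤ (ℤₚ.[1+m]⊖[1+n]≡m⊖n m n) ⟩
      fromℤ (m ℤ.⊖ n)                      ≈⟨ fromℤ-⊖ m n ⟩
      fromℕ m - fromℕ n                    ≈⟨ sym (cancel-1 _ _) ⟩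
      fromℕ (suc m) - fromℕ (suc n)        ∎
      where open ≈R

    fromℤ-+ : ∀ i j → fromℤ (i ℤ.+ j) ≈ fromℤ i + fromℤ j
    fromℤ-+ (pos m) (pos n) = trans (fromℤ-pos (m ℕ.+ n)) (trans (fromℕ-+ m n)
      (sym (+-cong (fromℤ-pos m) (fromℤ-pos n))))
    fromℤ-+ (pos m) -[1+ n ] = trans (fromℤ-⊖ m (suc n)) (+-congʳ (sym (fromℤ-pos m)))
    fromℤ-+ -[1+ m ] (pos n) = trans (fromℤ-⊖ n (suc m)) (trans (+-congʳ (sym (fromℤ-pos n))) (+-comm _ _))
    fromℤ-+ -[1+ m ] -[1+ n ] = begin
      - fromℕ (suc (suc (m ℕ.+ n)))        ≡⟨ ≡.cong (λ k → - fromℕ k) (≡.sym (≡.cong suc (ℕₚ.+-suc m n))) ⟩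
      - fromℕ (suc m ℕ.+ suc n)            ≈⟨ -‿cong (fromℕ-+ (suc m) (suc n)) ⟩
      - (fromℕ (suc m) + fromℕ (suc n))    ≈⟨ sym (-‿+-comm _ _) ⟩
      - fromℕ (suc m) + - fromℕ (suc n)    ∎
      where open ≈R

    fromℤ-neg : ∀ i → fromℤ (ℤ.- i) ≈ - fromℤ i
    fromℤ-neg (pos zero) = sym -0#≈0#
    fromℤ-neg (pos (suc n)) = -‿cong (sym (fromℤ-pos (suc n)))
    fromℤ-neg -[1+ n ] = trans (fromℤ-pos (suc n)) (sym (-‿involutive _))

    fromℤ-pos-* : ∀ m n → fromℤ (pos m ℤ.* pos n) ≈ fromℤ (pos m) * fromℤ (pos n)
    fromℤ-pos-* m n = begin
      fromℤ (pos m ℤ.* pos n)            ≡⟨ ≡.cong fromℤ (ℤₚ.pos-* m n) ⟨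
      fromℤ (pos (m ℕ.* n))              ≈⟨ fromℤ-pos (m ℕ.* n) ⟩
      fromℕ (m ℕ.* n)                    ≈⟨ ×1-homo-* m n ⟩
      fromℕ m * fromℕ n                  ≈⟨ *-cong (fromℤ-pos m) (fromℤ-pos n) ⟨
      fromℤ (pos m) * fromℤ (pos n)      ∎
      where open ≈R

    fromℤ-negˡ-* : ∀ i j → fromℤ (i ℤ.* j) ≈ fromℤ i * fromℤ j →
                   fromℤ (ℤ.- i ℤ.* j) ≈ fromℤ (ℤ.- i) * fromℤ j
    fromℤ-negˡ-* i j eq = begin
      fromℤ (ℤ.- i ℤ.* j)      ≡⟨ ≡.cong fromℤ (ℤₚ.neg-distribˡ-* i j) ⟨
      fromℤ (ℤ.- (i ℤ.* j))    ≈⟨ fromℤ-neg (i ℤ.* j) ⟩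
      - fromℤ (i ℤ.* j)        ≈⟨ -‿cong eq ⟩
      - (fromℤ i * fromℤ j)    ≈⟨ -‿distribˡ-* _ _ ⟩
      - fromℤ i * fromℤ j      ≈⟨ *-congʳ (fromℤ-neg i) ⟨
      fromℤ (ℤ.- i) * fromℤ j  ∎
      where open ≈R

    fromℤ-pos-*ʳ : ∀ i n → fromℤ (i ℤ.* pos n) ≈ fromℤ i * fromℤ (pos n)
    fromℤ-pos-*ʳ (pos m) n = fromℤ-pos-* m n
    fromℤ-pos-*ʳ -[1+ m ] n = fromℤ-negˡ-* (pos (suc m)) (pos n) (fromℤ-pos-* (suc m) n)

    fromℤ-* : ∀ i j → fromℤ (i ℤ.* j) ≈ fromℤ i * fromℤ j
    fromℤ-* i (pos n) = fromℤ-pos-*ʳ i n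
    fromℤ-* i -[1+ n ] = begin
      fromℤ (i ℤ.* -[1+ n ])               ≡⟨ ≡.cong fromℤ (ℤₚ.*-comm i -[1+ n ]) ⟩
      fromℤ (-[1+ n ] ℤ.* i)               ≈⟨ fromℤ-negˡ-* (pos (suc n)) i swapped ⟩
      fromℤ -[1+ n ] * fromℤ i             ≈⟨ *-comm _ _ ⟩
      fromℤ i * fromℤ -[1+ n ]             ∎
      where
      open ≈R
      swapped : fromℤ (pos (suc n) ℤ.* i) ≈ fromℤ (pos (suc n)) * fromℤ i
      swapped = trans (reflexive (≡.cong fromℤ (ℤₚ.*-comm (pos (suc n)) i)))
        (trans (fromℤ-pos-*ʳ i (suc n)) (*-comm _ _))

    almostCommutativeRing : AlmostCommutativeRing r ℓ
    almostCommutativeRing = fromCommutativeRing commutativeRing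

    fromℤ-morphism : CommutativeRing.rawRing ℤₚ.+-*-commutativeRing -Raw-AlmostCommutative⟶ almostCommutativeRing
    fromℤ-morphism = record
      { ⟦_⟧ = fromℤ ; +-homo = fromℤ-+ ; *-homo = fromℤ-* ; -‿homo = fromℤ-neg ; 0-homo = refl ; 1-homo = refl }

    fromℤ-≟ : ∀ i j → Maybe (fromℤ i ≈ fromℤ j)
    fromℤ-≟ i j with i ℤₚ.≟ j
    ... | yes eq = just (reflexive (≡.cong fromℤ eq))
    ... | no _ = nothing

  open Algebra.Solver.Ring (CommutativeRing.rawRing ℤₚ.+-*-commutativeRing) almostCommutativeRing
    fromℤ-morphism fromℤ-≟
    using (solve; con; _:+_; _:*_; :-_; _:-_; _:=_)

  -- Ordered field arithmetic

  slack : ∀ {x y} → x ≤ y → 0# ≤ y - x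
  slack {x} {y} x≤y = begin
    0#     ≈⟨ -‿inverseʳ x ⟨
    x - x  ≤⟨ +-monoˡ-≤ (- x) x≤y ⟩
    y - x  ∎
    where open ≤R

  -- Inequalities are proved by exhibiting the difference as a manifestly
  -- nonnegative expression; the equation is left to the ring solver.
  slack⇒≤ : ∀ {x y s} → 0# ≤ s → y - x ≈ s → x ≤ y
  slack⇒≤ {x} {y} {s} 0≤s eq = begin
    x            ≈⟨ +-identityˡ x ⟨
    0# + x       ≤⟨ +-monoˡ-≤ x 0≤s ⟩
    s + x        ≈⟨ +-congʳ eq ⟨
    (y - x) + x  ≈⟨ solve 2 (λ x y → (y :- x) :+ x := y) refl x y ⟩
    y            ∎
    where open ≤R

  ≤-trans : ∀ {x y z} → x ≤ y → y ≤ z → x ≤ z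
  ≤-trans = Ord.trans

  ≤-reflexive : ∀ {x y} → x ≈ y → x ≤ y
  ≤-reflexive = Ord.reflexive

  +-mono-≤ : ∀ {x y u v} → x ≤ y → u ≤ v → x + u ≤ y + v
  +-mono-≤ {x} {y} {u} {v} x≤y u≤v = begin
    x + u  ≤⟨ +-monoˡ-≤ u x≤y ⟩
    y + u  ≈⟨ +-comm y u ⟩
    u + y  ≤⟨ +-monoˡ-≤ y u≤v ⟩
    v + y  ≈⟨ +-comm v y ⟩
    y + v  ∎
    where open ≤R

  +-nonNegative : ∀ {x y} → 0# ≤ x → 0# ≤ y → 0# ≤ x + y
  +-nonNegative 0≤x 0≤y = ≤-trans (≤-reflexive (sym (+-identityˡ 0#))) (+-mono-≤ 0≤x 0≤y)

  neg-antimono-≤ : ∀ {x y} → x ≤ y → - y ≤ - x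
  neg-antimono-≤ {x} {y} x≤y = slack⇒≤ (slack x≤y)
    (solve 2 (λ x y → :- x :- :- y := y :- x) refl x y)

  *-monoˡ-≤ : ∀ {x y z} → 0# ≤ z → x ≤ y → z * x ≤ z * y
  *-monoˡ-≤ {x} {y} {z} 0≤z x≤y = slack⇒≤ (*-nonNegative 0≤z (slack x≤y))
    (solve 3 (λ x y z → z :* y :- z :* x := z :* (y :- x)) refl x y z)

  *-monoʳ-≤ : ∀ {x y z} → 0# ≤ z → x ≤ y → x * z ≤ y * z
  *-monoʳ-≤ {x} {y} {z} 0≤z x≤y = slack⇒≤ (*-nonNegative (slack x≤y) 0≤z)
    (solve 3 (λ x y z → y :* z :- x :* z := (y :- x) :* z) refl x y z)

  *-mono-≤ : ∀ {x y u v} → 0# ≤ u → 0# ≤ y → x ≤ y → u ≤ v → x * u ≤ y * v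
  *-mono-≤ 0≤u 0≤y x≤y u≤v = ≤-trans (*-monoʳ-≤ 0≤u x≤y) (*-monoˡ-≤ 0≤y u≤v)

  square-nonNegative : ∀ x → 0# ≤ x * x
  square-nonNegative x with Ord.total 0# x
  ... | inj₁ 0≤x = *-nonNegative 0≤x 0≤x
  ... | inj₂ x≤0 = ≤-trans (*-nonNegative 0≤-x 0≤-x)
    (≤-reflexive (solve 1 (λ x → (:- x) :* (:- x) := x :* x) refl x))
    where
    0≤-x : 0# ≤ - x
    0≤-x = ≤-trans (≤-reflexive (sym -0#≈0#)) (neg-antimono-≤ x≤0)

  0≤1 : 0# ≤ 1#
  0≤1 = ≤-trans (square-nonNegative 1#) (≤-reflexive (*-identityˡ 1#))

  1≰0 : ¬ 1# ≤ 0#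
  1≰0 1≤0 = 1≉0 (Ord.antisym 1≤0 0≤1)

  fromℕ-nonNegative : ∀ n → 0# ≤ fromℕ n
  fromℕ-nonNegative zero = Ord.refl
  fromℕ-nonNegative (suc n) = +-nonNegative 0≤1 (fromℕ-nonNegative n)

  fromℕ-mono : ∀ {m n} → m ℕ.≤ n → fromℕ m ≤ fromℕ n
  fromℕ-mono {n = n} ℕ.z≤n = fromℕ-nonNegative n
  fromℕ-mono (ℕ.s≤s m≤n) = +-mono-≤ Ord.refl (fromℕ-mono m≤n)

  1≤fromℕ : ∀ n .{{_ : NonZero n}} → 1# ≤ fromℕ n
  1≤fromℕ (suc n) = ≤-trans (≤-reflexive (sym (+-identityʳ 1#))) (fromℕ-mono {1} {suc n} (ℕ.s≤s ℕ.z≤n))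

  1≤⇒0< : ∀ {x} → 1# ≤ x → 0# < x
  1≤⇒0< 1≤x = ≤-trans 0≤1 1≤x , λ 0≈x → 1≰0 (≤-trans 1≤x (≤-reflexive (sym 0≈x)))

  0<1 : 0# < 1#
  0<1 = 1≤⇒0< Ord.refl

  0<fromℕ : ∀ n .{{_ : NonZero n}} → 0# < fromℕ n
  0<fromℕ n = 1≤⇒0< (1≤fromℕ n)

  inverse-positive : ∀ {x} → 0# < x → x * x ⁻¹ ≈ 1# × 0# < x ⁻¹
  inverse-positive {x} (0≤x , 0≉x) = eq , nonNeg (Ord.total 0# (x ⁻¹)) , nonZero
    where
    eq : x * x ⁻¹ ≈ 1#
    eq = ⁻¹-inverse (λ x≈0 → 0≉x (sym x≈0))
    nonZero : 0# ≉ x ⁻¹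
    nonZero 0≈x⁻¹ = 1≉0 (trans (sym eq) (trans (*-congˡ (sym 0≈x⁻¹)) (zeroʳ x)))
    nonNeg : 0# ≤ x ⁻¹ ⊎ x ⁻¹ ≤ 0# → 0# ≤ x ⁻¹
    nonNeg (inj₁ 0≤x⁻¹) = 0≤x⁻¹
    nonNeg (inj₂ x⁻¹≤0) = ⊥-elim (1≰0 (≤-trans (≤-reflexive (sym eq))
      (≤-trans (*-monoˡ-≤ 0≤x x⁻¹≤0) (≤-reflexive (zeroʳ x)))))

  *-cancelˡ-≤ : ∀ {x y z} → 0# < z → z * x ≤ z * y → x ≤ y
  *-cancelˡ-≤ {x} {y} {z} 0<z zx≤zy with inverse-positive 0<z
  ... | eq , 0<w = begin
    x                ≈⟨ *-identityˡ x ⟨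
    1# * x           ≈⟨ *-congʳ eq ⟨
    z * w * x        ≈⟨ solve 3 (λ z w x → z :* w :* x := w :* (z :* x)) refl z w x ⟩
    w * (z * x)      ≤⟨ *-monoˡ-≤ (proj₁ 0<w) zx≤zy ⟩
    w * (z * y)      ≈⟨ solve 3 (λ z w x → z :* w :* x := w :* (z :* x)) refl z w y ⟨
    z * w * y        ≈⟨ *-congʳ eq ⟩
    1# * y           ≈⟨ *-identityˡ y ⟩
    y                ∎
    where
    open ≤R
    w = z ⁻¹

  *-cancelˡ-nonNegative : ∀ {x z} → 0# < z → 0# ≤ z * x → 0# ≤ x
  *-cancelˡ-nonNegative {x} {z} 0<z 0≤zx = *-cancelˡ-≤ 0<z (≤-trans (≤-reflexive (zeroʳ z)) 0≤zx)

  *-positive : ∀ {x y} → 0# < x → 0# < y → 0# < x * y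
  *-positive {x} {y} 0<x@(0≤x , _) (0≤y , 0≉y) = *-nonNegative 0≤x 0≤y , λ 0≈xy →
    0≉y (Ord.antisym 0≤y (*-cancelˡ-≤ 0<x (≤-reflexive (trans (sym 0≈xy) (sym (zeroʳ x))))))

  ≰⇒≥ : ∀ {x y} → ¬ x ≤ y → y ≤ x
  ≰⇒≥ {x} {y} x≰y with Ord.total x y
  ... | inj₁ x≤y = ⊥-elim (x≰y x≤y)
  ... | inj₂ y≤x = y≤x

  ≰⇒> : ∀ {x y} → ¬ x ≤ y → y < x
  ≰⇒> x≰y = ≰⇒≥ x≰y , λ y≈x → x≰y (≤-reflexive (sym y≈x))

  <⇒≱ : ∀ {x y} → x < y → ¬ y ≤ x
  <⇒≱ (x≤y , x≉y) y≤x = x≉y (Ord.antisym x≤y y≤x)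

  ^-nonNegative : ∀ {x} n → 0# ≤ x → 0# ≤ x ^ n
  ^-nonNegative zero 0≤x = 0≤1
  ^-nonNegative (suc n) 0≤x = *-nonNegative 0≤x (^-nonNegative n 0≤x)

  ^-positive : ∀ {x} n → 0# < x → 0# < x ^ n
  ^-positive zero 0<x = 0<1
  ^-positive (suc n) 0<x = *-positive 0<x (^-positive n 0<x)

  ^-mono-≤ : ∀ {x y} n → 0# ≤ x → x ≤ y → x ^ n ≤ y ^ n
  ^-mono-≤ zero 0≤x x≤y = Ord.refl
  ^-mono-≤ (suc n) 0≤x x≤y = *-mono-≤ (^-nonNegative n 0≤x) (≤-trans 0≤x x≤y) x≤y (^-mono-≤ n 0≤x x≤y)

  *-distrib-^ : ∀ x y n → (x * y) ^ n ≈ x ^ n * y ^ n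
  *-distrib-^ x y zero = sym (*-identityˡ 1#)
  *-distrib-^ x y (suc n) = trans (*-congˡ (*-distrib-^ x y n))
    (solve 4 (λ x y u v → x :* y :* (u :* v) := x :* u :* (y :* v)) refl x y (x ^ n) (y ^ n))

  module MaxOp = Algebra.Construct.NaturalChoice.Max totalOrder
  module MinOp = Algebra.Construct.NaturalChoice.Min totalOrder

  -- Two-sided bounds

  infix 4 ∣_∣≤_
  -- A pair of inequalities in place of `abs x ≤ B`: with no `max` in the way, both halves are open
  -- to the ring solver.
  ∣_∣≤_ : Carrier → Carrier → Set ℓ
  ∣ x ∣≤ B = x ≤ B × - x ≤ B

  abs≤⇒∣∣≤ : ∀ {x B} → abs x ≤ B → ∣ x ∣≤ B
  abs≤⇒∣∣≤ {x} abs≤B = ≤-trans (MaxOp.x≤x⊔y x (- x)) abs≤B , ≤-trans (MaxOp.x≤y⊔x x (- x)) abs≤B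

  ∣∣≤⇒abs≤ : ∀ {x B} → ∣ x ∣≤ B → abs x ≤ B
  ∣∣≤⇒abs≤ (x≤B , -x≤B) = MaxOp.⊔-lub x≤B -x≤B

  ∣∣≤-cong : ∀ {x y A B} → x ≈ y → A ≈ B → ∣ x ∣≤ A → ∣ y ∣≤ B
  ∣∣≤-cong x≈y A≈B (x≤A , -x≤A) =
    ≤-trans (≤-reflexive (sym x≈y)) (≤-trans x≤A (≤-reflexive A≈B)) ,
    ≤-trans (≤-reflexive (-‿cong (sym x≈y))) (≤-trans -x≤A (≤-reflexive A≈B))

  ∣∣≤-weaken : ∀ {x A B} → A ≤ B → ∣ x ∣≤ A → ∣ x ∣≤ B
  ∣∣≤-weaken A≤B (x≤A , -x≤A) = ≤-trans x≤A A≤B , ≤-trans -x≤A A≤B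

  ∣∣≤-+ : ∀ {x y A B} → ∣ x ∣≤ A → ∣ y ∣≤ B → ∣ x + y ∣≤ A + B
  ∣∣≤-+ {x} {y} (x≤A , -x≤A) (y≤B , -y≤B) = +-mono-≤ x≤A y≤B ,
    ≤-trans (≤-reflexive (sym (-‿+-comm x y))) (+-mono-≤ -x≤A -y≤B)

  ∣∣≤-neg : ∀ {x B} → ∣ x ∣≤ B → ∣ - x ∣≤ B
  ∣∣≤-neg {x} (x≤B , -x≤B) = -x≤B , ≤-trans (≤-reflexive (-‿involutive x)) x≤B

  ∣∣≤-nonNegative : ∀ {x B} → 0# ≤ x → x ≤ B → ∣ x ∣≤ B
  ∣∣≤-nonNegative {x} 0≤x x≤B = x≤B ,
    ≤-trans (neg-antimono-≤ 0≤x) (≤-trans (≤-reflexive -0#≈0#) (≤-trans 0≤x x≤B))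

  ∣∣≤-*ˡ : ∀ {x a B} → 0# ≤ a → ∣ x ∣≤ B → ∣ a * x ∣≤ a * B
  ∣∣≤-*ˡ {x} {a} 0≤a (x≤B , -x≤B) = *-monoˡ-≤ 0≤a x≤B ,
    ≤-trans (≤-reflexive (-‿distribʳ-* a x)) (*-monoˡ-≤ 0≤a -x≤B)

  -- The numbers `A ± x` and `B ± y` are nonnegative, and `2 (A B - x y)` and `2 (A B + x y)` are
  -- sums of two products of them; no case distinction on signs arises.
  ∣∣≤-* : ∀ {x y A B} → ∣ x ∣≤ A → ∣ y ∣≤ B → ∣ x * y ∣≤ A * B
  ∣∣≤-* {x} {y} {A} {B} (x≤A , -x≤A) (y≤B , -y≤B) =
    *-cancelˡ-≤ 0<2 (slack⇒≤
      (+-nonNegative (*-nonNegative (slack x≤A) (slack -y≤B)) (*-nonNegative (slack -x≤A) (slack y≤B)))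
      (solve 4 (λ x y A B → con (pos 2) :* (A :* B) :- con (pos 2) :* (x :* y)
                  := (A :- x) :* (B :- :- y) :+ (A :- :- x) :* (B :- y)) refl x y A B)) ,
    *-cancelˡ-≤ 0<2 (slack⇒≤
      (+-nonNegative (*-nonNegative (slack x≤A) (slack y≤B)) (*-nonNegative (slack -x≤A) (slack -y≤B)))
      (solve 4 (λ x y A B → con (pos 2) :* (A :* B) :- con (pos 2) :* (:- (x :* y))
                  := (A :- x) :* (B :- y) :+ (A :- :- x) :* (B :- :- y)) refl x y A B))
    where
    0<2 : 0# < fromℕ 2
    0<2 = 0<fromℕ 2

  -- Finite sums

  unitVector : ∀ {s} → Fin s → Fin s → Carrier
  unitVector zero zero = 1#
  unitVector zero (suc y) = 0#
  unitVector (suc x) zero = 0#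
  unitVector (suc x) (suc y) = unitVector x y

  unitVector-nonNegative : ∀ {s} (x y : Fin s) → 0# ≤ unitVector x y
  unitVector-nonNegative zero zero = 0≤1
  unitVector-nonNegative zero (suc y) = Ord.refl
  unitVector-nonNegative (suc x) zero = Ord.refl
  unitVector-nonNegative (suc x) (suc y) = unitVector-nonNegative x y

  -- Abstract, so that unification can read the summand off a sum.
  abstract
    ∑ : ∀ {s} → (Fin s → Carrier) → Carrier
    ∑ = sum

    ∑-cong : ∀ {s} {g h : Fin s → Carrier} → (∀ x → g x ≈ h x) → ∑ g ≈ ∑ h
    ∑-cong = sum-cong-≋

    ∑-+ : ∀ {s} (g h : Fin s → Carrier) → ∑ (λ x → g x + h x) ≈ ∑ g + ∑ h
    ∑-+ = ∑-distrib-+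

    ∑-*ˡ : ∀ {s} a (h : Fin s → Carrier) → ∑ (λ x → a * h x) ≈ a * ∑ h
    ∑-*ˡ a h = sym (*-distribˡ-sum a h)

    ∑-zero : ∀ {s} {h : Fin s → Carrier} → (∀ x → h x ≈ 0#) → ∑ h ≈ 0#
    ∑-zero {s} h≈0 = trans (sum-cong-≋ h≈0) (sum-replicate-zero s)

    ∑-mono-≤ : ∀ {s} {g h : Fin s → Carrier} → (∀ x → g x ≤ h x) → ∑ g ≤ ∑ h
    ∑-mono-≤ {zero} g≤h = Ord.refl
    ∑-mono-≤ {suc s} g≤h = +-mono-≤ (g≤h zero) (∑-mono-≤ (λ x → g≤h (suc x)))

    ∣∑∣≤ : ∀ {s} {g h : Fin s → Carrier} → (∀ x → ∣ g x ∣≤ h x) → ∣ ∑ g ∣≤ ∑ h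
    ∣∑∣≤ {zero} g≤h = Ord.refl , ≤-reflexive -0#≈0#
    ∣∑∣≤ {suc s} g≤h = ∣∣≤-+ (g≤h zero) (∣∑∣≤ (λ x → g≤h (suc x)))

    ∑-unitVector : ∀ {s} (h : Fin s → Carrier) x → ∑ (λ y → h y * unitVector x y) ≈ h x
    ∑-unitVector h zero = trans (+-cong (*-identityʳ _) (∑-zero {h = λ y → h (suc y) * 0#} (λ y → zeroʳ _)))
        (+-identityʳ _)
    ∑-unitVector h (suc x) = trans (+-cong (zeroʳ _) (∑-unitVector (λ y → h (suc y)) x)) (+-identityˡ _)

  ∑-linear : ∀ {s} a b (g h : Fin s → Carrier) → ∑ (λ x → a * g x + b * h x) ≈ a * ∑ g + b * ∑ h
  ∑-linear a b g h = trans (∑-+ (λ x → a * g x) (λ x → b * h x)) (+-cong (∑-*ˡ a g) (∑-*ˡ b h))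

  ∑-nonNegative : ∀ {s} {h : Fin s → Carrier} → (∀ x → 0# ≤ h x) → 0# ≤ ∑ h
  ∑-nonNegative {s} 0≤h = ≤-trans (≤-reflexive (sym (∑-zero {s} {λ _ → 0#} (λ _ → refl)))) (∑-mono-≤ 0≤h)

  -- Polynomial functions

  Term : ℕ → Set r
  Term N = Carrier × Vec ℕ N

  monomial-+ : ∀ {N} (e e′ : Vec ℕ N) x →
               monomial (Vec.zipWith ℕ._+_ e e′) x ≈ monomial e x * monomial e′ x
  monomial-+ [] [] [] = sym (*-identityˡ 1#)
  monomial-+ (k ∷ e) (k′ ∷ e′) (x ∷ xs) = trans (*-cong (^-homo-* x k k′) (monomial-+ e e′ xs))
    (solve 4 (λ a b u v → a :* b :* (u :* v) := a :* u :* (b :* v)) refl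
      (x ^ k) (x ^ k′) (monomial e xs) (monomial e′ xs))

  monomial-0 : ∀ N (x : Point N) → monomial (Vec.replicate N 0) x ≈ 1#
  monomial-0 zero [] = refl
  monomial-0 (suc N) (x ∷ xs) = trans (*-identityˡ _) (monomial-0 N xs)

  sum-replicate-0 : ∀ N → Vec.sum (Vec.replicate N 0) ≡ 0
  sum-replicate-0 zero = ≡.refl
  sum-replicate-0 (suc N) = sum-replicate-0 N

  sum-zipWith-+ : ∀ {N} (e e′ : Vec ℕ N) → Vec.sum (Vec.zipWith ℕ._+_ e e′) ≡ Vec.sum e ℕ.+ Vec.sum e′
  sum-zipWith-+ [] [] = ≡.refl
  sum-zipWith-+ (k ∷ e) (k′ ∷ e′) = ≡.trans (≡.cong (k ℕ.+ k′ ℕ.+_) (sum-zipWith-+ e e′))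
    (+-interchange k k′ (Vec.sum e) (Vec.sum e′))
    where
    open Algebra.Properties.CommutativeSemigroup ℕₚ.+-commutativeSemigroup
      using () renaming (interchange to +-interchange)

  eval-++ : ∀ {N} (p q : Polynomial Carrier N) x → eval (p ++ q) x ≈ eval p x + eval q x
  eval-++ [] q x = sym (+-identityˡ _)
  eval-++ ((a , e) ∷ p) q x = trans (+-congˡ (eval-++ p q x)) (sym (+-assoc _ _ _))

  mulTerm : ∀ {N} → Term N → Term N → Term N
  mulTerm (a , e) (b , e′) = a * b , Vec.zipWith ℕ._+_ e e′

  mulPoly : ∀ {N} → Polynomial Carrier N → Polynomial Carrier N → Polynomial Carrier N
  mulPoly [] q = []
  mulPoly (t ∷ p) q = List.map (mulTerm t) q ++ mulPoly p q

  eval-mulTerm : ∀ {N} a e (q : Polynomial Carrier N) x →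
                 eval (List.map (mulTerm (a , e)) q) x ≈ a * monomial e x * eval q x
  eval-mulTerm a e [] x = sym (zeroʳ _)
  eval-mulTerm a e ((b , e′) ∷ q) x = trans (+-cong (*-congˡ (monomial-+ e e′ x)) (eval-mulTerm a e q x))
    (solve 5 (λ a b m m′ s → a :* b :* (m :* m′) :+ a :* m :* s := a :* m :* (b :* m′ :+ s)) refl
      a b (monomial e x) (monomial e′ x) (eval q x))

  eval-mulPoly : ∀ {N} (p q : Polynomial Carrier N) x → eval (mulPoly p q) x ≈ eval p x * eval q x
  eval-mulPoly [] q x = sym (zeroˡ _)
  eval-mulPoly ((a , e) ∷ p) q x = trans (eval-++ (List.map (mulTerm (a , e)) q) (mulPoly p q) x)
    (trans (+-cong (eval-mulTerm a e q x) (eval-mulPoly p q x)) (sym (distribʳ _ _ _)))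

  degree-mulPoly : ∀ {N d d′} {p q : Polynomial Carrier N} →
                   HasDegree≤ d p → HasDegree≤ d′ q → HasDegree≤ (d ℕ.+ d′) (mulPoly p q)
  degree-mulPoly [] dq = []
  degree-mulPoly {p = (a , e) ∷ p} (de ∷ dp) dq = Allₚ.++⁺
    (Allₚ.map⁺ (All.map (λ {(b , e′)} de′ → ≡.subst (ℕ._≤ _) (≡.sym (sum-zipWith-+ e e′)) (ℕₚ.+-mono-≤ de de′)) dq))
    (degree-mulPoly dp dq)

  -- Degree is attributed to the function on the given points, not to an expression: a function of a
  -- sign, or a sum over other points, acquires a degree as soon as it agrees pointwise with some
  -- polynomial.
  record PolynomialOfDegree≤ {A : Set} {N} (pt : A → Point N) (d : ℕ) (g : A → Carrier) : Set (r ⊔ ℓ) where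
    constructor polynomial
    field
      representative : Polynomial Carrier N
      hasDegree      : HasDegree≤ d representative
      represents     : ∀ x → eval representative (pt x) ≈ g x

  module _ {A : Set} {N} {pt : A → Point N} where

    polynomial-cong : ∀ {d g h} → (∀ x → g x ≈ h x) → PolynomialOfDegree≤ pt d g → PolynomialOfDegree≤ pt d h
    polynomial-cong g≈h (polynomial p dp p≈g) = polynomial p dp λ x → trans (p≈g x) (g≈h x)

    polynomial-weaken : ∀ {d d′ g} → d ℕ.≤ d′ → PolynomialOfDegree≤ pt d g → PolynomialOfDegree≤ pt d′ g
    polynomial-weaken d≤d′ (polynomial p dp p≈g) = polynomial p (All.map (λ de → ℕₚ.≤-trans de d≤d′) dp) p≈g

    polynomial-const : ∀ {d} a → PolynomialOfDegree≤ pt d (λ _ → a)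
    polynomial-const {d} a =
      polynomial ((a , Vec.replicate N 0) ∷ []) (≡.subst (ℕ._≤ d) (≡.sym (sum-replicate-0 N)) ℕ.z≤n ∷ [])
      λ x → trans (+-congʳ (*-congˡ (monomial-0 N (pt x)))) (trans (+-identityʳ _) (*-identityʳ a))

    polynomial-+ : ∀ {d g h} → PolynomialOfDegree≤ pt d g → PolynomialOfDegree≤ pt d h →
                   PolynomialOfDegree≤ pt d (λ x → g x + h x)
    polynomial-+ (polynomial p dp p≈g) (polynomial q dq q≈h) = polynomial (p ++ q) (Allₚ.++⁺ dp dq)
      λ x → trans (eval-++ p q (pt x)) (+-cong (p≈g x) (q≈h x))

    polynomial-* : ∀ {d d′ g h} → PolynomialOfDegree≤ pt d g → PolynomialOfDegree≤ pt d′ h →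
                   PolynomialOfDegree≤ pt (d ℕ.+ d′) (λ x → g x * h x)
    polynomial-* (polynomial p dp p≈g) (polynomial q dq q≈h) = polynomial (mulPoly p q) (degree-mulPoly dp dq)
      λ x → trans (eval-mulPoly p q (pt x)) (*-cong (p≈g x) (q≈h x))

    polynomial-*ˡ : ∀ {d g} a → PolynomialOfDegree≤ pt d g → PolynomialOfDegree≤ pt d (λ x → a * g x)
    polynomial-*ˡ a pg = polynomial-* (polynomial-const {0} a) pg

  liftPoly : ∀ {N} → Polynomial Carrier N → Polynomial Carrier (suc N)
  liftPoly = List.map (λ (a , e) → a , 0 ∷ e)

  eval-liftPoly : ∀ {N} (p : Polynomial Carrier N) x xs → eval (liftPoly p) (x ∷ xs) ≈ eval p xs
  eval-liftPoly [] x xs = refl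
  eval-liftPoly ((a , e) ∷ p) x xs = +-cong (*-congˡ (*-identityˡ _)) (eval-liftPoly p x xs)

  polynomial-tail : ∀ {n d} {g : Vec Sign n → Carrier} → PolynomialOfDegree≤ cube d g →
                    PolynomialOfDegree≤ cube d (λ z → g (Vec.tail z))
  polynomial-tail (polynomial p dp p≈g) = polynomial (liftPoly p) (Allₚ.map⁺ dp)
    λ { (σ ∷ z) → trans (eval-liftPoly p (fromSign σ) (cube z)) (p≈g z) }

  polynomial-head : ∀ {n} → PolynomialOfDegree≤ (cube {suc n}) 1 (λ z → fromSign (Vec.head z))
  polynomial-head {n} = polynomial ((1# , 1 ∷ Vec.replicate n 0) ∷ [])
      (ℕ.s≤s (ℕₚ.≤-reflexive (sum-replicate-0 n)) ∷ [])
    λ { (σ ∷ z) → trans (+-identityʳ _) (trans (*-identityˡ _)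
          (trans (*-cong (*-identityʳ _) (monomial-0 n (cube z))) (*-identityʳ _))) }

  ½ : Carrier
  ½ = fromℕ 2 ⁻¹

  2*½≈1 : fromℕ 2 * ½ ≈ 1#
  2*½≈1 = proj₁ (inverse-positive (0<fromℕ 2))

  -- On two points every function is affine: half the sum of its values plus half their difference
  -- times the sign. This is why a factor depending on one coordinate costs only one degree,
  -- whatever its values.
  polynomial-ofSign : ∀ {n} (a : Sign → Carrier) → PolynomialOfDegree≤ (cube {suc n}) 1 (λ z → a (Vec.head z))
  polynomial-ofSign a = polynomial-cong (λ { (Sign.+ ∷ z) → plus ; (Sign.- ∷ z) → minus })
    (polynomial-+ (polynomial-const (½ * (a Sign.+ + a Sign.-)))
      (polynomial-*ˡ (½ * (a Sign.+ - a Sign.-)) polynomial-head))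
    where
    plus : ½ * (a Sign.+ + a Sign.-) + ½ * (a Sign.+ - a Sign.-) * 1# ≈ a Sign.+
    plus = trans (solve 3 (λ h u v → h :* (u :+ v) :+ h :* (u :- v) :* con (pos 1) := con (pos 2) :* h :* u) refl
      ½ (a Sign.+) (a Sign.-)) (trans (*-congʳ 2*½≈1) (*-identityˡ _))
    minus : ½ * (a Sign.+ + a Sign.-) + ½ * (a Sign.+ - a Sign.-) * - 1# ≈ a Sign.-
    minus = trans (solve 3 (λ h u v → h :* (u :+ v) :+ h :* (u :- v) :* (:- con (pos 1))
        := con (pos 2) :* h :* v) refl
      ½ (a Sign.+) (a Sign.-)) (trans (*-congʳ 2*½≈1) (*-identityˡ _))

  indicator : Sign → Sign → Carrier
  indicator Sign.+ Sign.+ = 1#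
  indicator Sign.- Sign.- = 1#
  indicator _ _ = 0#

  -- The two branches on the first coordinate are multiplied by indicators of degree 1. The outcome
  -- caps the degree of `F` by `n`, from which `30 δ ≤ 1` follows.
  polynomial-onCube : ∀ {n} (g : Vec Sign n → Carrier) → PolynomialOfDegree≤ cube n g
  polynomial-onCube {zero} g = polynomial-cong (λ { [] → refl }) (polynomial-const (g []))
  polynomial-onCube {suc n} g = polynomial-cong (λ { (Sign.+ ∷ z) → first (g _) (g _) ; (Sign.- ∷ z) →
      second (g _) (g _) })
    (polynomial-+ (branch Sign.+) (branch Sign.-))
    where
    branch : ∀ σ → PolynomialOfDegree≤ cube (suc n) (λ z → indicator σ (Vec.head z) * g (σ ∷ Vec.tail z))
    branch σ = polynomial-* (polynomial-ofSign (indicator σ))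
        (polynomial-tail (polynomial-onCube (λ z → g (σ ∷ z))))
    first : ∀ x y → 1# * x + 0# * y ≈ x
    first = solve 2 (λ x y → con (pos 1) :* x :+ con (pos 0) :* y := x) refl
    second : ∀ x y → 0# * x + 1# * y ≈ y
    second = solve 2 (λ x y → con (pos 0) :* x :+ con (pos 1) :* y := y) refl

  -- Sign amplification

  scaled : ℕ → Carrier → Carrier
  scaled zero t = t
  scaled (suc j) t = fromℕ 2 * scaled j t

  -- With t = sin φ, bump j t = sin²(2ʲφ) / (2ʲ sin φ), which is a polynomial of
  -- degree 2ʲ⁺¹ − 1; the recursion is the double-angle formula.
  bump : ℕ → Carrier → Carrier
  bump zero t = t
  bump (suc j) t = fromℕ 2 * bump j t * (1# - scaled j t * bump j t)

  -- The bump of index `j` is large where `2ʲ t` lies between `1/2` and 1 and decays geometrically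
  -- on either side. The sum is thus bounded above on the unit interval and bounded below down to
  -- about `2⁻ᴶ`: a crude odd sign function.
  bumpSum : ℕ → Carrier → Carrier
  bumpSum zero t = t
  bumpSum (suc j) t = bumpSum j t + bump (suc j) t

  -- The cubic with fixed points `-1`, 0, 1 and slope zero at `±1`; iteration drives nonzero values
  -- in `[-1, 1]` towards their sign.
  improve : Carrier → Carrier
  improve y = ½ * (fromℕ 3 * y - y * y * y)

  improveBy : ℕ → Carrier → Carrier
  improveBy zero y = y
  improveBy (suc k) y = improve (improveBy k y)

  -- Kept abstract lest the type checker compute with 3 ^ steps.
  abstract
    steps : ℕ
    steps = 42

    42≤steps : 42 ℕ.≤ steps
    42≤steps = ℕₚ.≤-refl

  -- Values within `ε < 1` of a sign are at most 2 in absolute value, and the inner `½` brings them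
  -- into the range of the bump bounds. The outer two divide by 4, the upper bound of `bumpSum`, so
  -- that `improve` starts inside `[-1, 1]`.
  amplify : ℕ → Carrier → Carrier
  amplify J y = improveBy steps (½ * (½ * bumpSum J (½ * y)))

  scaled-odd : ∀ j t → scaled j (- t) ≈ - scaled j t
  scaled-odd zero t = refl
  scaled-odd (suc j) t = trans (*-congˡ (scaled-odd j t)) (sym (-‿distribʳ-* _ _))

  bump-odd : ∀ j t → bump j (- t) ≈ - bump j t
  bump-odd zero t = refl
  bump-odd (suc j) t = trans
    (*-cong (*-congˡ (bump-odd j t)) (+-congˡ (-‿cong (*-cong (scaled-odd j t) (bump-odd j t)))))
    (solve 2 (λ a b → con (pos 2) :* (:- b) :* (con (pos 1) :- (:- a) :* (:- b))
                := :- (con (pos 2) :* b :* (con (pos 1) :- a :* b))) refl (scaled j t) (bump j t))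

  bumpSum-odd : ∀ j t → bumpSum j (- t) ≈ - bumpSum j t
  bumpSum-odd zero t = refl
  bumpSum-odd (suc j) t = trans (+-cong (bumpSum-odd j t) (bump-odd (suc j) t)) (-‿+-comm _ _)

  bump-cong : ∀ j {s t} → s ≈ t → scaled j s ≈ scaled j t × bump j s ≈ bump j t
  bump-cong zero s≈t = s≈t , s≈t
  bump-cong (suc j) s≈t with bump-cong j s≈t
  ... | a≈ , b≈ = *-congˡ a≈ , *-cong (*-congˡ b≈) (+-congˡ (-‿cong (*-cong a≈ b≈)))

  bumpSum-cong : ∀ j {s t} → s ≈ t → bumpSum j s ≈ bumpSum j t
  bumpSum-cong zero s≈t = s≈t
  bumpSum-cong (suc j) s≈t = +-cong (bumpSum-cong j s≈t) (proj₂ (bump-cong (suc j) s≈t))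

  improve-cong : ∀ {x y} → x ≈ y → improve x ≈ improve y
  improve-cong x≈y = *-congˡ (+-cong (*-congˡ x≈y) (-‿cong (*-cong (*-cong x≈y x≈y) x≈y)))

  improveBy-odd : ∀ k {x y} → x ≈ - y → improveBy k x ≈ - improveBy k y
  improveBy-odd zero x≈-y = x≈-y
  improveBy-odd (suc k) {x} {y} x≈-y = trans (improve-cong (improveBy-odd k x≈-y))
    (solve 2 (λ h y → h :* (con (pos 3) :* (:- y) :- (:- y) :* (:- y) :* (:- y))
                := :- (h :* (con (pos 3) :* y :- y :* y :* y))) refl ½ (improveBy k y))

  amplify-odd : ∀ J y → amplify J (- y) ≈ - amplify J y
  amplify-odd J y = improveBy-odd steps (trans (*-congˡ (*-congˡ (trans
    (bumpSum-cong J (sym (-‿distribʳ-* ½ y))) (bumpSum-odd J (½ * y)))))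
    (solve 2 (λ h s → h :* (h :* (:- s)) := :- (h :* (h :* s))) refl ½ (bumpSum J (½ * y))))

  bumpDegree : ℕ → ℕ → ℕ
  bumpDegree d zero = d
  bumpDegree d (suc j) = bumpDegree d j ℕ.+ (d ℕ.+ bumpDegree d j)

  bumpDegree+d≡2^[1+j]*d : ∀ d j → bumpDegree d j ℕ.+ d ≡ 2 ℕ.^ suc j ℕ.* d
  bumpDegree+d≡2^[1+j]*d d zero = solveℕ 1 (λ d → d ⊕ d ⊜ lit 2 ⊗ d) ≡.refl d
  bumpDegree+d≡2^[1+j]*d d (suc j) = ≡.trans
    (solveℕ 2 (λ b d → b ⊕ (d ⊕ b) ⊕ d ⊜ lit 2 ⊗ (b ⊕ d)) ≡.refl (bumpDegree d j) d)
    (≡.trans (≡.cong (2 ℕ.*_) (bumpDegree+d≡2^[1+j]*d d j)) (≡.sym (ℕₚ.*-assoc 2 (2 ℕ.^ suc j) d)))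

  module _ {A : Set} {N} {pt : A → Point N} {d} {g : A → Carrier} (pg : PolynomialOfDegree≤ pt d g) where

    polynomial-scaled : ∀ j → PolynomialOfDegree≤ pt d (λ x → scaled j (g x))
    polynomial-scaled zero = pg
    polynomial-scaled (suc j) = polynomial-*ˡ (fromℕ 2) (polynomial-scaled j)

    polynomial-bump : ∀ j → PolynomialOfDegree≤ pt (bumpDegree d j) (λ x → bump j (g x))
    polynomial-bump zero = pg
    polynomial-bump (suc j) = polynomial-* (polynomial-*ˡ (fromℕ 2) (polynomial-bump j))
      (polynomial-+ (polynomial-const 1#)
        (polynomial-cong (λ x → sym (-1* _))
          (polynomial-*ˡ (- 1#) (polynomial-* (polynomial-scaled j) (polynomial-bump j)))))
      where
      -1* : ∀ x → - x ≈ - 1# * x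
      -1* = solve 1 (λ x → :- x := (:- con (pos 1)) :* x) refl

    polynomial-bumpSum : ∀ j → PolynomialOfDegree≤ pt (bumpDegree d j) (λ x → bumpSum j (g x))
    polynomial-bumpSum zero = pg
    polynomial-bumpSum (suc j) =
      polynomial-+ (polynomial-weaken (ℕₚ.m≤m+n _ _) (polynomial-bumpSum j)) (polynomial-bump (suc j))

    polynomial-improveBy : ∀ k → PolynomialOfDegree≤ pt (3 ℕ.^ k ℕ.* d) (λ x → improveBy k (g x))
    polynomial-improveBy zero = ≡.subst (λ e → PolynomialOfDegree≤ pt e g) (≡.sym (ℕₚ.*-identityˡ d)) pg
    polynomial-improveBy (suc k) = polynomial-*ˡ ½ (polynomial-cong (λ x → +-congˡ (sym (-1* _)))
      (polynomial-+ (polynomial-weaken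
          (ℕₚ.≤-trans (ℕₚ.m≤m+n _ _) (ℕₚ.≤-trans (ℕₚ.m≤m+n _ _) (ℕₚ.≤-reflexive triple)))
          (polynomial-*ˡ (fromℕ 3) ih))
        (polynomial-weaken (ℕₚ.≤-reflexive triple)
          (polynomial-*ˡ (- 1#) (polynomial-* (polynomial-* ih ih) ih)))))
      where
      ih = polynomial-improveBy k
      -1* : ∀ x → - x ≈ - 1# * x
      -1* = solve 1 (λ x → :- x := (:- con (pos 1)) :* x) refl
      e = 3 ℕ.^ k ℕ.* d
      triple : e ℕ.+ e ℕ.+ e ≡ 3 ℕ.^ suc k ℕ.* d
      triple = ≡.trans (solveℕ 1 (λ e → e ⊕ e ⊕ e ⊜ lit 3 ⊗ e) ≡.refl e)
        (≡.sym (ℕₚ.*-assoc 3 (3 ℕ.^ k) d))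

  κ : ℕ
  κ = 3 ℕ.^ steps

  polynomial-amplify : ∀ {A : Set} {N} {pt : A → Point N} {d} {g : A → Carrier} J →
    PolynomialOfDegree≤ pt d g → PolynomialOfDegree≤ pt (κ ℕ.* (2 ℕ.^ suc J ℕ.* d)) (λ x → amplify J (g x))
  polynomial-amplify {d = d} J pg = polynomial-improveBy (polynomial-*ˡ ½ (polynomial-*ˡ ½
    (polynomial-weaken (≡.subst (bumpDegree d J ℕ.≤_) (bumpDegree+d≡2^[1+j]*d d J) (ℕₚ.m≤m+n _ _))
      (polynomial-bumpSum (polynomial-*ˡ ½ pg) J)))) steps

  module _ {t} (0≤t : 0# ≤ t) (t≤1 : t ≤ 1#) where

    private
      0≤2 : 0# ≤ fromℕ 2
      0≤2 = fromℕ-nonNegative 2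

    scaled-nonNegative : ∀ j → 0# ≤ scaled j t
    scaled-nonNegative zero = 0≤t
    scaled-nonNegative (suc j) = *-nonNegative 0≤2 (scaled-nonNegative j)

    -- Here `a * b` is `sin²(2ʲφ)`. Doubling the angle applies the logistic map
    -- `4 s (1 - s) = 1 - (1 - 2 s)²` to it, which never exceeds 1.
    bump-bounds : ∀ j → let a = scaled j t; b = bump j t in 0# ≤ b × b ≤ a × a * b ≤ 1#
    bump-bounds zero = 0≤t , Ord.refl , slack⇒≤
      (+-nonNegative (slack t≤1) (*-nonNegative 0≤t (slack t≤1)))
      (solve 1 (λ t → con (pos 1) :- t :* t := (con (pos 1) :- t) :+ t :* (con (pos 1) :- t)) refl t)
    bump-bounds (suc j) with bump-bounds j
    ... | 0≤b , b≤a , ab≤1 =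
      *-nonNegative (*-nonNegative 0≤2 0≤b) (slack ab≤1) ,
      slack⇒≤ (*-nonNegative 0≤2 (+-nonNegative (slack b≤a)
          (*-nonNegative (*-nonNegative (scaled-nonNegative j) 0≤b) 0≤b)))
        (solve 2 (λ a b → con (pos 2) :* a :- con (pos 2) :* b :* (con (pos 1) :- a :* b)
                    := con (pos 2) :* ((a :- b) :+ a :* b :* b)) refl a b) ,
      slack⇒≤ (square-nonNegative (1# - fromℕ 2 * (a * b)))
        (solve 2 (λ a b → con (pos 1) :- con (pos 2) :* a :* (con (pos 2) :* b :* (con (pos 1) :- a :* b))
                    := (con (pos 1) :- con (pos 2) :* (a :* b)) :* (con (pos 1) :- con (pos 2) :* (a :* b)))
                        refl a b)
      where
      a = scaled j t
      b = bump j t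

    -- The cubic `a - a³/3` begins the expansion of `sin²(a) / a`. The doubling step reproduces it
    -- exactly once `b²` is replaced by the larger `a²`.
    bump-lower : ∀ j → let a = scaled j t; b = bump j t in fromℕ 3 * a - a * a * a ≤ fromℕ 3 * b
    bump-lower zero = slack⇒≤ (*-nonNegative (*-nonNegative 0≤t 0≤t) 0≤t)
      (solve 1 (λ t → con (pos 3) :* t :- (con (pos 3) :* t :- t :* t :* t) := t :* t :* t) refl t)
    bump-lower (suc j) with bump-bounds j
    ... | 0≤b , b≤a , ab≤1 = slack⇒≤
      (+-nonNegative (*-nonNegative 0≤2 (slack (bump-lower j)))
        (*-nonNegative (fromℕ-nonNegative 6) (*-nonNegative (scaled-nonNegative j)
          (*-nonNegative (slack b≤a) (+-nonNegative (scaled-nonNegative j) 0≤b)))))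
      (solve 2 (λ a b → con (pos 3) :* (con (pos 2) :* b :* (con (pos 1) :- a :* b))
                  :- (con (pos 3) :* (con (pos 2) :* a) :- con (pos 2) :* a :* (con (pos 2) :* a) :*
                      (con (pos 2) :* a))
                := con (pos 2) :* (con (pos 3) :* b :- (con (pos 3) :* a :- a :* a :* a))
                  :+ con (pos 6) :* (a :* ((a :- b) :* (a :+ b)))) refl (scaled j t) (bump j t))

    bumpSum-nonNegative : ∀ j → 0# ≤ bumpSum j t
    bumpSum-nonNegative zero = 0≤t
    bumpSum-nonNegative (suc j) = +-nonNegative (bumpSum-nonNegative j) (proj₁ (bump-bounds (suc j)))

    -- Up to scale 1 the bumps are at most the geometric sequence 2ʲ t, beyond it
    -- at most its inverse.
    bumpSum-upper : ∀ j → let a = scaled j t; s = bumpSum j t in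
                    a ≤ 1# × s ≤ fromℕ 2 * a ⊎ 1# ≤ a × s * a ≤ fromℕ 4 * a - 1#
    bumpSum-upper zero = inj₁ (t≤1 , slack⇒≤ 0≤t (solve 1 (λ t → con (pos 2) :* t :- t := t) refl t))
    bumpSum-upper (suc j) = [ small , large ]′ (bumpSum-upper j)
      where
      x = scaled j t
      S = bumpSum j t
      b = bump (suc j) t
      b≤2x : b ≤ fromℕ 2 * x
      b≤2x = proj₁ (proj₂ (bump-bounds (suc j)))
      2xb≤1 : fromℕ 2 * x * b ≤ 1#
      2xb≤1 = proj₂ (proj₂ (bump-bounds (suc j)))
      0≤x : 0# ≤ x
      0≤x = scaled-nonNegative j
      Goal = fromℕ 2 * x ≤ 1# × S + b ≤ fromℕ 2 * (fromℕ 2 * x) ⊎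
             1# ≤ fromℕ 2 * x × (S + b) * (fromℕ 2 * x) ≤ fromℕ 4 * (fromℕ 2 * x) - 1#
      large : 1# ≤ x × S * x ≤ fromℕ 4 * x - 1# → Goal
      large (1≤x , Sx≤4x-1) = inj₂
        ( slack⇒≤ (+-nonNegative (slack 1≤x) 0≤x)
            (solve 1 (λ x → con (pos 2) :* x :- con (pos 1) := (x :- con (pos 1)) :+ x) refl x)
        , slack⇒≤ (+-nonNegative (*-nonNegative 0≤2 (slack Sx≤4x-1)) (slack 2xb≤1))
            (solve 3 (λ x s b → con (pos 4) :* (con (pos 2) :* x) :- con (pos 1) :- (s :+ b) :* (con (pos 2) :* x)
                        := con (pos 2) :* (con (pos 4) :* x :- con (pos 1) :- s :* x)
                           :+ (con (pos 1) :- con (pos 2) :* x :* b)) refl x S b))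
      small : x ≤ 1# × S ≤ fromℕ 2 * x → Goal
      small (x≤1 , S≤2x) with fromℕ 2 * x Ord.≤? 1#
      ... | yes 2x≤1 = inj₁ (2x≤1 , slack⇒≤ (+-nonNegative (slack S≤2x) (slack b≤2x))
              (solve 3 (λ x s b → con (pos 2) :* (con (pos 2) :* x) :- (s :+ b)
                          := (con (pos 2) :* x :- s) :+ (con (pos 2) :* x :- b)) refl x S b))
      ... | no 2x≰1 = inj₂ (≰⇒≥ 2x≰1 , slack⇒≤
              (+-nonNegative (+-nonNegative (*-nonNegative (*-nonNegative 0≤2 0≤x) (slack S≤2x)) (slack 2xb≤1))
                (+-nonNegative (*-nonNegative (*-nonNegative 0≤2 (slack x≤1)) (slack (≰⇒≥ 2x≰1)))
                  (*-nonNegative 0≤2 0≤x)))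
              (solve 3 (λ x s b → con (pos 4) :* (con (pos 2) :* x) :- con (pos 1) :- (s :+ b) :* (con (pos 2) :* x)
                          := (con (pos 2) :* x) :* (con (pos 2) :* x :- s) :+ (con (pos 1) :- con (pos 2) :* x :* b)
                            :+ (con (pos 2) :* (con (pos 1) :- x) :*
                                (con (pos 2) :* x :- con (pos 1)) :+ con (pos 2) :* x)) refl
                x S b))

    -- The second alternative is `s ≤ 4 - 1/a` with the denominator cleared; the term `1/a` is the
    -- room that the induction reserves for the remaining geometric tail.
    bumpSum≤4 : ∀ j → bumpSum j t ≤ fromℕ 4
    bumpSum≤4 j with bumpSum-upper j
    ... | inj₁ (a≤1 , s≤2a) = slack⇒≤
      (+-nonNegative (+-nonNegative (slack s≤2a) (*-nonNegative 0≤2 (slack a≤1))) 0≤2)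
      (solve 2 (λ a s → con (pos 4) :- s
          := (con (pos 2) :* a :- s) :+ con (pos 2) :* (con (pos 1) :- a) :+ con (pos 2)) refl
        (scaled j t) (bumpSum j t))
    ... | inj₂ (1≤a , sa≤4a-1) = *-cancelˡ-≤ (1≤⇒0< 1≤a) (slack⇒≤ (+-nonNegative (slack sa≤4a-1) 0≤1)
      (solve 2 (λ a s → a :* con (pos 4) :- a :* s
          := (con (pos 4) :* a :- con (pos 1) :- s :* a) :+ con (pos 1)) refl
        (scaled j t) (bumpSum j t)))

    -- For `0 ≤ a ≤ 1` the cubic of `bump-lower` satisfies `3 a - a³ ≥ 2 a`.
    bump-large : ∀ j → scaled j t ≤ 1# → 1# ≤ fromℕ 2 * scaled j t → 1# ≤ fromℕ 3 * bump j t
    bump-large j a≤1 1≤2a = ≤-trans 1≤2a (≤-trans (slack⇒≤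
      (*-nonNegative (scaled-nonNegative j)
          (+-nonNegative (slack a≤1) (*-nonNegative (scaled-nonNegative j) (slack a≤1))))
      (solve 1 (λ a → con (pos 3) :* a :- a :* a :* a :- con (pos 2) :* a
                  := a :* ((con (pos 1) :- a) :+ a :* (con (pos 1) :- a))) refl (scaled j t)))
      (bump-lower j))

    -- At the first index with `2 a > 1` one still has `a ≤ 1`, because `a` has only doubled, so
    -- this single bump is at least `1/3`. Later bumps are nonnegative and cannot lower the sum.
    bumpSum-lower : ∀ j → 1# ≤ fromℕ 3 * bumpSum j t ⊎ fromℕ 2 * scaled j t ≤ 1#
    bumpSum-lower zero with fromℕ 2 * t Ord.≤? 1#
    ... | yes 2t≤1 = inj₂ 2t≤1
    ... | no 2t≰1 = inj₁ (bump-large 0 t≤1 (≰⇒≥ 2t≰1))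
    bumpSum-lower (suc j) with bumpSum-lower j | fromℕ 2 * scaled (suc j) t Ord.≤? 1#
    ... | _ | yes 2a≤1 = inj₂ 2a≤1
    ... | inj₁ 1≤3s | no _ = inj₁ (≤-trans 1≤3s (*-monoˡ-≤ (fromℕ-nonNegative 3)
      (slack⇒≤ (proj₁ (bump-bounds (suc j))) (solve 2 (λ s b → s :+ b :- s
          := b) refl (bumpSum j t) (bump (suc j) t)))))
    ... | inj₂ a≤1 | no 2a≰1 = inj₁ (≤-trans (bump-large (suc j) a≤1 (≰⇒≥ 2a≰1)) (*-monoˡ-≤ (fromℕ-nonNegative 3)
      (slack⇒≤ (bumpSum-nonNegative j) (solve 2 (λ s b → s :+ b :- b := s) refl (bumpSum j t) (bump (suc j) t)))))

  scaled≈2^* : ∀ j t → scaled j t ≈ fromℕ (2 ℕ.^ j) * t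
  scaled≈2^* zero t = solve 1 (λ t → t := (con (pos 1) :+ con (pos 0)) :* t) refl t
  scaled≈2^* (suc j) t = trans (*-congˡ (scaled≈2^* j t))
    (trans (sym (*-assoc _ _ _)) (*-congʳ (sym (fromℕ-* 2 (2 ℕ.^ j)))))

  private
    2*[½*x]≈x : ∀ x → fromℕ 2 * (½ * x) ≈ x
    2*[½*x]≈x x = trans (sym (*-assoc _ _ _)) (trans (*-congʳ 2*½≈1) (*-identityˡ x))

    0<2 : 0# < fromℕ 2
    0<2 = 0<fromℕ 2

  ½*-≤ : ∀ {x y} → x ≤ fromℕ 2 * y → ½ * x ≤ y
  ½*-≤ {x} x≤2y = *-cancelˡ-≤ 0<2 (≤-trans (≤-reflexive (2*[½*x]≈x x)) x≤2y)

  ≤-½* : ∀ {x y} → fromℕ 2 * y ≤ x → y ≤ ½ * x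
  ≤-½* {x} 2y≤x = *-cancelˡ-≤ 0<2 (≤-trans 2y≤x (≤-reflexive (sym (2*[½*x]≈x x))))

  improve≤1 : ∀ {y} → 0# ≤ y → improve y ≤ 1#
  improve≤1 {y} 0≤y = ½*-≤ (slack⇒≤
    (*-nonNegative (square-nonNegative (1# - y)) (+-nonNegative (fromℕ-nonNegative 2) 0≤y))
    (solve 1 (λ y → con (pos 2) :* con (pos 1) :- (con (pos 3) :* y :- y :* y :* y)
                := (con (pos 1) :- y) :* (con (pos 1) :- y) :* (con (pos 2) :+ y)) refl y))

  improve-increases : ∀ {y} → 0# ≤ y → y ≤ 1# → y ≤ improve y
  improve-increases {y} 0≤y y≤1 = ≤-½* (slack⇒≤
    (*-nonNegative 0≤y (*-nonNegative (slack y≤1) (+-nonNegative 0≤1 0≤y)))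
    (solve 1 (λ y → con (pos 3) :* y :- y :* y :* y :- con (pos 2) :* y
                := y :* ((con (pos 1) :- y) :* (con (pos 1) :+ y))) refl y))

  improve-gain : ∀ {y} → 0# ≤ y → 1# ≤ fromℕ 12 * y → fromℕ 3 * y ≤ fromℕ 2 →
                 1# + fromℕ 72 * y ≤ fromℕ 72 * improve y
  improve-gain {y} 0≤y 1≤12y 3y≤2 = ≤-trans (slack⇒≤
    (+-nonNegative (*-nonNegative (*-nonNegative (*-nonNegative (fromℕ-nonNegative 12) 0≤y)
        (+-nonNegative 0≤1 (slack 3y≤2))) 0≤y)
      (+-nonNegative (+-nonNegative (slack 1≤12y) (slack 3y≤2)) (*-nonNegative (slack 1≤12y) (slack 3y≤2))))
    (solve 1 (λ y → con (pos 36) :* (con (pos 3) :* y :- y :* y :* y) :- (con (pos 1) :+ con (pos 72) :* y)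
                := con (pos 12) :* y :* (con (pos 1) :+ (con (pos 2) :- con (pos 3) :* y)) :* y
                  :+ ((con (pos 12) :* y :- con (pos 1)) :+ (con (pos 2) :- con (pos 3) :* y)
                     :+ (con (pos 12) :* y :- con (pos 1)) :* (con (pos 2) :- con (pos 3) :* y))) refl y))
    (≤-reflexive (trans (*-congˡ (sym (2*[½*x]≈x _)))
      (solve 2 (λ h z → con (pos 36) :* (con (pos 2) :* (h :* z)) := con (pos 72) :* (h :* z)) refl ½ _)))

  module _ {y} (0≤y : 0# ≤ y) (y≤1 : y ≤ 1#) (6≤72y : fromℕ 6 ≤ fromℕ 72 * y) where

    improveBy-bounds : ∀ k → 0# ≤ improveBy k y × improveBy k y ≤ 1#
    improveBy-bounds zero = 0≤y , y≤1
    improveBy-bounds (suc k) with improveBy-bounds k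
    ... | 0≤z , z≤1 = ≤-trans 0≤z (improve-increases 0≤z z≤1) , improve≤1 0≤z

    -- In units of `1/72` the start is 6, each step below `2/3` gains at least one unit, and `2/3`
    -- is 48 units: this is where 42 steps come from.
    improveBy-progress : ∀ k → fromℕ 2 ≤ fromℕ 3 * improveBy k y ⊎ fromℕ (6 ℕ.+ k) ≤ fromℕ 72 * improveBy k y
    improveBy-progress zero = inj₂ 6≤72y
    improveBy-progress (suc k) with improveBy-bounds k | improveBy-progress k
    ... | 0≤z , z≤1 | inj₁ 2≤3z = inj₁ (≤-trans 2≤3z (*-monoˡ-≤ (fromℕ-nonNegative 3) (improve-increases 0≤z z≤1)))
    ... | 0≤z , z≤1 | inj₂ 6+k≤72z with fromℕ 3 * improveBy k y Ord.≤? fromℕ 2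
    ...   | no 3z≰2 = inj₁ (≤-trans (≰⇒≥ 3z≰2) (*-monoˡ-≤ (fromℕ-nonNegative 3) (improve-increases 0≤z z≤1)))
    ...   | yes 3z≤2 = inj₂ (≤-trans (+-mono-≤ Ord.refl 6+k≤72z) (improve-gain 0≤z 1≤12z 3z≤2))
      where
      1≤12z : 1# ≤ fromℕ 12 * improveBy k y
      1≤12z = *-cancelˡ-≤ (0<fromℕ 6) (≤-trans
        (≤-trans (≤-reflexive (*-identityʳ _)) (≤-trans (fromℕ-mono (ℕₚ.m≤m+n 6 k)) 6+k≤72z))
        (≤-reflexive (solve 1 (λ z → con (pos 72) :* z := con (pos 6) :* (con (pos 12) :* z))
            refl (improveBy k y))))

    improveBy-steps : fromℕ 2 ≤ fromℕ 3 * improveBy steps y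
    improveBy-steps with improveBy-progress steps
    ... | inj₁ 2≤3z = 2≤3z
    ... | inj₂ 6+k≤72z = *-cancelˡ-≤ (0<fromℕ 24) (≤-trans
      (≤-reflexive (sym (fromℕ-* 24 2)))
      (≤-trans (fromℕ-mono (ℕₚ.+-monoʳ-≤ 6 42≤steps)) (≤-trans 6+k≤72z
        (≤-reflexive (solve 1 (λ z → con (pos 72) :* z := con (pos 24) :* (con (pos 3) :* z)) refl _)))))

  -- `2 ≤ 2ᴶ δ` and `δ ≤ y` put `scaled J (½ * y)` at 1 or above, which excludes the second
  -- alternative of `bumpSum-lower`. The bump sum then lies in `[1/3, 4]` and its quarter in
  -- `[1/12, 1]`, where `improveBy` starts.
  amplify-bounds : ∀ J {y δ} → fromℕ 2 ≤ fromℕ (2 ℕ.^ J) * δ → δ ≤ y → 0# ≤ y → y ≤ fromℕ 2 →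
                   amplify J y ≤ 1# × fromℕ 2 ≤ fromℕ 3 * amplify J y
  amplify-bounds J {y} {δ} 2≤2^Jδ δ≤y 0≤y y≤2 =
    proj₂ (improveBy-bounds 0≤s s≤1 6≤72s steps) , improveBy-steps 0≤s s≤1 6≤72s
    where
    t = ½ * y
    0≤t : 0# ≤ t
    0≤t = ≤-½* (≤-trans (≤-reflexive (zeroʳ _)) 0≤y)
    t≤1 : t ≤ 1#
    t≤1 = ½*-≤ (≤-trans y≤2 (≤-reflexive (sym (*-identityʳ _))))
    s = ½ * (½ * bumpSum J t)
    0≤s : 0# ≤ s
    0≤s = ≤-½* (≤-trans (≤-reflexive (zeroʳ _))
        (≤-½* (≤-trans (≤-reflexive (zeroʳ _)) (bumpSum-nonNegative 0≤t t≤1 J))))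
    4s≈S : fromℕ 4 * s ≈ bumpSum J t
    4s≈S = trans (solve 2 (λ h z → con (pos 4) :* (h :* (h :* z))
        := con (pos 2) :* (h :* (con (pos 2) :* (h :* z)))) refl ½ _)
      (trans (2*[½*x]≈x _) (2*[½*x]≈x _))
    s≤1 : s ≤ 1#
    s≤1 = *-cancelˡ-≤ (0<fromℕ 4) (≤-trans (≤-reflexive 4s≈S)
      (≤-trans (bumpSum≤4 0≤t t≤1 J) (≤-reflexive (sym (*-identityʳ _)))))
    2≤2a : fromℕ 2 ≤ fromℕ 2 * scaled J t
    2≤2a = ≤-trans 2≤2^Jδ (≤-trans (*-monoˡ-≤ (fromℕ-nonNegative (2 ℕ.^ J)) δ≤y)
      (≤-reflexive (sym (trans (*-congˡ (scaled≈2^* J t))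
        (trans (solve 2 (λ p t → con (pos 2) :* (p :* t) := p :* (con (pos 2) :* t)) refl (fromℕ (2 ℕ.^ J)) t)
          (*-congˡ (2*[½*x]≈x y)))))))
    1≤3S : 1# ≤ fromℕ 3 * bumpSum J t
    1≤3S = [ id , (λ 2a≤1 → ⊥-elim (1≰0 (slack⇒≤ (slack (≤-trans 2≤2a 2a≤1))
      (solve 0 (con (pos 0) :- con (pos 1) := con (pos 1) :- con (pos 2)) refl)))) ]′ (bumpSum-lower 0≤t t≤1 J)
    6≤72s : fromℕ 6 ≤ fromℕ 72 * s
    6≤72s = ≤-trans (≤-reflexive (sym (*-identityʳ _))) (≤-trans (*-monoˡ-≤ (fromℕ-nonNegative 6) 1≤3S)
      (≤-reflexive (trans (*-congˡ (*-congˡ (sym 4s≈S)))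
        (solve 1 (λ s → con (pos 6) :* (con (pos 3) :* (con (pos 4) :* s)) := con (pos 72) :* s) refl s))))

  3*1/3≈1 : fromℕ 3 * 1/3 ≈ 1#
  3*1/3≈1 = trans (solve 2 (λ t w → t :* ((con (pos 1) :+ con (pos 0)) :* w) := t :* w) refl (fromℕ 3) (fromℕ 3 ⁻¹))
    (proj₁ (inverse-positive (0<fromℕ 3)))

  private
    ∣1-q∣≤1/3 : ∀ {q} → q ≤ 1# × fromℕ 2 ≤ fromℕ 3 * q → ∣ 1# - q ∣≤ 1/3
    ∣1-q∣≤1/3 {q} (q≤1 , 2≤3q) = ∣∣≤-nonNegative (slack q≤1) (*-cancelˡ-≤ (0<fromℕ 3)
      (≤-trans (slack⇒≤ (slack 2≤3q)
        (solve 1 (λ q → con (pos 1) :- con (pos 3) :* (con (pos 1) :- q) := con (pos 3) :* q :- con (pos 2))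
            refl q))
        (≤-reflexive (sym 3*1/3≈1))))

  -- The approximant is composed with `amplify J`, which is odd, so that the sign `-` is the case of
  -- `+` negated. For `2ᴶ` of order `1 / (1 - ε)` the degree grows by a factor of that order.
  approximable-amplify : ∀ {A : Set} {N} {pt : A → Point N} {f : A → Sign} {ε d} J →
    fromℕ 2 ≤ fromℕ (2 ℕ.^ J) * (1# - ε) →
    Approximable pt ε f d → Approximable pt 1/3 f (κ ℕ.* (2 ℕ.^ suc J ℕ.* d))
  approximable-amplify {pt = pt} {f} {ε} {d} J 2≤2^J[1-ε] (p , dp , p-approximates) =
    representative , hasDegree , λ x → ∣∣≤⇒abs≤
      (∣∣≤-cong (+-congˡ (-‿cong (sym (represents x)))) refl (close (f x) (abs≤⇒∣∣≤ (p-approximates x))))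
    where
    open PolynomialOfDegree≤ (polynomial-amplify J (polynomial {pt = pt} p dp (λ x → refl)))
    0≤1-ε : 0# ≤ 1# - ε
    0≤1-ε = *-cancelˡ-nonNegative (0<fromℕ (2 ℕ.^ J) {{ℕₚ.m^n≢0 2 J}}) (≤-trans (fromℕ-nonNegative 2) 2≤2^J[1-ε])
    near-1 : ∀ {y} → ∣ 1# - y ∣≤ ε → amplify J y ≤ 1# × fromℕ 2 ≤ fromℕ 3 * amplify J y
    near-1 {y} (1-y≤ε , y-1≤ε) = amplify-bounds J 2≤2^J[1-ε] 1-ε≤y (≤-trans 0≤1-ε 1-ε≤y)
      (slack⇒≤ (+-nonNegative (slack y-1≤ε) 0≤1-ε)
        (solve 2 (λ y ε → con (pos 2) :- y := (ε :- :- (con (pos 1) :- y)) :+ (con (pos 1) :- ε)) refl y ε))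
      where
      1-ε≤y : 1# - ε ≤ y
      1-ε≤y = slack⇒≤ (slack 1-y≤ε) (solve 2 (λ y ε → y :- (con (pos 1) :- ε) := ε :- (con (pos 1) :- y)) refl y ε)
    close : ∀ σ {y} → ∣ fromSign σ - y ∣≤ ε → ∣ fromSign σ - amplify J y ∣≤ 1/3
    close Sign.+ ∣1-y∣≤ε = ∣1-q∣≤1/3 (near-1 ∣1-y∣≤ε)
    close Sign.- {y} ∣-1-y∣≤ε = ∣∣≤-cong
      (trans (-‿cong (+-congˡ (-‿cong (amplify-odd J y))))
        (solve 1 (λ q → :- (con (pos 1) :- :- q) := :- con (pos 1) :- q) refl (amplify J y))) refl
      (∣∣≤-neg (∣1-q∣≤1/3 (near-1 (∣∣≤-cong
        (solve 1 (λ y → :- (:- con (pos 1) :- y) := con (pos 1) :- :- y) refl y) refl (∣∣≤-neg ∣-1-y∣≤ε)))))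

  -- Linear inequalities

  between : ∀ (ls us : List Carrier) → (∀ {l u} → l ∈ ls → u ∈ us → l ≤ u) →
            ∃ λ a → (∀ {l} → l ∈ ls → l ≤ a) × (∀ {u} → u ∈ us → a ≤ u)
  between [] [] ls≤us = 0# , (λ ()) , λ ()
  between [] (u ∷ us) ls≤us with between [] us (λ ())
  ... | a , _ , a≤us = MinOp._⊓_ u a , (λ ()) ,
    λ { (here ≡.refl) → MinOp.x⊓y≤x u a ; (there u∈us) → ≤-trans (MinOp.x⊓y≤y u a) (a≤us u∈us) }
  between (l ∷ ls) us ls≤us with between ls us (λ l∈ls → ls≤us (there l∈ls))
  ... | a , ls≤a , a≤us = max l a ,
    (λ { (here ≡.refl) → MaxOp.x≤x⊔y l a ; (there l∈ls) → ≤-trans (ls≤a l∈ls) (MaxOp.x≤y⊔x l a) }) ,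
    λ u∈us → MaxOp.⊔-lub (ls≤us (here ≡.refl) u∈us) (a≤us u∈us)

  -- Farkas' lemma by Fourier–Motzkin elimination.  The rows v of a system of
  -- inequalities live in any space V of formal combinations; each unknown is
  -- indexed by some e with coefficient φ e v, and β v is the right-hand side.
  module Farkas {E : Set} {V : Set r} (combine : Carrier → V → Carrier → V → V)
    (φ : E → V → Carrier) (β : V → Carrier)
    (φ-linear : ∀ e a v b w → φ e (combine a v b w) ≈ a * φ e v + b * φ e w)
    (β-linear : ∀ a v b w → β (combine a v b w) ≈ a * β v + b * β w)
    where

    -- Assignments are lists of values tagged with unknowns: when the unknowns are exponent vectors,
    -- a solution already is a `Polynomial` and `lhs` imitates `eval`.
    lhs : List (Carrier × E) → V → Carrier
    lhs p v = foldr (λ (a , e) s → a * φ e v + s) 0# p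

    lhs-linear : ∀ p a v b w → lhs p (combine a v b w) ≈ a * lhs p v + b * lhs p w
    lhs-linear [] a v b w = sym (trans (+-cong (zeroʳ a) (zeroʳ b)) (+-identityˡ 0#))
    lhs-linear ((x , e) ∷ p) a v b w = trans (+-cong (*-congˡ (φ-linear e a v b w)) (lhs-linear p a v b w))
      (solve 7 (λ x a b y z s t → x :* (a :* y :+ b :* z) :+ (a :* s :+ b :* t)
          := a :* (x :* y :+ s) :+ b :* (x :* z :+ t))
        refl x a b (φ e v) (φ e w) (lhs p v) (lhs p w))

    Solution : List E → List V → Set (r ⊔ ℓ)
    Solution es L = ∃ λ p → (∀ {a e} → (a , e) ∈ p → e ∈ es) × (∀ {v} → v ∈ L → lhs p v ≤ β v)

    Infeasible : List E → (V → Set ℓ) → Set (r ⊔ ℓ)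
    Infeasible es P = ∃ λ v → P v × (∀ {e} → e ∈ es → φ e v ≈ 0#) × β v < 0#

    -- Closure under nonnegative combinations replaces a record of the multipliers in a certificate.
    -- During elimination the predicate also accumulates the vanishing of the eliminated
    -- coefficients; at the end it says that the dual measures are nonnegative.
    Conic : (V → Set ℓ) → Set (r ⊔ ℓ)
    Conic P = ∀ {a v b w} → 0# ≤ a → 0# ≤ b → P v → P w → P (combine a v b w)

    module Elimination (e : E) (L : List V) where
      Positive Negative Null : V → Set ℓ
      Positive v = ¬ φ e v ≤ 0#
      Negative v = ¬ 0# ≤ φ e v
      Null v = φ e v ≤ 0# × 0# ≤ φ e v

      cross : V → V → V
      cross v w = combine (- φ e w) v (φ e v) w

      positive negative null eliminated : List V
      positive = filter (λ v → ¬? (φ e v Ord.≤? 0#)) L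
      negative = filter (λ v → ¬? (0# Ord.≤? φ e v)) L
      null = filter (λ v → φ e v Ord.≤? 0# ×-dec 0# Ord.≤? φ e v) L
      eliminated = null ++ cartesianProductWith cross positive negative

      ∈-positive⁻ : ∀ {v} → v ∈ positive → v ∈ L × Positive v
      ∈-positive⁻ = ∈-filter⁻ (λ v → ¬? (φ e v Ord.≤? 0#))
      ∈-negative⁻ : ∀ {v} → v ∈ negative → v ∈ L × Negative v
      ∈-negative⁻ = ∈-filter⁻ (λ v → ¬? (0# Ord.≤? φ e v))
      ∈-null⁻ : ∀ {v} → v ∈ null → v ∈ L × Null v
      ∈-null⁻ = ∈-filter⁻ (λ v → φ e v Ord.≤? 0# ×-dec 0# Ord.≤? φ e v)

      -‿nonNegative : ∀ {x} → x ≤ 0# → 0# ≤ - x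
      -‿nonNegative x≤0 = ≤-trans (≤-reflexive (sym -0#≈0#)) (neg-antimono-≤ x≤0)

      eliminated-satisfies : ∀ {P} → Conic P → (∀ {v} → v ∈ L → P v) →
                             ∀ {v} → v ∈ eliminated → P v × φ e v ≈ 0#
      eliminated-satisfies conic satisfied v∈ with ∈-++⁻ null v∈
      ... | inj₁ v∈null with ∈-null⁻ v∈null
      ...   | v∈L , φv≤0 , 0≤φv = satisfied v∈L , Ord.antisym φv≤0 0≤φv
      eliminated-satisfies conic satisfied v∈ | inj₂ v∈cross with ∈-cartesianProductWith⁻ cross positive negative v∈cross
      ... | v , w , v∈pos , w∈neg , ≡.refl with ∈-positive⁻ v∈pos | ∈-negative⁻ w∈neg
      ... | v∈L , φv≰0 | w∈L , 0≰φw =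
        conic (-‿nonNegative (≰⇒≥ 0≰φw)) (≰⇒≥ φv≰0) (satisfied v∈L) (satisfied w∈L) ,
        trans (φ-linear e (- φ e w) v (φ e v) w)
          (solve 2 (λ x y → (:- y) :* x :+ x :* y := con (pos 0)) refl (φ e v) (φ e w))

      module _ {es} (p : List (Carrier × E)) (p⊆es : ∀ {a e′} → (a , e′) ∈ p → e′ ∈ es)
               (solves : ∀ {v} → v ∈ eliminated → lhs p v ≤ β v) where

        slackOf : V → Carrier
        slackOf v = β v - lhs p v

        -- With the other values fixed, a row bounds the new value by its ratio: from above if its
        -- coefficient is positive, from below if it is negative.
        ratio : V → Carrier
        ratio v = slackOf v * φ e v ⁻¹

        φ*ratio : ∀ {v} → φ e v ≉ 0# → φ e v * ratio v ≈ slackOf v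
        φ*ratio {v} φv≉0 = trans (solve 3 (λ x s w → x :* (s :* w) := s :* (x :* w)) refl (φ e v)
            (slackOf v) (φ e v ⁻¹))
          (trans (*-congˡ (⁻¹-inverse φv≉0)) (*-identityʳ _))

        positive≉0 : ∀ {v} → Positive v → φ e v ≉ 0#
        positive≉0 φv≰0 φv≈0 = φv≰0 (≤-reflexive φv≈0)

        negative≉0 : ∀ {v} → Negative v → φ e v ≉ 0#
        negative≉0 0≰φv φv≈0 = 0≰φv (≤-reflexive (sym φv≈0))

        0<-negative : ∀ {v} → Negative v → 0# < - φ e v
        0<-negative 0≰φv = -‿nonNegative (≰⇒≥ 0≰φv) , λ 0≈-φv →
          negative≉0 0≰φv (trans (sym (-‿involutive _)) (trans (-‿cong (sym 0≈-φv)) -0#≈0#))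

        -- This is the inequality of the crossed row divided by the positive number
        -- `φ e v * (- φ e w)`.
        ratio-negative≤ratio-positive : ∀ {v w} → v ∈ positive → w ∈ negative → ratio w ≤ ratio v
        ratio-negative≤ratio-positive {v} {w} v∈pos w∈neg with ∈-positive⁻ v∈pos | ∈-negative⁻ w∈neg
        ... | _ , φv≰0 | _ , 0≰φw = *-cancelˡ-≤ (*-positive (≰⇒> φv≰0) (0<-negative 0≰φw))
          (slack⇒≤ (slack (solves (∈-++⁺ʳ null (∈-cartesianProductWith⁺ cross v∈pos w∈neg))))
            (trans (solve 4 (λ x y r t → x :* (:- y) :* r :- x :* (:- y) :* t
                := (:- y) :* (x :* r) :+ x :* (y :* t)) refl
                (φ e v) (φ e w) (ratio v) (ratio w))
              (trans (+-cong (*-congˡ (φ*ratio (positive≉0 φv≰0))) (*-congˡ (φ*ratio (negative≉0 0≰φw))))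
                (trans (solve 6 (λ x y s t s′ t′ → (:- y) :* (s :- t) :+ x :* (s′ :- t′)
                            := (:- y) :* s :+ x :* s′ :- ((:- y) :* t :+ x :* t′)) refl
                    (φ e v) (φ e w) (β v) (lhs p v) (β w) (lhs p w))
                  (sym (+-cong (β-linear (- φ e w) v (φ e v) w) (-‿cong (lhs-linear p (- φ e w) v (φ e v) w))))))))

        extend : Solution (e ∷ es) L
        extend with between (List.map ratio negative) (List.map ratio positive) lower≤upper
          where
          lower≤upper : ∀ {l u} → l ∈ List.map ratio negative → u ∈ List.map ratio positive → l ≤ u
          lower≤upper l∈ u∈ with ∈-map⁻ ratio l∈ | ∈-map⁻ ratio u∈
          ... | w , w∈neg , ≡.refl | v , v∈pos , ≡.refl = ratio-negative≤ratio-positive v∈pos w∈neg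
        ... | a , lower≤a , a≤upper = (a , e) ∷ p , ⊆e∷es , solved
          where
          ⊆e∷es : ∀ {b e′} → (b , e′) ∈ (a , e) ∷ p → e′ ∈ e ∷ es
          ⊆e∷es (here ≡.refl) = here ≡.refl
          ⊆e∷es (there e′∈p) = there (p⊆es e′∈p)

          solved-if : ∀ {v} → a * φ e v ≤ slackOf v → a * φ e v + lhs p v ≤ β v
          solved-if {v} aφ≤s = slack⇒≤ (slack aφ≤s)
            (solve 3 (λ x t b → b :- (x :+ t) := b :- t :- x) refl (a * φ e v) (lhs p v) (β v))

          solved : ∀ {v} → v ∈ L → a * φ e v + lhs p v ≤ β v
          solved {v} v∈L with φ e v Ord.≤? 0# | 0# Ord.≤? φ e v
          ... | no φv≰0 | _ = solved-if (≤-trans (≤-reflexive (*-comm a _))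
            (≤-trans (*-monoˡ-≤ (≰⇒≥ φv≰0) (a≤upper (∈-map⁺ ratio (∈-filter⁺ _ v∈L φv≰0))))
              (≤-reflexive (φ*ratio (positive≉0 φv≰0)))))
          ... | _ | no 0≰φv = solved-if (slack⇒≤
            (*-nonNegative (proj₁ (0<-negative 0≰φv)) (slack (lower≤a (∈-map⁺ ratio (∈-filter⁺ _ v∈L 0≰φv)))))
            (trans (+-congʳ (sym (φ*ratio (negative≉0 0≰φv))))
              (solve 3 (λ a x r → x :* r :- a :* x := (:- x) :* (a :- r)) refl a (φ e v) (ratio v))))
          ... | yes φv≤0 | yes 0≤φv = ≤-trans
            (≤-reflexive (trans (+-congʳ (trans (*-congˡ (Ord.antisym φv≤0 0≤φv)) (zeroʳ a))) (+-identityˡ _)))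
            (solves (∈-++⁺ˡ (∈-filter⁺ _ v∈L (φv≤0 , 0≤φv))))

    farkas : ∀ es {P} → Conic P → ∀ L → (∀ {v} → v ∈ L → P v) → Solution es L ⊎ Infeasible es P
    farkas [] conic [] satisfied = inj₁ ([] , (λ ()) , λ ())
    farkas [] conic (v ∷ L) satisfied with 0# Ord.≤? β v | farkas [] conic L (λ w∈L → satisfied (there w∈L))
    ... | no 0≰β | _ = inj₂ (v , satisfied (here ≡.refl) , (λ ()) , ≰⇒> 0≰β)
    ... | yes 0≤β | inj₂ infeasible = inj₂ infeasible
    ... | yes 0≤β | inj₁ (p , p⊆ , solves) with p | p⊆
    ...   | [] | _ = inj₁ ([] , (λ ()) , λ { (here ≡.refl) → 0≤β ; (there w∈L) → solves w∈L })
    ...   | _ ∷ _ | p⊆ with () ← p⊆ (here ≡.refl)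
    farkas (e ∷ es) {P} conic L satisfied
      with farkas es {λ v → P v × φ e v ≈ 0#} conic′ eliminated (eliminated-satisfies conic satisfied)
      where
      open Elimination e L
      conic′ : Conic (λ v → P v × φ e v ≈ 0#)
      conic′ {a} {v} {b} {w} 0≤a 0≤b (Pv , φv≈0) (Pw , φw≈0) = conic 0≤a 0≤b Pv Pw ,
        trans (φ-linear e a v b w) (trans (+-cong (trans (*-congˡ φv≈0) (zeroʳ a)) (trans (*-congˡ φw≈0) (zeroʳ b)))
          (+-identityˡ 0#))
    ... | inj₁ (p , p⊆es , solves) = inj₁ (Elimination.extend e L p p⊆es solves)
    ... | inj₂ (v , (Pv , φv≈0) , φs≈0 , β<0) = inj₂
        (v , Pv , (λ { (here ≡.refl) → φv≈0 ; (there e∈es) → φs≈0 e∈es }) , β<0)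

  -- Dual measures

  incrementHead : ∀ {N} → Vec ℕ (suc N) → Vec ℕ (suc N)
  incrementHead (k ∷ e) = suc k ∷ e

  exponents : ∀ N → ℕ → List (Vec ℕ N)
  exponents zero d = [] ∷ []
  exponents (suc N) zero = List.map (0 ∷_) (exponents N zero)
  exponents (suc N) (suc d) = List.map (0 ∷_) (exponents N (suc d)) ++ List.map incrementHead (exponents (suc N) d)

  ∈-exponents : ∀ {N d} (e : Vec ℕ N) → Vec.sum e ℕ.≤ d → e ∈ exponents N d
  ∈-exponents [] _ = here ≡.refl
  ∈-exponents {d = zero} (zero ∷ e) e≤d = ∈-map⁺ (0 ∷_) (∈-exponents e e≤d)
  ∈-exponents {d = suc d} (zero ∷ e) e≤d = ∈-++⁺ˡ (∈-map⁺ (0 ∷_) (∈-exponents e e≤d))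
  ∈-exponents {suc N} {d = suc d} (suc k ∷ e) (ℕ.s≤s e≤d) =
    ∈-++⁺ʳ (List.map (0 ∷_) (exponents N (suc d))) (∈-map⁺ incrementHead (∈-exponents (k ∷ e) e≤d))

  exponents-degree : ∀ N d → All (λ e → Vec.sum e ℕ.≤ d) (exponents N d)
  exponents-degree zero d = ℕ.z≤n ∷ []
  exponents-degree (suc N) zero = Allₚ.map⁺ (exponents-degree N zero)
  exponents-degree (suc N) (suc d) = Allₚ.++⁺ (Allₚ.map⁺ (exponents-degree N (suc d)))
    (Allₚ.map⁺ (All.map (λ { {k ∷ e} e≤d → ℕ.s≤s e≤d }) (exponents-degree (suc N) d)))

  indicator-nonNegative : ∀ σ τ → 0# ≤ indicator σ τ
  indicator-nonNegative Sign.+ Sign.+ = 0≤1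
  indicator-nonNegative Sign.- Sign.- = 0≤1
  indicator-nonNegative Sign.+ Sign.- = Ord.refl
  indicator-nonNegative Sign.- Sign.+ = Ord.refl

  indicator≤1 : ∀ σ τ → indicator σ τ ≤ 1#
  indicator≤1 Sign.+ Sign.+ = Ord.refl
  indicator≤1 Sign.- Sign.- = Ord.refl
  indicator≤1 Sign.+ Sign.- = 0≤1
  indicator≤1 Sign.- Sign.+ = 0≤1

  -- A pair of measures on the points with equal moments up to degree d that
  -- sees too much of f for f to have an ε-approximant of degree d.
  record Dual {s N} (pt : Fin s → Point N) (ε : Carrier) (f : Fin s → Sign) (d : ℕ) : Set (r ⊔ ℓ) where
    field
      measure     : Sign → Fin s → Carrier
      nonNegative : ∀ σ x → 0# ≤ measure σ x
      balanced    : ∀ e → Vec.sum e ℕ.≤ d →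
                    ∑ (λ x → monomial e (pt x) * measure Sign.+ x) ≈ ∑ (λ x → monomial e (pt x) * measure Sign.- x)
      correlated  : ∑ (λ x → (ε - 1# * fromSign (f x)) * measure Sign.+ x)
                    + ∑ (λ x → (ε - - 1# * fromSign (f x)) * measure Sign.- x) < 0#

  module _ {s N} (pt : Fin s → Point N) (ε : Carrier) (f : Fin s → Sign) (d : ℕ) where

    private
      Measures : Set r
      Measures = Sign → Fin s → Carrier

      combine : Carrier → Measures → Carrier → Measures → Measures
      combine a v b w σ x = a * v σ x + b * w σ x

      pairing : (Sign → Fin s → Carrier) → Measures → Carrier
      pairing h v = ∑ (λ x → h Sign.+ x * v Sign.+ x) + ∑ (λ x → h Sign.- x * v Sign.- x)

      pairing-linear : ∀ h a v b w → pairing h (combine a v b w) ≈ a * pairing h v + b * pairing h w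
      pairing-linear h a v b w = trans (+-cong (half Sign.+) (half Sign.-))
        (solve 6 (λ a b s t s′ t′ → (a :* s :+ b :* t) :+ (a :* s′ :+ b :* t′)
            := a :* (s :+ s′) :+ b :* (t :+ t′)) refl a b _ _ _ _)
        where
        half : ∀ σ → ∑ (λ x → h σ x * combine a v b w σ x) ≈
                     a * ∑ (λ x → h σ x * v σ x) + b * ∑ (λ x → h σ x * w σ x)
        half σ = trans (∑-cong (λ x → solve 5 (λ h a v b w → h :* (a :* v :+ b :* w)
            := a :* (h :* v) :+ b :* (h :* w)) refl
          (h σ x) a (v σ x) b (w σ x))) (∑-linear a b _ _)

      -- A point mass stands for the inequality `σ (f x - p x) ≤ ε`. Rows and dual measures thus
      -- share one space, and a nonnegative combination of rows is a pair of measures.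
      unit : Sign → Fin s → Measures
      unit σ x τ y = indicator σ τ * unitVector x y

      pairing-unit : ∀ h σ x → pairing h (unit σ x) ≈ h σ x
      pairing-unit h Sign.+ x = trans (+-cong
        (trans (∑-cong (λ y → *-congˡ (*-identityˡ _))) (∑-unitVector (h Sign.+) x))
        (∑-zero (λ y → trans (*-congˡ (zeroˡ _)) (zeroʳ _)))) (+-identityʳ _)
      pairing-unit h Sign.- x = trans (+-cong
        (∑-zero (λ y → trans (*-congˡ (zeroˡ _)) (zeroʳ _)))
        (trans (∑-cong (λ y → *-congˡ (*-identityˡ _))) (∑-unitVector (h Sign.-) x))) (+-identityˡ _)

      -- That inequality reads `- σ p x ≤ ε - σ f x` with the unknown coefficients of `p` on the
      -- left; `moment` and `tolerance` are its two sides.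
      moment : Vec ℕ N → Sign → Fin s → Carrier
      moment e σ x = - fromSign σ * monomial e (pt x)

      tolerance : Sign → Fin s → Carrier
      tolerance σ x = ε - fromSign σ * fromSign (f x)

      φ : Vec ℕ N → Measures → Carrier
      φ e = pairing (moment e)

      β : Measures → Carrier
      β = pairing tolerance

      open Farkas combine φ β (λ e → pairing-linear (moment e)) (pairing-linear tolerance)

      units : List Measures
      units = List.map (unit Sign.+) (allFin s) ++ List.map (unit Sign.-) (allFin s)

      ∈-units : ∀ σ x → unit σ x ∈ units
      ∈-units Sign.+ x = ∈-++⁺ˡ (∈-map⁺ (unit Sign.+) (∈-allFin x))
      ∈-units Sign.- x = ∈-++⁺ʳ (List.map (unit Sign.+) (allFin s)) (∈-map⁺ (unit Sign.-) (∈-allFin x))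

      unit-nonNegative : ∀ σ x τ y → 0# ≤ unit σ x τ y
      unit-nonNegative σ x τ y = *-nonNegative (indicator-nonNegative σ τ) (unitVector-nonNegative x y)

      units-nonNegative : ∀ {v} → v ∈ units → ∀ τ y → 0# ≤ v τ y
      units-nonNegative v∈ with ∈-++⁻ (List.map (unit Sign.+) (allFin s)) v∈
      ... | inj₁ v∈+ with ∈-map⁻ (unit Sign.+) v∈+
      ...   | x , _ , ≡.refl = unit-nonNegative Sign.+ x
      units-nonNegative v∈ | inj₂ v∈- with ∈-map⁻ (unit Sign.-) v∈-
      ...   | x , _ , ≡.refl = unit-nonNegative Sign.- x

      lhs-unit : ∀ p σ x → lhs p (unit σ x) ≈ - fromSign σ * eval p (pt x)
      lhs-unit [] σ x = sym (zeroʳ _)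
      lhs-unit ((a , e) ∷ p) σ x = trans (+-cong (*-congˡ (pairing-unit (moment e) σ x)) (lhs-unit p σ x))
        (solve 4 (λ a w m t → a :* (w :* m) :+ w :* t := w :* (a :* m :+ t)) refl
          a (- fromSign σ) (monomial e (pt x)) (eval p (pt x)))

      one-sided : ∀ {p} → (∀ {v} → v ∈ units → lhs p v ≤ β v) → ∀ σ x →
                  fromSign σ * (fromSign (f x) - eval p (pt x)) ≤ ε
      one-sided {p} solves σ x = slack⇒≤
        (slack (≤-trans (≤-reflexive (sym (lhs-unit p σ x)))
            (≤-trans (solves (∈-units σ x)) (≤-reflexive (pairing-unit tolerance σ x)))))
        (solve 4 (λ ε w y t → ε :- w :* (y :- t) := ε :- w :* y :- (:- w) :* t) refl
          ε (fromSign σ) (fromSign (f x)) (eval p (pt x)))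

      fromSolution : Solution (exponents N d) units → Approximable pt ε f d
      fromSolution (p , p⊆ , solves) =
        p ,
        All.tabulate (λ t∈p → All.lookup (exponents-degree N d) (p⊆ t∈p)) ,
        λ x → ∣∣≤⇒abs≤
          ( ≤-trans (≤-reflexive (sym (*-identityˡ _))) (one-sided {p} solves Sign.+ x)
          , ≤-trans (≤-reflexive (solve 1 (λ y → :- y := (:- con (pos 1)) :* y) refl _))
              (one-sided {p} solves Sign.- x))

      balance : ∀ v e → φ e v ≈ 0# → ∑ (λ x → monomial e (pt x) * v Sign.+ x)
          ≈ ∑ (λ x → monomial e (pt x) * v Sign.- x)
      balance v e φ≈0 = trans (solve 2 (λ s t → s := t :- ((:- con (pos 1)) :* s :+ t)) refl _ _)
        (trans (+-congˡ (-‿cong (trans (+-cong (sym (signed Sign.+)) (sym (trans (signed Sign.-)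
            (trans (*-congʳ (-‿involutive 1#)) (*-identityˡ _))))) φ≈0)))
          (trans (+-congˡ -0#≈0#) (+-identityʳ _)))
        where
        signed : ∀ σ → ∑ (λ x → - fromSign σ * monomial e (pt x) * v σ x)
            ≈ - fromSign σ * ∑ (λ x → monomial e (pt x) * v σ x)
        signed σ = trans (∑-cong (λ x → *-assoc (- fromSign σ) _ _)) (∑-*ˡ (- fromSign σ) _)

      NonNegative : Measures → Set ℓ
      NonNegative v = ∀ σ x → 0# ≤ v σ x

      fromInfeasible : Infeasible (exponents N d) NonNegative → Dual pt ε f d
      fromInfeasible (v , 0≤v , φ≈0 , β<0) = record
        { measure = v
        ; nonNegative = 0≤v
        ; balanced = λ e e≤d → balance v e (φ≈0 (∈-exponents e e≤d))
        ; correlated = β<0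
        }

      conic : Conic NonNegative
      conic 0≤a 0≤b 0≤v 0≤w σ x = +-nonNegative (*-nonNegative 0≤a (0≤v σ x)) (*-nonNegative 0≤b (0≤w σ x))

    approximable-or-dual : Approximable pt ε f d ⊎ Dual pt ε f d
    approximable-or-dual = Sum.map fromSolution fromInfeasible
      (farkas (exponents N d) {NonNegative} (λ {a} {v} {b} {w} → conic {a} {v} {b} {w}) units units-nonNegative)

  -- The measures of a Dual, normalised to weights of mass 1, with a part of mass
  -- exactly 1 − δ of weight σ carved out of the points where f = σ.
  record Split {s N} (pt : Fin s → Point N) (δ : Carrier) (f : Fin s → Sign) (d : ℕ) : Set (r ⊔ ℓ) where
    field
      weight good   : Sign → Fin s → Carrier
      0≤good        : ∀ σ x → 0# ≤ good σ x
      good≤weight   : ∀ σ x → good σ x ≤ weight σ x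
      good-vanishes : ∀ σ x → f x ≢ σ → good σ x ≈ 0#
      ∑-good        : ∀ σ → ∑ (good σ) ≈ 1# - δ
      ∑-weight      : ∀ σ → ∑ (weight σ) ≈ 1#
      balanced      : ∀ e → Vec.sum e ℕ.≤ d →
                      ∑ (λ x → monomial e (pt x) * weight Sign.+ x) ≈ ∑ (λ x → monomial e (pt x) * weight Sign.- x)

  fromSign-* : ∀ σ τ → fromSign σ * fromSign τ ≈ fromℕ 2 * indicator σ τ - 1#
  fromSign-* Sign.+ Sign.+ = solve 0 (con (pos 1) :* con (pos 1) := con (pos 2) :* con (pos 1) :- con (pos 1)) refl
  fromSign-* Sign.+ Sign.- = solve 0 (con (pos 1) :* :- con (pos 1)
      := con (pos 2) :* con (pos 0) :- con (pos 1)) refl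
  fromSign-* Sign.- Sign.+ = solve 0 (:- con (pos 1) :* con (pos 1)
      := con (pos 2) :* con (pos 0) :- con (pos 1)) refl
  fromSign-* Sign.- Sign.- = solve 0 (:- con (pos 1) :* :- con (pos 1)
      := con (pos 2) :* con (pos 1) :- con (pos 1)) refl

  indicator-≢ : ∀ {σ τ} → τ ≢ σ → indicator σ τ ≈ 0#
  indicator-≢ {Sign.+} {Sign.+} τ≢σ = ⊥-elim (τ≢σ ≡.refl)
  indicator-≢ {Sign.+} {Sign.-} τ≢σ = refl
  indicator-≢ {Sign.-} {Sign.+} τ≢σ = refl
  indicator-≢ {Sign.-} {Sign.-} τ≢σ = ⊥-elim (τ≢σ ≡.refl)

  module _ {s N} {pt : Fin s → Point N} {δ : Carrier} {f : Fin s → Sign} {d : ℕ}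
           (0<1-δ : 0# < 1# - δ) (dual : Dual pt (1# - δ) f d) where
    open Dual dual

    private
      mass correct : Sign → Carrier
      mass σ = ∑ (measure σ)
      correct σ = ∑ (λ x → indicator σ (f x) * measure σ x)

      m : Carrier
      m = mass Sign.+

      -- This is the moment of degree zero, which every `d` covers; it lets one normalising constant
      -- serve both signs.
      mass-balanced : mass Sign.- ≈ m
      mass-balanced = trans (sym (constant Sign.-))
        (trans (sym (balanced (Vec.replicate N 0) (≡.subst (ℕ._≤ d) (≡.sym (sum-replicate-0 N)) ℕ.z≤n)))
            (constant Sign.+))
        where
        constant : ∀ σ → ∑ (λ x → monomial (Vec.replicate N 0) (pt x) * measure σ x) ≈ mass σ
        constant σ = ∑-cong (λ x → trans (*-congʳ (monomial-0 N (pt x))) (*-identityˡ _))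

      correct≤mass : ∀ σ → correct σ ≤ mass σ
      correct≤mass σ = ∑-mono-≤ (λ x → ≤-trans (*-monoʳ-≤ (nonNegative σ x) (indicator≤1 σ (f x)))
          (≤-reflexive (*-identityˡ _)))

      deviation : ∀ σ → ∑ (λ x → ((1# - δ) - fromSign σ * fromSign (f x)) * measure σ x) ≈
                        (fromℕ 2 - δ) * mass σ + (- fromℕ 2) * correct σ
      deviation σ = trans (∑-cong (λ x → trans (*-congʳ (+-congˡ (-‿cong (fromSign-* σ (f x)))))
        (solve 3 (λ δ i v → (con (pos 1) :- δ :- (con (pos 2) :* i :- con (pos 1))) :* v
                    := (con (pos 2) :- δ) :* v :+ (:- con (pos 2)) :* (i :* v)) refl δ (indicator σ (f x))
                        (measure σ x))))
        (∑-linear _ _ _ _)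

      correct-large : (fromℕ 2 - δ) * m < correct Sign.+ + correct Sign.-
      correct-large = ≰⇒> λ correct≤ → <⇒≱ correlated (≤-trans
        (*-nonNegative (fromℕ-nonNegative 2) (slack correct≤))
        (≤-reflexive (trans
          (solve 4 (λ δ m c c′ → con (pos 2) :* ((con (pos 2) :- δ) :* m :- (c :+ c′))
                      := (con (pos 2) :- δ) :* m :+ (:- con (pos 2)) :* c :+
                          ((con (pos 2) :- δ) :* m :+ (:- con (pos 2)) :* c′))
            refl δ m (correct Sign.+) (correct Sign.-))
          (sym (+-cong (deviation Sign.+) (trans (deviation Sign.-) (+-congʳ (*-congˡ mass-balanced))))))))

      correct≤m : ∀ σ → correct σ ≤ m
      correct≤m Sign.+ = correct≤mass Sign.+
      correct≤m Sign.- = ≤-trans (correct≤mass Sign.-) (≤-reflexive mass-balanced)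

      <-from-sum : ∀ {c c′} → (fromℕ 2 - δ) * m < c + c′ → c′ ≤ m → (1# - δ) * m < c
      <-from-sum {c} {c′} large c′≤m = ≰⇒> λ c≤ → <⇒≱ large (slack⇒≤ (+-nonNegative (slack c≤) (slack c′≤m))
        (solve 4 (λ δ m c c′ → (con (pos 2) :- δ) :* m :- (c :+ c′)
            := ((con (pos 1) :- δ) :* m :- c) :+ (m :- c′)) refl δ m c c′))

      -- The two correct masses together exceed `(2 - δ) m` and neither exceeds `m`, so each must
      -- exceed `(1 - δ) m`.
      correct-majority : ∀ σ → (1# - δ) * m < correct σ
      correct-majority Sign.+ = <-from-sum correct-large (correct≤m Sign.-)
      correct-majority Sign.- = <-from-sum
        (≤-trans (proj₁ correct-large) (≤-reflexive (+-comm _ _)) , λ eq → proj₂ correct-large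
            (trans eq (+-comm _ _)))
        (correct≤m Sign.+)

      0≤m : 0# ≤ m
      0≤m = ∑-nonNegative (nonNegative Sign.+)

      0<m : 0# < m
      0<m = 0≤m , λ 0≈m → <⇒≱ (correct-majority Sign.+)
        (≤-trans (correct≤m Sign.+) (≤-reflexive (trans (sym 0≈m) (trans (sym (zeroʳ _)) (*-congˡ 0≈m)))))

      0<correct : ∀ σ → 0# < correct σ
      0<correct σ = ≰⇒> λ c≤0 → <⇒≱ (correct-majority σ) (≤-trans c≤0 (*-nonNegative (proj₁ 0<1-δ) 0≤m))

      m⁻¹ : Carrier
      m⁻¹ = m ⁻¹

      m*m⁻¹≈1 : m * m⁻¹ ≈ 1#
      m*m⁻¹≈1 = proj₁ (inverse-positive 0<m)

      0≤m⁻¹ : 0# ≤ m⁻¹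
      0≤m⁻¹ = proj₁ (proj₂ (inverse-positive 0<m))

      -- Division by `m` alone would leave correct parts of mass more than `1 - δ`, different for
      -- the two signs. They are shrunk to mass exactly `1 - δ`, so that no total over the product
      -- set depends on `z`.
      scale : Sign → Carrier
      scale σ = (1# - δ) * correct σ ⁻¹

      scale*correct : ∀ σ → scale σ * correct σ ≈ 1# - δ
      scale*correct σ = trans (*-assoc _ _ _)
          (trans (*-congˡ (trans (*-comm _ _) (proj₁ (inverse-positive (0<correct σ)))))
        (*-identityʳ _))

      0≤scale : ∀ σ → 0# ≤ scale σ
      0≤scale σ = *-nonNegative (proj₁ 0<1-δ) (proj₁ (proj₂ (inverse-positive (0<correct σ))))

      scale≤m⁻¹ : ∀ σ → scale σ ≤ m⁻¹
      scale≤m⁻¹ σ = *-cancelˡ-≤ (*-positive 0<m (0<correct σ)) (begin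
        m * correct σ * scale σ   ≈⟨ solve 3 (λ m c k → m :* c :* k := k :* c :* m) refl m (correct σ) (scale σ) ⟩
        scale σ * correct σ * m   ≈⟨ *-congʳ (scale*correct σ) ⟩
        (1# - δ) * m              ≤⟨ proj₁ (correct-majority σ) ⟩
        correct σ                 ≈⟨ *-identityˡ _ ⟨
        1# * correct σ            ≈⟨ *-congʳ m*m⁻¹≈1 ⟨
        m * m⁻¹ * correct σ       ≈⟨ solve 3 (λ m c k → m :* k :* c := m :* c :* k) refl m (correct σ) m⁻¹ ⟩
        m * correct σ * m⁻¹       ∎)
        where open ≤R

      mass≈m : ∀ σ → mass σ ≈ m
      mass≈m Sign.+ = refl
      mass≈m Sign.- = mass-balanced

    split : Split pt δ f d
    split = record
      { weight = λ σ x → m⁻¹ * measure σ x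
      ; good = λ σ x → scale σ * (indicator σ (f x) * measure σ x)
      ; 0≤good = λ σ x → *-nonNegative (0≤scale σ) (*-nonNegative (indicator-nonNegative σ (f x)) (nonNegative σ x))
      ; good≤weight = λ σ x → *-mono-≤
          (*-nonNegative (indicator-nonNegative σ (f x)) (nonNegative σ x)) 0≤m⁻¹ (scale≤m⁻¹ σ)
          (≤-trans (*-monoʳ-≤ (nonNegative σ x) (indicator≤1 σ (f x))) (≤-reflexive (*-identityˡ _)))
      ; good-vanishes = λ σ x fx≢σ → trans (*-congˡ (trans (*-congʳ (indicator-≢ fx≢σ)) (zeroˡ _))) (zeroʳ _)
      ; ∑-good = λ σ → trans (∑-*ˡ _ _) (scale*correct σ)
      ; ∑-weight = λ σ → trans (∑-*ˡ _ _) (trans (*-congˡ (mass≈m σ)) (trans (*-comm _ _) m*m⁻¹≈1))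
      ; balanced = λ e e≤d → trans (moment e Sign.+) (trans (*-congˡ (balanced e e≤d)) (sym (moment e Sign.-)))
      }
      where
      moment : ∀ e σ → ∑ (λ x → monomial e (pt x) * (m⁻¹ * measure σ x))
          ≈ m⁻¹ * ∑ (λ x → monomial e (pt x) * measure σ x)
      moment e σ = trans (∑-cong (λ x → solve 3 (λ a k v → a :* (k :* v) := k :* (a :* v)) refl
        (monomial e (pt x)) m⁻¹ (measure σ x))) (∑-*ˡ m⁻¹ _)

  not-approximable⇒split : ∀ {s N} {pt : Fin s → Point N} {δ f d} → 0# < 1# - δ →
                           ¬ Approximable pt (1# - δ) f d → Split pt δ f d
  not-approximable⇒split {pt = pt} {δ} {f} {d} 0<1-δ ¬approximable =
    [ (λ approximable → ⊥-elim (¬approximable approximable)) , split 0<1-δ ]′ (approximable-or-dual pt (1# - δ) f d)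

  -- Truncated inclusion–exclusion

  prod : ∀ {n} → (Fin n → Carrier) → Carrier
  prod {zero} u = 1#
  prod {suc n} u = u zero * prod (u ∘ suc)

  -- truncated β k u v = ∑_{|S| ≤ k} β (k − |S|) ∏_{i ∈ S} v i ∏_{i ∉ S} u i
  truncated : ∀ {n} → (ℕ → Carrier) → ℕ → (u v : Fin n → Carrier) → Carrier
  truncated {zero} β k u v = β k
  truncated {suc n} β zero u v = u zero * truncated β zero (u ∘ suc) (v ∘ suc)
  truncated {suc n} β (suc k) u v =
    u zero * truncated β (suc k) (u ∘ suc) (v ∘ suc) + v zero * truncated β k (u ∘ suc) (v ∘ suc)

  -- With `ones`, `truncated` collects the terms having at most `k` factors `v`; with `initial`,
  -- those having exactly `k`.
  ones initial : ℕ → Carrier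
  ones _ = 1#
  initial zero = 1#
  initial (suc _) = 0#

  truncated-cong : ∀ {n} β k {u u′ v v′ : Fin n → Carrier} → (∀ i → u i ≈ u′ i) → (∀ i → v i ≈ v′ i) →
                   truncated β k u v ≈ truncated β k u′ v′
  truncated-cong {zero} β k u≈ v≈ = refl
  truncated-cong {suc n} β zero u≈ v≈ = *-cong (u≈ zero) (truncated-cong β zero (u≈ ∘ suc) (v≈ ∘ suc))
  truncated-cong {suc n} β (suc k) u≈ v≈ =
    +-cong (*-cong (u≈ zero) (truncated-cong β (suc k) (u≈ ∘ suc) (v≈ ∘ suc)))
           (*-cong (v≈ zero) (truncated-cong β k (u≈ ∘ suc) (v≈ ∘ suc)))

  prod-cong : ∀ {n} {u u′ : Fin n → Carrier} → (∀ i → u i ≈ u′ i) → prod u ≈ prod u′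
  prod-cong {zero} u≈ = refl
  prod-cong {suc n} u≈ = *-cong (u≈ zero) (prod-cong (u≈ ∘ suc))

  prod≈truncated : ∀ {n} (u v : Fin n → Carrier) → prod u ≈ truncated ones 0 u v
  prod≈truncated {zero} u v = refl
  prod≈truncated {suc n} u v = *-congˡ (prod≈truncated (u ∘ suc) (v ∘ suc))

  prod-nonNegative : ∀ {n} {u : Fin n → Carrier} → (∀ i → 0# ≤ u i) → 0# ≤ prod u
  prod-nonNegative {zero} 0≤u = 0≤1
  prod-nonNegative {suc n} 0≤u = *-nonNegative (0≤u zero) (prod-nonNegative (0≤u ∘ suc))

  truncated-nonNegative : ∀ {n} k {u v : Fin n → Carrier} → (∀ i → 0# ≤ u i) → (∀ i → 0# ≤ v i) →
                          0# ≤ truncated initial k u v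
  truncated-nonNegative {zero} zero 0≤u 0≤v = 0≤1
  truncated-nonNegative {zero} (suc k) 0≤u 0≤v = Ord.refl
  truncated-nonNegative {suc n} zero 0≤u 0≤v = *-nonNegative (0≤u zero)
      (truncated-nonNegative zero (0≤u ∘ suc) (0≤v ∘ suc))
  truncated-nonNegative {suc n} (suc k) 0≤u 0≤v = +-nonNegative
    (*-nonNegative (0≤u zero) (truncated-nonNegative (suc k) (0≤u ∘ suc) (0≤v ∘ suc)))
    (*-nonNegative (0≤v zero) (truncated-nonNegative k (0≤u ∘ suc) (0≤v ∘ suc)))

  -- The part of ∏ (u − v) with fewer than k factors v.
  truncatedBelow : ∀ {n} → ℕ → (u v : Fin n → Carrier) → Carrier
  truncatedBelow zero u v = 0#
  truncatedBelow (suc k) u v = truncated ones k u (λ i → - v i)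

  -- The reason for counting fewer than `k` rather than at most `k`: one recursion now covers the
  -- bottom case too, where the branch taking `v` contributes zero.
  truncatedBelow-suc : ∀ {n} k (u v : Fin (suc n) → Carrier) → truncatedBelow (suc k) u v ≈
    u zero * truncatedBelow (suc k) (u ∘ suc) (v ∘ suc) - v zero * truncatedBelow k (u ∘ suc) (v ∘ suc)
  truncatedBelow-suc zero u v = solve 3 (λ x y s → x :* s := x :* s :- y :* con (pos 0)) refl (u zero) (v zero) _
  truncatedBelow-suc (suc k) u v = +-congˡ (sym (-‿distribˡ-* _ _))

  -- Let `P` be the product of the remaining factors, `T` and `T′` its truncations at `suc k` and
  -- `k`. As the first factor is `u - v`, the error is `u (P - T) - v (P - T′)`, and the bounds for
  -- the two differences recombine by the recursion of `truncated`.
  bonferroni : ∀ {n} k (g u : Fin n → Carrier) → (∀ i → 0# ≤ g i) → (∀ i → g i ≤ u i) →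
               let v = λ i → u i - g i in
               ∣ prod g - truncatedBelow k u v ∣≤ truncated initial k u v
  bonferroni {zero} zero g u 0≤g g≤u = ∣∣≤-cong (solve 0 (con (pos 1) := con (pos 1) :- con (pos 0)) refl) refl
    (∣∣≤-nonNegative 0≤1 Ord.refl)
  bonferroni {zero} (suc k) g u 0≤g g≤u = ∣∣≤-cong (sym (-‿inverseʳ 1#)) refl (∣∣≤-nonNegative Ord.refl Ord.refl)
  bonferroni {suc n} zero g u 0≤g g≤u = ∣∣≤-cong
    (solve 2 (λ x y → x :* (y :- con (pos 0)) := x :* y :- con (pos 0)) refl (g zero) (prod (g ∘ suc))) refl
    (∣∣≤-weaken (*-monoʳ-≤ (truncated-nonNegative zero (λ i → ≤-trans (0≤g (suc i)) (g≤u (suc i)))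
        (λ i → slack (g≤u (suc i)))) (g≤u zero))
      (∣∣≤-*ˡ (0≤g zero) (bonferroni zero (g ∘ suc) (u ∘ suc) (0≤g ∘ suc) (g≤u ∘ suc))))
  bonferroni {suc n} (suc k) g u 0≤g g≤u = ∣∣≤-cong
    (trans (solve 5 (λ x y p s t → x :* (p :- s) :+ (x :- y) :* (:- (p :- t))
        := y :* p :- (x :* s :- (x :- y) :* t)) refl
        (u zero) (g zero) (prod (g ∘ suc)) (truncatedBelow (suc k) (u ∘ suc) v) (truncatedBelow k (u ∘ suc) v))
      (+-congˡ (-‿cong (sym (truncatedBelow-suc k u (λ i → u i - g i))))))
    refl
    (∣∣≤-+ (∣∣≤-*ˡ (≤-trans (0≤g zero) (g≤u zero)) (ih (suc k))) (∣∣≤-*ˡ (slack (g≤u zero)) (∣∣≤-neg (ih k))))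
    where
    v = λ i → u (suc i) - g (suc i)
    ih = λ k → bonferroni k (g ∘ suc) (u ∘ suc) (0≤g ∘ suc) (g≤u ∘ suc)

  -- Sums over the product of the point sets

  module _ {m : ℕ} where

    consProduct : ∀ {n} (X : Fin (suc n) → FiniteSet m) → Element (X zero) → Product (X ∘ suc) → Product X
    consProduct X y x zero = y
    consProduct X y x (suc i) = x i

    ∑ₚ : ∀ {n} (X : Fin n → FiniteSet m) → (Product X → Carrier) → Carrier
    ∑ₚ {zero} X h = h (λ ())
    ∑ₚ {suc n} X h = ∑ (λ y → ∑ₚ (X ∘ suc) (λ x → h (consProduct X y x)))

    ∑ₚ-cong : ∀ {n} (X : Fin n → FiniteSet m) {g h : Product X → Carrier} → (∀ x → g x ≈ h x) → ∑ₚ X g ≈ ∑ₚ X h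
    ∑ₚ-cong {zero} X g≈h = g≈h _
    ∑ₚ-cong {suc n} X g≈h = ∑-cong (λ y → ∑ₚ-cong (X ∘ suc) (λ x → g≈h (consProduct X y x)))

    ∑ₚ-linear : ∀ {n} (X : Fin n → FiniteSet m) a b (g h : Product X → Carrier) →
                ∑ₚ X (λ x → a * g x + b * h x) ≈ a * ∑ₚ X g + b * ∑ₚ X h
    ∑ₚ-linear {zero} X a b g h = refl
    ∑ₚ-linear {suc n} X a b g h = trans (∑-cong (λ y → ∑ₚ-linear (X ∘ suc) a b _ _)) (∑-linear a b _ _)

    ∑ₚ-*ˡ : ∀ {n} (X : Fin n → FiniteSet m) a (h : Product X → Carrier) → ∑ₚ X (λ x → a * h x) ≈ a * ∑ₚ X h
    ∑ₚ-*ˡ {zero} X a h = refl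
    ∑ₚ-*ˡ {suc n} X a h = trans (∑-cong (λ y → ∑ₚ-*ˡ (X ∘ suc) a _)) (∑-*ˡ a _)

    ∣∑ₚ∣≤ : ∀ {n} (X : Fin n → FiniteSet m) {g h : Product X → Carrier} → (∀ x → ∣ g x ∣≤ h x) → ∣ ∑ₚ X g ∣≤ ∑ₚ X h
    ∣∑ₚ∣≤ {zero} X g≤h = g≤h _
    ∣∑ₚ∣≤ {suc n} X g≤h = ∣∑∣≤ (λ y → ∣∑ₚ∣≤ (X ∘ suc) (λ x → g≤h (consProduct X y x)))

    -- Every term of the expansion is a product over the coordinates, so its sum over the product
    -- set factorises. The factor `q` is there to carry the blocks of a monomial.
    ∑ₚ-truncated : ∀ {n} (X : Fin n → FiniteSet m) β k (q u v : ∀ i → Element (X i) → Carrier) →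
      ∑ₚ X (λ x → prod (λ i → q i (x i)) * truncated β k (λ i → u i (x i)) (λ i → v i (x i))) ≈
      truncated β k (λ i → ∑ (λ y → q i y * u i y)) (λ i → ∑ (λ y → q i y * v i y))
    ∑ₚ-truncated {zero} X β k q u v = *-identityˡ _
    ∑ₚ-truncated {suc n} X β zero q u v = begin
      ∑ (λ y → ∑ₚ X′ (λ x → (q zero y * Q x) * (u zero y * T x)))
        ≈⟨ ∑-cong (λ y → trans
             (∑ₚ-cong X′ (λ x → solve 4 (λ a b c d → a :* b :* (c :* d) := a :* c :* (b :* d))
                 refl (q zero y) (Q x) (u zero y) (T x)))
             (trans (∑ₚ-*ˡ X′ (q zero y * u zero y) (λ x → Q x * T x)) (*-comm _ _))) ⟩
      ∑ (λ y → ∑ₚ X′ (λ x → Q x * T x) * (q zero y * u zero y))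
        ≈⟨ trans (∑-*ˡ _ _) (*-comm _ _) ⟩
      ∑ (λ y → q zero y * u zero y) * ∑ₚ X′ (λ x → Q x * T x)
        ≈⟨ *-congˡ (∑ₚ-truncated X′ β zero (λ i → q (suc i)) (λ i → u (suc i)) (λ i → v (suc i))) ⟩
      _ ∎
      where
      open ≈R
      X′ = X ∘ suc
      Q T : Product X′ → Carrier
      Q x = prod (λ i → q (suc i) (x i))
      T x = truncated β zero (λ i → u (suc i) (x i)) (λ i → v (suc i) (x i))
    ∑ₚ-truncated {suc n} X β (suc k) q u v = begin
      ∑ (λ y → ∑ₚ X′ (λ x → (q zero y * Q x) * (u zero y * T (suc k) x + v zero y * T k x)))
        ≈⟨ ∑-cong (λ y → trans
             (∑ₚ-cong X′ (λ x → solve 6 (λ a b c d e f → a :* b :* (c :* d :+ e :* f)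
                 := a :* c :* (b :* d) :+ a :* e :* (b :* f)) refl
               (q zero y) (Q x) (u zero y) (T (suc k) x) (v zero y) (T k x)))
             (trans (∑ₚ-linear X′ (q zero y * u zero y) (q zero y * v zero y) (λ x → Q x * T (suc k) x)
                 (λ x → Q x * T k x))
               (+-cong (*-comm _ _) (*-comm _ _)))) ⟩
      ∑ (λ y → S (suc k) * (q zero y * u zero y) + S k * (q zero y * v zero y))
        ≈⟨ trans (∑-linear (S (suc k)) (S k) _ _) (+-cong (*-comm _ _) (*-comm _ _)) ⟩
      ∑ (λ y → q zero y * u zero y) * S (suc k) + ∑ (λ y → q zero y * v zero y) * S k
        ≈⟨ +-cong (*-congˡ (ih (suc k))) (*-congˡ (ih k)) ⟩
      _ ∎
      where
      open ≈R
      X′ = X ∘ suc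
      Q : Product X′ → Carrier
      Q x = prod (λ i → q (suc i) (x i))
      T : ℕ → Product X′ → Carrier
      T k x = truncated β k (λ i → u (suc i) (x i)) (λ i → v (suc i) (x i))
      S : ℕ → Carrier
      S k = ∑ₚ X′ (λ x → Q x * T k x)
      ih = λ k → ∑ₚ-truncated X′ β k (λ i → q (suc i)) (λ i → u (suc i)) (λ i → v (suc i))

  -- Only in these blocks may the moments of the two weights of a `Split` differ.
  heavy : ∀ {m n} → ℕ → Vec (Vec ℕ m) n → ℕ
  heavy d [] = 0
  heavy d (e ∷ es) with Vec.sum e ℕₚ.≤? d
  ... | yes _ = heavy d es
  ... | no _ = suc (heavy d es)

  sum-++ : ∀ {m n} (e : Vec ℕ m) (e′ : Vec ℕ n) → Vec.sum (e Vec.++ e′) ≡ Vec.sum e ℕ.+ Vec.sum e′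
  sum-++ [] e′ = ≡.refl
  sum-++ (k ∷ e) e′ = ≡.trans (≡.cong (k ℕ.+_) (sum-++ e e′)) (≡.sym (ℕₚ.+-assoc k _ _))

  heavy-bound : ∀ {m n} d (es : Vec (Vec ℕ m) n) → heavy d es ℕ.* suc d ℕ.≤ Vec.sum (Vec.concat es)
  heavy-bound d [] = ℕ.z≤n
  heavy-bound d (e ∷ es) rewrite sum-++ e (Vec.concat es) with Vec.sum e ℕₚ.≤? d
  ... | yes _ = ℕₚ.≤-trans (heavy-bound d es) (ℕₚ.m≤n+m _ _)
  ... | no e≰d = ℕₚ.+-mono-≤ (ℕₚ.≰⇒> e≰d) (heavy-bound d es)

  -- A factor whose first weight does not depend on the sign contributes to the
  -- degree only when its second weight is chosen.
  polynomial-truncated : ∀ {m n} d (es : Vec (Vec ℕ m) n) β k (M N : Fin n → Sign → Carrier) →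
    (∀ i → Vec.sum (lookup es i) ℕ.≤ d → M i Sign.+ ≈ M i Sign.-) →
    PolynomialOfDegree≤ cube (k ℕ.+ heavy d es)
        (λ z → truncated β k (λ i → M i (lookup z i)) (λ i → N i (lookup z i)))
  polynomial-truncated d [] β k M N light = polynomial-const (β k)
  polynomial-truncated d (e ∷ es) β zero M N light with Vec.sum e ℕₚ.≤? d
  ... | yes e≤d = polynomial-cong
    (λ { (Sign.+ ∷ z) → refl ; (Sign.- ∷ z) → *-congʳ (light zero e≤d) })
    (polynomial-*ˡ (M zero Sign.+)
        (polynomial-tail (polynomial-truncated d es β zero (M ∘ suc) (N ∘ suc) (light ∘ suc))))
  ... | no e≰d = polynomial-cong (λ { (σ ∷ z) → refl })
    (polynomial-* (polynomial-ofSign (M zero))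
        (polynomial-tail (polynomial-truncated d es β zero (M ∘ suc) (N ∘ suc) (light ∘ suc))))
  polynomial-truncated d (e ∷ es) β (suc k) M N light with Vec.sum e ℕₚ.≤? d
  ... | yes e≤d = polynomial-cong
    (λ { (Sign.+ ∷ z) → refl ; (Sign.- ∷ z) → +-congʳ (*-congʳ (light zero e≤d)) })
    (polynomial-+
      (polynomial-*ˡ (M zero Sign.+)
          (polynomial-tail (polynomial-truncated d es β (suc k) (M ∘ suc) (N ∘ suc) (light ∘ suc))))
      (polynomial-* (polynomial-ofSign (N zero))
          (polynomial-tail (polynomial-truncated d es β k (M ∘ suc) (N ∘ suc) (light ∘ suc)))))
  ... | no e≰d = polynomial-cong (λ { (σ ∷ z) → refl })
    (polynomial-+
      (polynomial-weaken (ℕₚ.≤-reflexive (≡.sym (ℕₚ.+-suc (suc k) _)))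
        (polynomial-* (polynomial-ofSign (M zero))
            (polynomial-tail (polynomial-truncated d es β (suc k) (M ∘ suc) (N ∘ suc) (light ∘ suc)))))
      (polynomial-weaken (ℕ.s≤s (ℕₚ.+-monoʳ-≤ k (ℕₚ.n≤1+n _)))
        (polynomial-* (polynomial-ofSign (N zero))
            (polynomial-tail (polynomial-truncated d es β k (M ∘ suc) (N ∘ suc) (light ∘ suc))))))

  monomial-++ : ∀ {m n} (e : Vec ℕ m) (e′ : Vec ℕ n) (x : Point m) (x′ : Point n) →
                monomial (e Vec.++ e′) (x Vec.++ x′) ≈ monomial e x * monomial e′ x′
  monomial-++ [] e′ [] x′ = sym (*-identityˡ _)
  monomial-++ (k ∷ e) e′ (y ∷ x) x′ = trans (*-congˡ (monomial-++ e e′ x x′)) (sym (*-assoc _ _ _))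

  monomial-concat : ∀ {m n} (es : Vec (Vec ℕ m) n) (X : Fin n → FiniteSet m) (x : Product X) →
    monomial (Vec.concat es) (productPoint X x) ≈ prod (λ i → monomial (lookup es i) (point (X i) (x i)))
  monomial-concat [] X x = refl
  monomial-concat (e ∷ es) X x = trans
    (monomial-++ e (Vec.concat es) (point (X zero) (x zero)) (productPoint (X ∘ suc) (λ i → x (suc i))))
    (*-congˡ (monomial-concat es (X ∘ suc) (λ i → x (suc i))))

  -- The truncation error

  ^-antimono : ∀ {y m n} → 0# ≤ y → y ≤ 1# → m ℕ.≤ n → y ^ n ≤ y ^ m
  ^-antimono {n = zero} 0≤y y≤1 ℕ.z≤n = Ord.refl
  ^-antimono {n = suc n} 0≤y y≤1 ℕ.z≤n = ≤-trans
    (*-mono-≤ (^-nonNegative n 0≤y) 0≤1 y≤1 (^-antimono {n = n} 0≤y y≤1 ℕ.z≤n)) (≤-reflexive (*-identityʳ 1#))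
  ^-antimono 0≤y y≤1 (ℕ.s≤s m≤n) = *-monoˡ-≤ 0≤y (^-antimono 0≤y y≤1 m≤n)

  -- The coefficient of tᵏ in (1 + t δ)ⁿ, bounded by the whole polynomial.
  truncated-generating : ∀ n k {δ t} → 0# ≤ δ → 0# ≤ t →
    truncated {n} initial k (λ _ → 1#) (λ _ → δ) * t ^ k ≤ (1# + t * δ) ^ n
  truncated-generating zero zero 0≤δ 0≤t = ≤-reflexive (*-identityʳ 1#)
  truncated-generating zero (suc k) 0≤δ 0≤t = ≤-trans (≤-reflexive (zeroˡ _)) 0≤1
  truncated-generating (suc n) zero {δ} {t} 0≤δ 0≤t = ≤-trans
    (≤-reflexive (trans (*-identityʳ _) (*-congˡ (sym (*-identityʳ _)))))
    (*-mono-≤ (≤-trans (truncated-nonNegative {n} zero (λ _ → 0≤1) (λ _ → 0≤δ)) (≤-reflexive (sym (*-identityʳ _))))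
      (+-nonNegative 0≤1 (*-nonNegative 0≤t 0≤δ))
      (slack⇒≤ (*-nonNegative 0≤t 0≤δ) (solve 2 (λ t δ → con (pos 1) :+ t :* δ :- con (pos 1) := t :* δ) refl t δ))
      (truncated-generating n zero 0≤δ 0≤t))
  truncated-generating (suc n) (suc k) {δ} {t} 0≤δ 0≤t = ≤-trans
    (≤-reflexive (solve 5 (λ a b δ t s → (con (pos 1) :* a :+ δ :* b) :* (t :* s)
        := a :* (t :* s) :+ t :* δ :* (b :* s)) refl
      (truncated {n} initial (suc k) (λ _ → 1#) (λ _ → δ))
          (truncated {n} initial k (λ _ → 1#) (λ _ → δ)) δ t (t ^ k)))
    (≤-trans (+-mono-≤ (truncated-generating n (suc k) 0≤δ 0≤t)
        (*-monoˡ-≤ (*-nonNegative 0≤t 0≤δ) (truncated-generating n k 0≤δ 0≤t)))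
      (≤-reflexive (solve 2 (λ u p → p :+ u :* p := (con (pos 1) :+ u) :* p) refl (t * δ) ((1# + t * δ) ^ n))))

  -- The first two terms of the binomial expansion, in homogeneous form so that no division by `a`
  -- occurs.
  bernoulli : ∀ n {a h} → 0# ≤ a → 0# ≤ h → a ^ suc n + fromℕ (suc n) * (a ^ n * h) ≤ (a + h) ^ suc n
  bernoulli zero {a} {h} 0≤a 0≤h = ≤-reflexive
    (solve 2 (λ a h → a :* con (pos 1) :+ (con (pos 1) :+ con (pos 0)) :* (con (pos 1) :* h)
        := (a :+ h) :* con (pos 1)) refl a h)
  bernoulli (suc n) {a} {h} 0≤a 0≤h = ≤-trans
    (slack⇒≤ (*-nonNegative (*-nonNegative (fromℕ-nonNegative (suc n)) (^-nonNegative n 0≤a))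
        (*-nonNegative 0≤h 0≤h))
      (solve 4 (λ a h p N → (a :+ h) :* (a :* p :+ N :* (p :* h)) :-
          (a :* (a :* p) :+ (con (pos 1) :+ N) :* (a :* p :* h))
                  := N :* p :* (h :* h)) refl a h (a ^ n) (fromℕ (suc n))))
    (*-monoˡ-≤ (+-nonNegative 0≤a 0≤h) (bernoulli n 0≤a 0≤h))

  -- AM–GM for d copies of 1 − x and j copies of 1.
  power-mean : ∀ d .{{_ : NonZero d}} j {a x} → 0# ≤ x → x ≤ 1# →
               fromℕ (j ℕ.+ d) * (1# - a) ≈ fromℕ d * x → (1# - x) ^ d ≤ a ^ (j ℕ.+ d)
  power-mean d zero {a} {x} 0≤x x≤1 eq = ≤-reflexive (^-congˡ d (trans (+-congˡ (-‿cong (sym 1-a≈x)))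
    (solve 1 (λ a → con (pos 1) :- (con (pos 1) :- a) := a) refl a)))
    where
    1-a≈x : 1# - a ≈ x
    1-a≈x = Ord.antisym (*-cancelˡ-≤ (0<fromℕ d) (≤-reflexive eq)) (*-cancelˡ-≤ (0<fromℕ d) (≤-reflexive (sym eq)))
  power-mean d (suc j) {a} {x} 0≤x x≤1 eq = ≤-trans (power-mean d j 0≤x x≤1 N[1-A]≈dx) A^N≤a^[1+N]
    where
    N = j ℕ.+ d
    0<N : 0# < fromℕ N
    0<N = 1≤⇒0< (≤-trans (1≤fromℕ d) (fromℕ-mono (ℕₚ.m≤n+m d j)))
    -- `A` is the mean of the first `N` numbers, and `a` that of `N` copies of `A` and a single 1.
    -- Hence `(N + 1) (a - A) = 1 - A`, and Bernoulli's inequality gives `A ^ N ≤ a ^ (N + 1)`.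
    A = 1# - (fromℕ d * x) * fromℕ N ⁻¹
    N[1-A]≈dx : fromℕ N * (1# - A) ≈ fromℕ d * x
    N[1-A]≈dx = trans (solve 3 (λ N w y → N :* (con (pos 1) :- (con (pos 1) :- y :* w)) := y :* (N :* w)) refl
      (fromℕ N) (fromℕ N ⁻¹) (fromℕ d * x)) (trans (*-congˡ (proj₁ (inverse-positive 0<N))) (*-identityʳ _))
    0≤1-A : 0# ≤ 1# - A
    0≤1-A = *-cancelˡ-nonNegative 0<N (≤-trans (*-nonNegative (fromℕ-nonNegative d) 0≤x)
        (≤-reflexive (sym N[1-A]≈dx)))
    0≤A : 0# ≤ A
    0≤A = ≤-trans (slack (*-cancelˡ-≤ 0<N (≤-trans (≤-reflexive N[1-A]≈dx)
        (≤-trans (*-mono-≤ 0≤x (fromℕ-nonNegative N) (fromℕ-mono (ℕₚ.m≤n+m d j)) x≤1) Ord.refl))))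
      (≤-reflexive (solve 1 (λ a → con (pos 1) :- (con (pos 1) :- a) := a) refl A))
    h = a - A
    [1+N]h≈1-A : fromℕ (suc N) * h ≈ 1# - A
    [1+N]h≈1-A = trans (solve 3 (λ N a A → (con (pos 1) :+ N) :* (a :- A)
        := (con (pos 1) :- A) :+ (N :* (con (pos 1) :- A) :- (con (pos 1) :+ N) :* (con (pos 1) :- a)))
            refl (fromℕ N) a A)
      (trans (+-congˡ (trans (+-cong N[1-A]≈dx (-‿cong eq)) (-‿inverseʳ _))) (+-identityʳ _))
    0≤h : 0# ≤ h
    0≤h = *-cancelˡ-nonNegative (0<fromℕ (suc N)) (≤-trans 0≤1-A (≤-reflexive (sym [1+N]h≈1-A)))
    A^N≤a^[1+N] : A ^ N ≤ a ^ suc N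
    A^N≤a^[1+N] = begin
      A ^ N                                          ≈⟨ solve 2 (λ A p → p
          := A :* p :+ (con (pos 1) :- A) :* p) refl A (A ^ N) ⟩
      A ^ suc N + (1# - A) * A ^ N                   ≈⟨ +-congˡ (*-congʳ [1+N]h≈1-A) ⟨
      A ^ suc N + fromℕ (suc N) * h * A ^ N         
          ≈⟨ +-congˡ (solve 3 (λ N h p → N :* h :* p := N :* (p :* h)) refl (fromℕ (suc N)) h (A ^ N)) ⟩
      A ^ suc N + fromℕ (suc N) * (A ^ N * h)        ≤⟨ bernoulli N 0≤A 0≤h ⟩
      (A + h) ^ suc N                                ≈⟨ ^-congˡ (suc N) (solve 2 (λ A a → A :+ (a :- A)
          := a) refl A a) ⟩
      a ^ suc N                                      ∎
      where open ≤R

  module _ {n d} .{{_ : NonZero d}} (d≤n : d ℕ.≤ n) {δ} (0≤δ : 0# ≤ δ) (30nδ≈d : fromℕ (30 ℕ.* n) * δ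
      ≈ fromℕ d) where

    private
      0<n : 0# < fromℕ n
      0<n = 1≤⇒0< (≤-trans (1≤fromℕ d) (fromℕ-mono d≤n))

      n[30δ]≈d : fromℕ n * (fromℕ 30 * δ) ≈ fromℕ d
      n[30δ]≈d = trans (solve 3 (λ N t δ → N :* (t :* δ) := t :* N :* δ) refl (fromℕ n) (fromℕ 30) δ)
        (trans (*-congʳ (sym (fromℕ-* 30 n))) 30nδ≈d)

    30δ≤1 : fromℕ 30 * δ ≤ 1#
    30δ≤1 = *-cancelˡ-≤ 0<n (≤-trans (≤-reflexive n[30δ]≈d)
        (≤-trans (fromℕ-mono d≤n) (≤-reflexive (sym (*-identityʳ _)))))

    private
      0≤1-9δ : 0# ≤ 1# - fromℕ 9 * δ
      0≤1-9δ = ≤-trans (+-nonNegative (slack 30δ≤1) (*-nonNegative (fromℕ-nonNegative 21) 0≤δ))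
        (≤-reflexive (solve 1 (λ δ → con (pos 1) :- con (pos 30) :* δ :+ con (pos 21) :* δ
            := con (pos 1) :- con (pos 9) :* δ) refl δ))

      x y : Carrier
      x = fromℕ 3 * fromℕ 10 ⁻¹
      y = 1# - x

      10x≈3 : fromℕ 10 * x ≈ fromℕ 3
      10x≈3 = trans (solve 2 (λ t w → t :* (con (pos 3) :* w) := con (pos 3) :* (t :* w)) refl (fromℕ 10)
          (fromℕ 10 ⁻¹))
        (trans (*-congˡ (proj₁ (inverse-positive (0<fromℕ 10)))) (*-identityʳ _))

      10y≈7 : fromℕ 10 * y ≈ fromℕ 7
      10y≈7 = trans (solve 1 (λ x → con (pos 10) :* (con (pos 1) :- x) := con (pos 10) :- con (pos 10) :* x) refl x)
        (trans (+-congˡ (-‿cong 10x≈3)) (solve 0 (con (pos 10) :- con (pos 3) := con (pos 7)) refl))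

      0≤x : 0# ≤ x
      0≤x = *-cancelˡ-nonNegative (0<fromℕ 10) (≤-trans (fromℕ-nonNegative 3) (≤-reflexive (sym 10x≈3)))

      0≤y : 0# ≤ y
      0≤y = *-cancelˡ-nonNegative (0<fromℕ 10) (≤-trans (fromℕ-nonNegative 7) (≤-reflexive (sym 10y≈7)))

      x≤1 : x ≤ 1#
      x≤1 = slack⇒≤ 0≤y refl

      y≤1 : y ≤ 1#
      y≤1 = slack⇒≤ 0≤x (solve 1 (λ x → con (pos 1) :- (con (pos 1) :- x) := x) refl x)

      -- The mean of `d` copies of `7/10` and `n - d` copies of 1 is `1 - 9 δ`, because `9 n δ` is
      -- `3/10` of `d`.
      y^d≤[1-9δ]^n : y ^ d ≤ (1# - fromℕ 9 * δ) ^ n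
      y^d≤[1-9δ]^n = ≤-trans (power-mean d (n ℕ.∸ d) 0≤x x≤1
          (≡.subst (λ N → fromℕ N * (1# - (1# - fromℕ 9 * δ)) ≈ fromℕ d * x)
          (≡.sym n∸d+d≡n) (begin
            fromℕ n * (1# - (1# - fromℕ 9 * δ))  
                ≈⟨ solve 2 (λ N δ → N :* (con (pos 1) :- (con (pos 1) :- con (pos 9) :* δ))
                    := con (pos 3) :* (N :* (con (pos 3) :* δ))) refl (fromℕ n) δ ⟩
            fromℕ 3 * (fromℕ n * (fromℕ 3 * δ))   ≈⟨ *-congʳ 10x≈3 ⟨
            fromℕ 10 * x * (fromℕ n * (fromℕ 3 * δ))
                ≈⟨ solve 3 (λ N δ x → con (pos 10) :* x :* (N :* (con (pos 3) :* δ))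
                    := N :* (con (pos 30) :* δ) :* x) refl (fromℕ n) δ x ⟩
            fromℕ n * (fromℕ 30 * δ) * x          ≈⟨ *-congʳ n[30δ]≈d ⟩
            fromℕ d * x                           ∎)))
        (≤-reflexive (^-congʳ _ n∸d+d≡n))
        where
        open ≈R
        n∸d+d≡n : n ℕ.∸ d ℕ.+ d ≡ n
        n∸d+d≡n = ℕₚ.m∸n+n≡m d≤n

      3≤8y² : fromℕ 3 ≤ fromℕ 8 * (y * y)
      3≤8y² = *-cancelˡ-≤ (0<fromℕ 100) (begin
        fromℕ 100 * fromℕ 3                      ≤⟨ slack⇒≤ (fromℕ-nonNegative 92)
            (solve 0 (con (pos 8) :* (con (pos 7) :* con (pos 7)) :- con (pos 100) :* con (pos 3)
                := con (pos 92)) refl) ⟩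
        fromℕ 8 * (fromℕ 7 * fromℕ 7)            ≈⟨ *-congˡ (*-cong 10y≈7 10y≈7) ⟨
        fromℕ 8 * (fromℕ 10 * y * (fromℕ 10 * y))
            ≈⟨ solve 1 (λ y → con (pos 8) :* (con (pos 10) :* y :* (con (pos 10) :* y))
                := con (pos 100) :* (con (pos 8) :* (y :* y))) refl y ⟩
        fromℕ 100 * (fromℕ 8 * (y * y))          ∎)
        where open ≤R

    -- The generating function at `t = 8` gives `e 8ᴷ ≤ (1 + 8 δ)ⁿ`, and `d ≤ 2 K` gives
    -- `y²ᴷ ≤ (1 - 9 δ)ⁿ` for `y = 7/10`. In the product, `(1 + 8 δ) (1 - 9 δ) ≤ 1 - δ` on the
    -- right, while on the left `8 y² = 3.92` leaves a factor of at least `3ᴷ ≥ 3`.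
    truncation-small : ∀ k → d ℕ.≤ suc k ℕ.+ suc k →
      fromℕ 3 * truncated {n} initial (suc k) (λ _ → 1#) (λ _ → δ) ≤ (1# - δ) ^ n
    truncation-small k d≤2K = begin
      fromℕ 3 * e                           ≤⟨ *-monoʳ-≤ 0≤e 3≤3^K ⟩
      fromℕ 3 ^ K * e                       ≤⟨ *-monoʳ-≤ 0≤e (^-mono-≤ K (fromℕ-nonNegative 3) 3≤8y²) ⟩
      (fromℕ 8 * (y * y)) ^ K * e           ≈⟨ *-congʳ (trans (*-distrib-^ _ _ K) (*-congˡ (*-distrib-^ y y K))) ⟩
      fromℕ 8 ^ K * (y ^ K * y ^ K) * e     ≈⟨ solve 3 (λ a b e → a :* b :* e := e :* a :* b)
          refl (fromℕ 8 ^ K) (y ^ K * y ^ K) e ⟩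
      e * fromℕ 8 ^ K * (y ^ K * y ^ K)     ≈⟨ *-congˡ (^-homo-* y K K) ⟨
      e * fromℕ 8 ^ K * y ^ (K ℕ.+ K)       ≤⟨ *-mono-≤ (^-nonNegative (K ℕ.+ K) 0≤y) (^-nonNegative n 0≤1+8δ)
                                                 (truncated-generating n K 0≤δ (fromℕ-nonNegative 8))
                                                 (≤-trans (^-antimono 0≤y y≤1 d≤2K) y^d≤[1-9δ]^n) ⟩
      (1# + fromℕ 8 * δ) ^ n * (1# - fromℕ 9 * δ) ^ n  ≈⟨ *-distrib-^ _ _ n ⟨
      ((1# + fromℕ 8 * δ) * (1# - fromℕ 9 * δ)) ^ n    ≤⟨ ^-mono-≤ n (*-nonNegative 0≤1+8δ 0≤1-9δ)
        (slack⇒≤ (*-nonNegative (fromℕ-nonNegative 72) (square-nonNegative δ))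
          (solve 1 (λ δ → con (pos 1) :- δ :- (con (pos 1) :+ con (pos 8) :* δ) :*
              (con (pos 1) :- con (pos 9) :* δ) := con (pos 72) :* (δ :* δ)) refl δ)) ⟩
      (1# - δ) ^ n                          ∎
      where
      open ≤R
      K = suc k
      e = truncated {n} initial K (λ _ → 1#) (λ _ → δ)
      0≤e : 0# ≤ e
      0≤e = truncated-nonNegative {n} K (λ _ → 0≤1) (λ _ → 0≤δ)
      0≤1+8δ : 0# ≤ 1# + fromℕ 8 * δ
      0≤1+8δ = +-nonNegative 0≤1 (*-nonNegative (fromℕ-nonNegative 8) 0≤δ)
      1≤3^ : ∀ k → 1# ≤ fromℕ 3 ^ k
      1≤3^ zero = Ord.refl
      1≤3^ (suc k) = ≤-trans (≤-reflexive (sym (*-identityʳ 1#)))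
          (*-mono-≤ 0≤1 (fromℕ-nonNegative 3) (1≤fromℕ 3) (1≤3^ k))
      3≤3^K : fromℕ 3 ≤ fromℕ 3 ^ K
      3≤3^K = ≤-trans (≤-reflexive (sym (*-identityʳ _))) (*-monoˡ-≤ (fromℕ-nonNegative 3) (1≤3^ k))

  -- The composition bound

  prod-const : ∀ n a → prod {n} (λ _ → a) ≡ a ^ n
  prod-const zero a = ≡.refl
  prod-const (suc n) a = ≡.cong (a *_) (prod-const n a)

  prod-1 : ∀ n → prod {n} (λ _ → 1#) ≈ 1#
  prod-1 zero = refl
  prod-1 (suc n) = trans (*-identityˡ _) (prod-1 n)

  ∑ₚ-truncated₁ : ∀ {n m} (X : Fin n → FiniteSet m) β k (u v : ∀ i → Element (X i) → Carrier) →
    ∑ₚ X (λ x → truncated β k (λ i → u i (x i)) (λ i → v i (x i))) ≈ truncated β k (λ i → ∑ (u i)) (λ i → ∑ (v i))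
  ∑ₚ-truncated₁ {n} X β k u v = trans
    (∑ₚ-cong X (λ x → sym (trans (*-congʳ (prod-1 n)) (*-identityˡ _))))
    (trans (∑ₚ-truncated X β k (λ i _ → 1#) u v)
      (truncated-cong β k (λ i → drop-1 (u i)) (λ i → drop-1 (v i))))
    where
    drop-1 : ∀ {s} (h : Fin s → Carrier) → ∑ (λ y → 1# * h y) ≈ ∑ h
    drop-1 h = ∑-cong (λ y → *-identityˡ (h y))

  100*0‧99≈99 : fromℕ 100 * 0‧99 ≈ fromℕ 99
  100*0‧99≈99 = trans
    (solve 2 (λ t w → t :* (con (pos 99) :* w) := con (pos 99) :* (t :* w)) refl (fromℕ 100) (fromℕ 100 ⁻¹))
    (trans (*-congˡ (proj₁ (inverse-positive (0<fromℕ 100)))) (*-identityʳ _))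

  ∣fromSign∣≤1 : ∀ σ → ∣ fromSign σ ∣≤ 1#
  ∣fromSign∣≤1 Sign.+ = ∣∣≤-nonNegative 0≤1 Ord.refl
  ∣fromSign∣≤1 Sign.- = ∣∣≤-neg (∣∣≤-nonNegative 0≤1 Ord.refl)

  0≤1/3 : 0# ≤ 1/3
  0≤1/3 = *-cancelˡ-nonNegative (0<fromℕ 3) (≤-trans 0≤1 (≤-reflexive (sym 3*1/3≈1)))

  module _ {n m} (F : Vec Sign n → Sign) (X : Fin n → FiniteSet m) (f : ∀ i → Element (X i) → Sign)
           (k D : ℕ) {δ : Carrier} (0<1-δ : 0# < 1# - δ)
           (splits : ∀ i → Split (point (X i)) δ (f i) D)
           (truncation-error : fromℕ 3 * truncated {n} initial (suc k) (λ _ → 1#) (λ _ → δ) ≤ (1# - δ) ^ n) where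

    private
      module S i = Split (splits i)

      g u v : Vec Sign n → ∀ i → Element (X i) → Carrier
      g z i = S.good i (lookup z i)
      u z i = S.weight i (lookup z i)
      v z i y = u z i y - g z i y

      -- `G` is the measure wanted, `E` its truncated expansion, whose degree in `z` is under
      -- control, and `e` the Bonferroni bound on their difference.
      E G e : Vec Sign n → Product X → Carrier
      E z x = truncatedBelow (suc k) (λ i → u z i (x i)) (λ i → v z i (x i))
      G z x = prod (λ i → g z i (x i))
      e z x = truncated initial (suc k) (λ i → u z i (x i)) (λ i → v z i (x i))

      -- The totals of `G z` and `e z`, the same for every `z`; hence one constant `W ⁻¹` normalises
      -- the average.
      W ē : Carrier
      W = (1# - δ) ^ n
      ē = truncated {n} initial (suc k) (λ _ → 1#) (λ _ → δ)

      0<W : 0# < W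
      0<W = ^-positive n 0<1-δ

      ∑ₚ-G : ∀ z → ∑ₚ X (G z) ≈ W
      ∑ₚ-G z = trans (∑ₚ-cong X (λ x → prod≈truncated (λ i → g z i (x i)) (λ i → g z i (x i))))
        (trans (∑ₚ-truncated₁ X ones 0 (g z) (g z))
          (trans (sym (prod≈truncated (λ i → ∑ (g z i)) (λ i → ∑ (g z i))))
              (trans (prod-cong (λ i → S.∑-good i (lookup z i))) (reflexive (prod-const n (1# - δ))))))

      ∑-v : ∀ z i → ∑ (v z i) ≈ δ
      ∑-v z i = trans (∑-cong (λ y → solve 2 (λ a b → a :- b := con (pos 1) :* a :+ (:- con (pos 1)) :* b)
          refl (u z i y) (g z i y)))
        (trans (∑-linear 1# (- 1#) (u z i) (g z i))
          (trans (+-cong (*-congˡ (S.∑-weight i (lookup z i))) (*-congˡ (S.∑-good i (lookup z i))))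
            (solve 1 (λ δ → con (pos 1) :* con (pos 1) :+ (:- con (pos 1)) :* (con (pos 1) :- δ) := δ) refl δ)))

      ∑ₚ-e : ∀ z → ∑ₚ X (e z) ≈ ē
      ∑ₚ-e z = trans (∑ₚ-truncated₁ X initial (suc k) (u z) (v z))
        (truncated-cong initial (suc k) (λ i → S.∑-weight i (lookup z i)) (∑-v z))

    agree-or-vanish : ∀ z x → Vec.tabulate (λ i → f i (x i)) ≡ z ⊎ G z x ≈ 0#
    agree-or-vanish z x = go z (λ i → f i (x i)) (λ i σ → S.good i σ (x i)) (λ i σ → S.good-vanishes i σ (x i))
      where
      go : ∀ {n} (z : Vec Sign n) (w : Fin n → Sign) (h : Fin n → Sign → Carrier) →
           (∀ i σ → w i ≢ σ → h i σ ≈ 0#) → Vec.tabulate w ≡ z ⊎ prod (λ i → h i (lookup z i)) ≈ 0#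
      go [] w h vanish = inj₁ ≡.refl
      go (σ ∷ z) w h vanish with w zero Signₚ.≟ σ | go z (w ∘ suc) (h ∘ suc) (vanish ∘ suc)
      ... | no w≢σ | _ = inj₂ (trans (*-congʳ (vanish zero σ w≢σ)) (zeroˡ _))
      ... | yes ≡.refl | inj₁ ≡.refl = inj₁ ≡.refl
      ... | yes _ | inj₂ rest≈0 = inj₂ (trans (*-congˡ rest≈0) (zeroʳ _))

    module _ (p : Polynomial Carrier (n ℕ.* m)) {degree : ℕ} (p-degree : HasDegree≤ degree p)
             (p-approximates : ∀ x → abs (fromSign (compose {X = X} F f x) - eval p (productPoint X x)) ≤ 1/3) where

      private
        value : Product X → Carrier
        value x = eval p (productPoint X x)

        S : Vec Sign n → Carrier
        S z = ∑ₚ X (λ x → value x * E z x)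

        -- Valid at every point of the product set. This matters because `G - E` need not vanish
        -- where some `f i` disagrees with `z`.
        ∣value∣≤4/3 : ∀ x → ∣ - value x ∣≤ 1# + 1/3
        ∣value∣≤4/3 x = ∣∣≤-cong (solve 2 (λ y t → :- y :+ (y :- t)
            := :- t) refl (fromSign (compose {X = X} F f x)) (value x)) refl
          (∣∣≤-+ (∣∣≤-neg (∣fromSign∣≤1 (compose {X = X} F f x))) (abs≤⇒∣∣≤ (p-approximates x)))

        0≤G : ∀ z x → 0# ≤ G z x
        0≤G z x = prod-nonNegative (λ i → S.0≤good i (lookup z i) (x i))

        on-agreement : ∀ z x → ∣ G z x * (value x - fromSign (F z)) ∣≤ G z x * 1/3
        on-agreement z x with agree-or-vanish z x
        ... | inj₂ G≈0 = ∣∣≤-cong (sym (trans (*-congʳ G≈0) (zeroˡ _))) (sym (trans (*-congʳ G≈0) (zeroˡ _)))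
          (∣∣≤-nonNegative Ord.refl Ord.refl)
        ... | inj₁ ≡.refl = ∣∣≤-*ˡ (0≤G z x) (∣∣≤-cong
          (solve 2 (λ y t → :- (y :- t) := t :- y) refl (fromSign (compose {X = X} F f x)) (value x)) refl
          (∣∣≤-neg (abs≤⇒∣∣≤ (p-approximates x))))

        -- With `p` for the value, `p E - F G = - p (G - E) + G (p - F)`: a truncation error
        -- weighted by at most `4/3`, and the error of the approximant where `G` is supported.
        pointwise : ∀ z x → ∣ 1# * (value x * E z x) + (- fromSign (F z)) * G z x ∣≤
            (1# + 1/3) * e z x + 1/3 * G z x
        pointwise z x = ∣∣≤-cong
          (solve 4 (λ t E y G → (:- t) :* (G :- E) :+ G :* (t :- y) := con (pos 1) :* (t :* E) :+ (:- y) :* G) refl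
            (value x) (E z x) (fromSign (F z)) (G z x))
          (+-congˡ (*-comm _ _))
          (∣∣≤-+ (∣∣≤-* (∣value∣≤4/3 x) (bonferroni (suc k) (λ i → g z i (x i)) (λ i → u z i (x i))
              (λ i → S.0≤good i (lookup z i) (x i)) (λ i → S.good≤weight i (lookup z i) (x i))))
            (on-agreement z x))

        error : ∀ z → ∣ S z - fromSign (F z) * W ∣≤ (1# + 1/3) * ē + 1/3 * W
        error z = ∣∣≤-cong
          (trans (∑ₚ-linear X 1# (- fromSign (F z)) (λ x → value x * E z x) (G z))
            (trans (+-cong (*-identityˡ _) (*-congˡ (∑ₚ-G z))) (+-congˡ (sym (-‿distribˡ-* _ _)))))
          (trans (∑ₚ-linear X (1# + 1/3) 1/3 (e z) (G z)) (+-cong (*-congˡ (∑ₚ-e z)) (*-congˡ (∑ₚ-G z))))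
          (∣∑ₚ∣≤ X (pointwise z))

        -- `4/3 · 1/3 + 1/3 = 7/9`. The factor 900 clears the denominators 9 and 100.
        error-small : (1# + 1/3) * ē + 1/3 * W ≤ W * 0‧99
        error-small = *-cancelˡ-≤ (0<fromℕ 900) (begin
          fromℕ 900 * ((1# + 1/3) * ē + 1/3 * W)
            ≈⟨ solve 3 (λ t ē W → con (pos 900) :* ((con (pos 1) :+ t) :* ē :+ t :* W)
                := con (pos 300) :* ((con (pos 1) :+ con (pos 1) :* t) :* (con (pos 3) :* ē) :+ con
                    (pos 3) :* t :* W)) refl 1/3 ē W ⟩
          fromℕ 300 * ((1# + 1# * 1/3) * (fromℕ 3 * ē) + fromℕ 3 * 1/3 * W)
            ≤⟨ *-monoˡ-≤ (fromℕ-nonNegative 300)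
                (+-mono-≤ (*-monoˡ-≤ (+-nonNegative 0≤1 (*-nonNegative 0≤1 0≤1/3)) truncation-error) Ord.refl) ⟩
          fromℕ 300 * ((1# + 1# * 1/3) * W + fromℕ 3 * 1/3 * W)
            ≈⟨ solve 2 (λ t W → con (pos 300) :*
                ((con (pos 1) :+ con (pos 1) :* t) :* W :+ con (pos 3) :* t :* W)
                    := con (pos 300) :* W :+ con (pos 400) :* (con (pos 3) :* t) :* W) refl 1/3 W ⟩
          fromℕ 300 * W + fromℕ 400 * (fromℕ 3 * 1/3) * W
            ≈⟨ +-congˡ (*-congʳ (*-congˡ 3*1/3≈1)) ⟩
          fromℕ 300 * W + fromℕ 400 * 1# * W
            ≤⟨ slack⇒≤ (*-nonNegative (fromℕ-nonNegative 191) (proj₁ 0<W))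
                 (solve 1 (λ W → con (pos 9) :* (W :* con (pos 99)) :-
                     (con (pos 300) :* W :+ con (pos 400) :* con (pos 1) :* W) := con (pos 191) :* W) refl W) ⟩
          fromℕ 9 * (W * fromℕ 99)
            ≈⟨ *-congˡ (*-congˡ 100*0‧99≈99) ⟨
          fromℕ 9 * (W * (fromℕ 100 * 0‧99))
            ≈⟨ solve 2 (λ W w → con (pos 9) :* (W :* (con (pos 100) :* w)) := con (pos 900) :* (W :* w))
                refl W 0‧99 ⟩
          fromℕ 900 * (W * 0‧99) ∎)
          where open ≤R

        approximates : ∀ z → ∣ fromSign (F z) - W ⁻¹ * S z ∣≤ 0‧99
        approximates z = cancel (∣∣≤-weaken error-small (error z))
          where
          W*W⁻¹≈1 = proj₁ (inverse-positive 0<W)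
          scaled-difference : S z - fromSign (F z) * W ≈ W * (W ⁻¹ * S z - fromSign (F z))
          scaled-difference = sym (trans
            (solve 4 (λ W V S y → W :* (V :* S :- y) := W :* V :* S :- y :* W) refl W (W ⁻¹) (S z) (fromSign (F z)))
            (+-congʳ (trans (*-congʳ W*W⁻¹≈1) (*-identityˡ _))))
          cancel : ∣ S z - fromSign (F z) * W ∣≤ W * 0‧99 → ∣ fromSign (F z) - W ⁻¹ * S z ∣≤ 0‧99
          cancel (above , below) = ∣∣≤-cong (solve 2 (λ a b → :- (a :- b) := b :- a) refl (W ⁻¹ * S z)
              (fromSign (F z))) refl (∣∣≤-neg
            ( *-cancelˡ-≤ 0<W (≤-trans (≤-reflexive (sym scaled-difference)) above)
            , *-cancelˡ-≤ 0<W (≤-trans (≤-reflexive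
                (trans (sym (-‿distribʳ-* _ _)) (-‿cong (sym scaled-difference)))) below)))

        bound : ℕ
        bound = k ℕ.+ degree ℕ./ suc D

        -- Summing out the points leaves a truncated product of block moments. Its degree counts at
        -- most `k` bad factors and the heavy blocks; each of these uses up `suc D` of the degree,
        -- so there are at most `degree / suc D`.
        polynomial-monomial : ∀ es → Vec.sum es ℕ.≤ degree →
          PolynomialOfDegree≤ cube bound (λ z → ∑ₚ X (λ x → monomial es (productPoint X x) * E z x))
        polynomial-monomial es es≤degree with Vec.group n m es
        ... | ess , ≡.refl = polynomial-weaken
          (ℕₚ.+-monoʳ-≤ k (≡.subst (ℕ._≤ degree ℕ./ suc D) (ℕ.m*n/n≡m (heavy D ess) (suc D))
            (ℕ./-monoˡ-≤ (suc D) (ℕₚ.≤-trans (heavy-bound D ess) es≤degree))))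
          (polynomial-cong
            (λ z → sym (trans (∑ₚ-cong X (λ x → *-congʳ (monomial-concat ess X x)))
              (∑ₚ-truncated X ones k q (u z) (λ i y → - v z i y))))
            (polynomial-truncated D ess ones k
              (λ i σ → ∑ (λ y → q i y * S.weight i σ y))
              (λ i σ → ∑ (λ y → q i y * - (S.weight i σ y - S.good i σ y)))
              (λ i → S.balanced i (lookup ess i))))
          where
          q : ∀ i → Element (X i) → Carrier
          q i y = monomial (lookup ess i) (point (X i) y)

        polynomial-S : ∀ q → HasDegree≤ degree q →
          PolynomialOfDegree≤ cube bound (λ z → ∑ₚ X (λ x → eval q (productPoint X x) * E z x))
        polynomial-S [] [] = polynomial-cong
          (λ z → sym (trans (∑ₚ-*ˡ X 0# (E z)) (zeroˡ _)))
          (polynomial-const 0#)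
        polynomial-S ((a , es) ∷ q) (es≤ ∷ q≤) = polynomial-cong
          (λ z → trans (sym (∑ₚ-linear X a 1# (λ x → monomial es (productPoint X x) * E z x)
              (λ x → eval q (productPoint X x) * E z x)))
            (∑ₚ-cong X (λ x → solve 4 (λ a b c e → a :* (b :* e) :+ con (pos 1) :* (c :* e)
                := (a :* b :+ c) :* e) refl
              a (monomial es (productPoint X x)) (eval q (productPoint X x)) (E z x))))
          (polynomial-+ (polynomial-*ˡ a (polynomial-monomial es es≤)) (polynomial-*ˡ 1# (polynomial-S q q≤)))

      decomposed : Approximable cube 0‧99 F (k ℕ.+ degree ℕ./ suc D)
      decomposed = representative , hasDegree ,
        λ z → ∣∣≤⇒abs≤ (∣∣≤-cong (+-congˡ (-‿cong (sym (represents z)))) refl (approximates z))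
        where open PolynomialOfDegree≤ (polynomial-*ˡ (W ⁻¹) (polynomial-S p p-degree))

  -- Spelled as in the statement of the theorem, so that its hypotheses at accuracy `1# - noise n d`
  -- apply directly.
  noise : ℕ → ℕ → Carrier
  noise n d = fromℕ 1 / fromℕ (30 ℕ.* n) * fromℕ d

  30n*noise≈d : ∀ n d .{{_ : NonZero n}} → fromℕ (30 ℕ.* n) * noise n d ≈ fromℕ d
  30n*noise≈d n d = trans (solve 3 (λ N w d → N :* ((con (pos 1) :+ con (pos 0)) :* w :* d) := N :* w :* d) refl
      (fromℕ (30 ℕ.* n)) (fromℕ (30 ℕ.* n) ⁻¹) (fromℕ d))
    (trans (*-congʳ (proj₁ (inverse-positive (0<fromℕ (30 ℕ.* n) {{ℕₚ.m*n≢0 30 n}})))) (*-identityˡ _))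

  noise-nonNegative : ∀ n d .{{_ : NonZero n}} → 0# ≤ noise n d
  noise-nonNegative n d = *-cancelˡ-nonNegative (0<fromℕ (30 ℕ.* n) {{ℕₚ.m*n≢0 30 n}})
    (≤-trans (fromℕ-nonNegative d) (≤-reflexive (sym (30n*noise≈d n d))))

  -- Only lower bounds `d` and `D` are asked for, and the noise level is formed from this `d`; the
  -- exact degrees need not be at hand.
  composition-bound : ∀ {n m d D degree} .{{_ : NonZero n}} (F : Vec Sign n → Sign) (X : Fin n → FiniteSet m)
    (f : ∀ i → Element (X i) → Sign) → d ℕ.≤ n →
    (∀ {k} → Approximable cube 0‧99 F k → d ℕ.≤ k) →
    (∀ i {k} → Approximable (point (X i)) (1# - noise n d) (f i) k → D ℕ.≤ k) →
    Approximable (productPoint X) 1/3 (compose {X = X} F f) degree →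
    d ℕ.* D ℕ.≤ 2 ℕ.* degree
  composition-bound {d = zero} F X f d≤n minF minf approximable = ℕ.z≤n
  composition-bound {d = suc d} {zero} {degree} F X f d≤n minF minf approximable =
    ≡.subst (ℕ._≤ 2 ℕ.* degree) (≡.sym (ℕₚ.*-zeroʳ d)) ℕ.z≤n
  composition-bound {n} {d = d@(suc d′)} {suc D} {degree} F X f d≤n minF minf
      (p , p-degree , p-approximates) = begin
    d ℕ.* suc D              ≤⟨ ℕₚ.*-monoˡ-≤ (suc D) d≤2q ⟩
    2 ℕ.* q ℕ.* suc D        ≡⟨ ℕₚ.*-assoc 2 q (suc D) ⟩
    2 ℕ.* (q ℕ.* suc D)      ≤⟨ ℕₚ.*-monoʳ-≤ 2 (ℕ.m/n*n≤m degree (suc D)) ⟩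
    2 ℕ.* degree             ∎
    where
    open ℕₚ.≤-Reasoning
    k q : ℕ
    -- The largest `k` with `2 k < d`. That inequality turns `d ≤ k + q` into `k < q`, while
    -- `d ≤ 2 (k + 1)` is what the truncation estimate asks for.
    k = ℕ.⌊ d′ /2⌋
    q = degree ℕ./ suc D
    δ : Carrier
    δ = noise n d
    k+k≤d′ : k ℕ.+ k ℕ.≤ d′
    k+k≤d′ = ℕₚ.≤-trans (ℕₚ.+-monoʳ-≤ k (ℕₚ.⌊n/2⌋≤⌈n/2⌉ d′)) (ℕₚ.≤-reflexive (ℕₚ.⌊n/2⌋+⌈n/2⌉≡n d′))
    ⌈n/2⌉≤1+⌊n/2⌋ : ∀ n → ℕ.⌈ n /2⌉ ℕ.≤ suc ℕ.⌊ n /2⌋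
    ⌈n/2⌉≤1+⌊n/2⌋ zero = ℕ.z≤n
    ⌈n/2⌉≤1+⌊n/2⌋ (suc zero) = ℕₚ.≤-refl
    ⌈n/2⌉≤1+⌊n/2⌋ (suc (suc n)) = ℕ.s≤s (⌈n/2⌉≤1+⌊n/2⌋ n)
    d≤2[1+k] : d ℕ.≤ suc k ℕ.+ suc k
    d≤2[1+k] = ℕ.s≤s (ℕₚ.≤-trans (ℕₚ.≤-reflexive (≡.sym (ℕₚ.⌊n/2⌋+⌈n/2⌉≡n d′))) (ℕₚ.+-monoʳ-≤ k (⌈n/2⌉≤1+⌊n/2⌋ d′)))
    30δ≤1′ : fromℕ 30 * δ ≤ 1#
    30δ≤1′ = 30δ≤1 d≤n (noise-nonNegative n d) (30n*noise≈d n d)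
    0<1-δ : 0# < 1# - δ
    0<1-δ = ≰⇒> λ 1-δ≤0 → 1≰0 (≤-trans (slack⇒≤
        (+-nonNegative (*-nonNegative (fromℕ-nonNegative 30) (slack 1-δ≤0))
            (+-nonNegative (slack 30δ≤1′) (fromℕ-nonNegative 28)))
        (solve 1 (λ δ → con (pos 0) :- con (pos 1)
            := con (pos 30) :* (con (pos 0) :- (con (pos 1) :- δ)) :+
                ((con (pos 1) :- con (pos 30) :* δ) :+ con (pos 28))) refl δ))
      Ord.refl)
    d≤k+q : d ℕ.≤ k ℕ.+ q
    d≤k+q = minF (decomposed F X f k D 0<1-δ
      -- An approximant of degree `D` would give `suc D ≤ D`, so the weights can be balanced up to
      -- degree `D`, one less than the lower bound.
      (λ i → not-approximable⇒split 0<1-δ (λ approximable → ℕₚ.1+n≰n (minf i approximable)))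
      (truncation-small d≤n (noise-nonNegative n d) (30n*noise≈d n d) k d≤2[1+k]) p p-degree p-approximates)
    k<q : k ℕ.< q
    k<q = ℕₚ.+-cancelˡ-≤ k _ _ (ℕₚ.≤-trans (ℕₚ.≤-reflexive (ℕₚ.+-suc k k)) (ℕₚ.≤-trans (ℕ.s≤s k+k≤d′) d≤k+q))
    d≤2q : d ℕ.≤ 2 ℕ.* q
    d≤2q = ℕₚ.≤-trans d≤2[1+k] (ℕₚ.≤-trans (ℕₚ.+-mono-≤ k<q k<q)
        (ℕₚ.≤-reflexive (≡.cong (q ℕ.+_) (≡.sym (ℕₚ.+-identityʳ q)))))

  -- Minima, ceilings and powers of two

  minimum≤ : ∀ {n} .{{_ : NonZero n}} (a : Fin n → ℕ) i → minimum a ℕ.≤ a i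
  minimum≤ {suc n} a = λ { zero → base (a zero) (a ∘ suc) ; (suc i) → entry (a zero) (a ∘ suc) i }
    where
    base : ∀ {n} b (a : Fin n → ℕ) → Vector.foldr ℕ._⊓_ b a ℕ.≤ b
    base {zero} b a = ℕₚ.≤-refl
    base {suc n} b a = ℕₚ.≤-trans (ℕₚ.m⊓n≤n _ _) (base b (a ∘ suc))
    entry : ∀ {n} b (a : Fin n → ℕ) i → Vector.foldr ℕ._⊓_ b a ℕ.≤ a i
    entry b a zero = ℕₚ.m⊓n≤m _ _
    entry b a (suc i) = ℕₚ.≤-trans (ℕₚ.m⊓n≤n _ _) (entry b (a ∘ suc) i)

  minimum-attained : ∀ {n} .{{_ : NonZero n}} (a : Fin n → ℕ) → ∃ λ i → minimum a ≡ a i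
  minimum-attained {suc n} a = [ (λ eq → zero , eq) , (λ (i , eq) → suc i , eq) ]′ (go (a zero) (a ∘ suc))
    where
    go : ∀ {n} b (a : Fin n → ℕ) → Vector.foldr ℕ._⊓_ b a ≡ b ⊎ ∃ λ i → Vector.foldr ℕ._⊓_ b a ≡ a i
    go {zero} b a = inj₁ ≡.refl
    go {suc n} b a with ℕₚ.⊓-sel (a zero) (Vector.foldr ℕ._⊓_ b (a ∘ suc)) | go b (a ∘ suc)
    ... | inj₁ eq | _ = inj₂ (zero , eq)
    ... | inj₂ eq | inj₁ eq′ = inj₁ (≡.trans eq eq′)
    ... | inj₂ eq | inj₂ (i , eq′) = inj₂ (suc i , ≡.trans eq eq′)

  ceilingDivision : ∀ a b .{{_ : NonZero b}} → ∃ λ q → a ℕ.≤ b ℕ.* q × (∀ {k} → a ℕ.≤ b ℕ.* k → q ℕ.≤ k)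
  ceilingDivision zero b = 0 , ℕ.z≤n , λ _ → ℕ.z≤n
  ceilingDivision (suc a) b = suc (a ℕ./ b) ,
    ℕₚ.≤-trans (ℕₚ.≤-trans (ℕ.s≤s (ℕₚ.≤-reflexive (ℕ.m≡m%n+[m/n]*n a b)))
        (ℕₚ.+-monoˡ-≤ (a ℕ./ b ℕ.* b) (ℕ.m%n<n a b)))
      (ℕₚ.≤-reflexive (ℕₚ.*-comm (suc (a ℕ./ b)) b)) ,
    λ {k} a<bk → ℕ.m<n*o⇒m/o<n (ℕₚ.≤-trans a<bk (ℕₚ.≤-reflexive (ℕₚ.*-comm b k)))

  powerBetween : ∀ A d .{{_ : NonZero d}} → d ℕ.≤ 2 ℕ.* A → ∃ λ J → A ℕ.≤ 2 ℕ.^ J ℕ.* d × 2 ℕ.^ J ℕ.* d ℕ.≤ 2 ℕ.* A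
  powerBetween A d d≤2A = [ id ,
      (λ (below , _) → ⊥-elim (ℕₚ.<⇒≱ below (ℕₚ.≤-trans (n≤2^n A) (ℕₚ.m≤m*n (2 ℕ.^ A) d)))) ]′ (search A)
    where
    n≤2^n : ∀ n → n ℕ.≤ 2 ℕ.^ n
    n≤2^n zero = ℕ.z≤n
    n≤2^n (suc n) = ℕₚ.≤-trans (ℕ.s≤s (n≤2^n n))
        (ℕₚ.+-mono-≤ (ℕₚ.m^n>0 2 n) (ℕₚ.≤-reflexive (≡.sym (ℕₚ.+-identityʳ _))))
    Found = ∃ λ J → A ℕ.≤ 2 ℕ.^ J ℕ.* d × 2 ℕ.^ J ℕ.* d ℕ.≤ 2 ℕ.* A
    compare : ∀ J → 2 ℕ.^ J ℕ.* d ℕ.≤ 2 ℕ.* A → Found ⊎ 2 ℕ.^ J ℕ.* d ℕ.< A × 2 ℕ.^ J ℕ.* d ℕ.≤ 2 ℕ.* A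
    compare J ≤2A with A ℕₚ.≤? 2 ℕ.^ J ℕ.* d
    ... | yes A≤ = inj₁ (J , A≤ , ≤2A)
    ... | no A≰ = inj₂ (ℕₚ.≰⇒> A≰ , ≤2A)
    search : ∀ J → Found ⊎ 2 ℕ.^ J ℕ.* d ℕ.< A × 2 ℕ.^ J ℕ.* d ℕ.≤ 2 ℕ.* A
    search zero = compare 0 (ℕₚ.≤-trans (ℕₚ.≤-reflexive (ℕₚ.*-identityˡ d)) d≤2A)
    search (suc J) = [ inj₁ , (λ (below , _) → compare (suc J)
        (ℕₚ.≤-trans (ℕₚ.≤-reflexive (ℕₚ.*-assoc 2 (2 ℕ.^ J) d))
      (ℕₚ.*-monoʳ-≤ 2 (ℕₚ.<⇒≤ below)))) ]′ (search J)

  -- Absolute constants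

  -- `κ₁` pays for passing from `0.99` to `1/3`: 8 is the least `J` with `2ᴶ / 100 ≥ 2`, and the
  -- degree grows by `κ 2ᴶ⁺¹`. `M₁` adds the 2 of `composition-bound`, and 240 is twice the 120 of
  -- `scaleFor`.
  κ₁ M₁ M₂ : ℕ
  κ₁ = κ ℕ.* 2 ℕ.^ 9
  M₁ = κ₁ ℕ.* 2
  M₂ = κ₁ ℕ.* (κ ℕ.* 240)

  κ≢0 : NonZero κ
  κ≢0 = ℕₚ.m^n≢0 3 steps

  κ₁≢0 : NonZero κ₁
  κ₁≢0 = ℕₚ.m*n≢0 κ (2 ℕ.^ 9) {{κ≢0}}

  approximable-F : ∀ {n d} {F : Vec Sign n → Sign} → Approximable cube 0‧99 F d → Approximable cube 1/3 F (κ₁ ℕ.* d)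
  approximable-F {n} {d} {F} approximable = ≡.subst (Approximable cube 1/3 F) (≡.sym (ℕₚ.*-assoc κ (2 ℕ.^ 9) d))
    (approximable-amplify {pt = cube} {F} 8 2≤2⁸*0‧01 approximable)
    where
    2≤2⁸*0‧01 : fromℕ 2 ≤ fromℕ 256 * (1# - 0‧99)
    2≤2⁸*0‧01 = *-cancelˡ-≤ (0<fromℕ 100) (begin
      fromℕ 100 * fromℕ 2                          ≤⟨ slack⇒≤ (fromℕ-nonNegative 56)
          (solve 0 (con (pos 256) :* (con (pos 100) :- con (pos 99)) :- con (pos 100) :* con (pos 2)
              := con (pos 56)) refl) ⟩
      fromℕ 256 * (fromℕ 100 - fromℕ 99)           ≈⟨ *-congˡ (+-congˡ (-‿cong 100*0‧99≈99)) ⟨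
      fromℕ 256 * (fromℕ 100 - fromℕ 100 * 0‧99)  
          ≈⟨ solve 1 (λ w → con (pos 256) :* (con (pos 100) :- con (pos 100) :* w)
              := con (pos 100) :* (con (pos 256) :* (con (pos 1) :- w))) refl 0‧99 ⟩
      fromℕ 100 * (fromℕ 256 * (1# - 0‧99))        ∎)
      where open ≤R

  approximable-exact : ∀ {n} (F : Vec Sign n → Sign) → Approximable cube 0‧99 F n
  approximable-exact F = representative , hasDegree ,
    λ z → ∣∣≤⇒abs≤ (∣∣≤-cong (sym (trans (+-congˡ (-‿cong (represents z))) (-‿inverseʳ _))) refl
      (∣∣≤-nonNegative Ord.refl (*-nonNegative (fromℕ-nonNegative 99)
          (proj₁ (proj₂ (inverse-positive (0<fromℕ 100)))))))
    where open PolynomialOfDegree≤ (polynomial-onCube (λ z → fromSign (F z)))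

  -- Because `30 n δ = d`, the hypothesis `60 n ≤ 2ᴶ d` is the condition `2 ≤ 2ᴶ δ` of the
  -- amplification.
  approximable-f : ∀ {A : Set} {N} {pt : A → Point N} {f : A → Sign} {n d k} J .{{_ : NonZero n}} →
    60 ℕ.* n ℕ.≤ 2 ℕ.^ J ℕ.* d → Approximable pt (1# - noise n d) f k →
        Approximable pt 1/3 f (κ ℕ.* (2 ℕ.^ suc J ℕ.* k))
  approximable-f {pt = pt} {f} {n} {d} J 60n≤2^Jd = approximable-amplify {pt = pt} {f} J
      (*-cancelˡ-≤ (0<fromℕ (30 ℕ.* n) {{ℕₚ.m*n≢0 30 n}}) (begin
    fromℕ (30 ℕ.* n) * fromℕ 2                ≈⟨ fromℕ-* (30 ℕ.* n) 2 ⟨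
    fromℕ (30 ℕ.* n ℕ.* 2)                    ≡⟨ ≡.cong fromℕ (solveℕ 1 (λ n → lit 30 ⊗ n ⊗ lit 2
        ⊜ lit 60 ⊗ n) ≡.refl n) ⟩
    fromℕ (60 ℕ.* n)                          ≤⟨ fromℕ-mono 60n≤2^Jd ⟩
    fromℕ (2 ℕ.^ J ℕ.* d)                     ≈⟨ fromℕ-* (2 ℕ.^ J) d ⟩
    fromℕ (2 ℕ.^ J) * fromℕ d                 ≈⟨ *-congˡ (30n*noise≈d n d) ⟨
    fromℕ (2 ℕ.^ J) * (fromℕ (30 ℕ.* n) * noise n d)
      ≈⟨ solve 3 (λ p N δ → p :* (N :* δ) := N :* (p :* (con (pos 1) :- (con (pos 1) :- δ))))
          refl (fromℕ (2 ℕ.^ J)) (fromℕ (30 ℕ.* n)) (noise n d) ⟩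
    fromℕ (30 ℕ.* n) * (fromℕ (2 ℕ.^ J) * (1# - (1# - noise n d))) ∎))
    where open ≤R

  -- The lower estimate makes the amplification work; the upper one keeps its cost within
  -- `O(n / d)`.
  scaleFor : ∀ {n d} .{{_ : NonZero d}} → d ℕ.≤ n → ∃ λ J → 60 ℕ.* n ℕ.≤ 2 ℕ.^ J ℕ.* d × 2 ℕ.^ J ℕ.* d ℕ.≤ 120 ℕ.* n
  scaleFor {n} {d} d≤n = ≡.subst (λ B → ∃ λ J → 60 ℕ.* n ℕ.≤ 2 ℕ.^ J ℕ.* d × 2 ℕ.^ J ℕ.* d ℕ.≤ B)
      (≡.sym (ℕₚ.*-assoc 2 60 n))
    (powerBetween (60 ℕ.* n) d (ℕₚ.≤-trans d≤n (ℕₚ.≤-trans (ℕₚ.m≤n*m n 120) (ℕₚ.≤-reflexive (ℕₚ.*-assoc 2 60 n)))))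

  first-bound : ∀ {degF d D degFf} → degF ℕ.≤ κ₁ ℕ.* d → d ℕ.* D ℕ.≤ 2 ℕ.* degFf → degF ℕ.* D ℕ.≤ M₁ ℕ.* degFf
  first-bound {degF} {d} {D} {degFf} degF≤κ₁d dD≤2degFf = begin
    degF ℕ.* D             ≤⟨ ℕₚ.*-monoˡ-≤ D degF≤κ₁d ⟩
    κ₁ ℕ.* d ℕ.* D         ≡⟨ ℕₚ.*-assoc κ₁ d D ⟩
    κ₁ ℕ.* (d ℕ.* D)       ≤⟨ ℕₚ.*-monoʳ-≤ κ₁ dD≤2degFf ⟩
    κ₁ ℕ.* (2 ℕ.* degFf)   ≡⟨ ℕₚ.*-assoc κ₁ 2 degFf ⟨
    M₁ ℕ.* degFf           ∎
    where open ℕₚ.≤-Reasoning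

  -- `degF` is `O(d)` and `degf` is `O(n / d)` times `D`, so that `d` cancels from the product.
  second-bound : ∀ {degF d degf D n} J → degF ℕ.≤ κ₁ ℕ.* d → 2 ℕ.^ J ℕ.* d ℕ.≤ 120 ℕ.* n →
                 degf ℕ.≤ κ ℕ.* (2 ℕ.^ suc J ℕ.* D) → degF ℕ.* degf ℕ.≤ M₂ ℕ.* n ℕ.* D
  second-bound {degF} {d} {degf} {D} {n} J degF≤κ₁d 2^Jd≤120n degf≤ = begin
    degF ℕ.* degf                                     ≤⟨ ℕₚ.*-mono-≤ degF≤κ₁d degf≤ ⟩
    κ₁ ℕ.* d ℕ.* (κ ℕ.* (2 ℕ.* 2 ℕ.^ J ℕ.* D))       
        ≡⟨ solveℕ 5 (λ a d k p D → a ⊗ d ⊗ (k ⊗ (lit 2 ⊗ p ⊗ D))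
            ⊜ a ⊗ (k ⊗ (lit 2 ⊗ (p ⊗ d))) ⊗ D) ≡.refl κ₁ d κ (2 ℕ.^ J) D ⟩
    κ₁ ℕ.* (κ ℕ.* (2 ℕ.* (2 ℕ.^ J ℕ.* d))) ℕ.* D     
        ≤⟨ ℕₚ.*-monoˡ-≤ D (ℕₚ.*-monoʳ-≤ κ₁ (ℕₚ.*-monoʳ-≤ κ (ℕₚ.*-monoʳ-≤ 2 2^Jd≤120n))) ⟩
    κ₁ ℕ.* (κ ℕ.* (2 ℕ.* (120 ℕ.* n))) ℕ.* D         
        ≡⟨ solveℕ 4 (λ a k n D → a ⊗ (k ⊗ (lit 2 ⊗ (lit 120 ⊗ n))) ⊗ D
            ⊜ a ⊗ (k ⊗ lit 240) ⊗ n ⊗ D) ≡.refl κ₁ κ n D ⟩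
    M₂ ℕ.* n ℕ.* D                                    ∎
    where
    open ℕₚ.≤-Reasoning

  -- The second bound chains both constants and the first needs only `M₁`; the product serves for
  -- both.
  M : ℕ
  M = M₁ ℕ.* M₂

  0<M₂ : 0# < fromℕ M₂
  0<M₂ = 0<fromℕ M₂ {{ℕₚ.m*n≢0 κ₁ (κ ℕ.* 240) {{κ₁≢0}} {{ℕₚ.m*n≢0 κ 240 {{κ≢0}}}}}}

  0<M : 0# < fromℕ M
  0<M = ≤-trans (proj₁ p) (≤-reflexive eq) , λ 0≈M → proj₂ p (trans 0≈M (sym eq))
    where
    0<M₁ = 0<fromℕ M₁ {{ℕₚ.m*n≢0 κ₁ 2 {{κ₁≢0}}}}
    p = *-positive 0<M₁ 0<M₂
    eq = sym (fromℕ-* M₁ M₂)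

  ⁻¹*-≤ : ∀ {t x y} → 0# < t → x ≤ t * y → t ⁻¹ * x ≤ y
  ⁻¹*-≤ {t} {x} {y} 0<t x≤ty = *-cancelˡ-≤ 0<t (≤-trans (≤-reflexive
    (trans (sym (*-assoc _ _ _)) (trans (*-congʳ (proj₁ (inverse-positive 0<t))) (*-identityˡ x)))) x≤ty)

  c c′ : Carrier
  c = fromℕ M ⁻¹
  c′ = fromℕ M₂ ⁻¹

  0<c : 0# < c
  0<c = proj₂ (inverse-positive 0<M)

  0<c′ : 0# < c′
  0<c′ = proj₂ (inverse-positive 0<M₂)

  -- From natural number inequalities to real ones

  real-bound₁ : ∀ {a b e} → a ℕ.* b ℕ.≤ M ℕ.* e → c * fromℕ a * fromℕ b ≤ fromℕ e
  real-bound₁ {a} {b} {e} ab≤Me = begin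
    c * fromℕ a * fromℕ b       ≈⟨ *-assoc _ _ _ ⟩
    c * (fromℕ a * fromℕ b)     ≤⟨ ⁻¹*-≤ 0<M (begin
      fromℕ a * fromℕ b         ≈⟨ fromℕ-* a b ⟨
      fromℕ (a ℕ.* b)           ≤⟨ fromℕ-mono ab≤Me ⟩
      fromℕ (M ℕ.* e)           ≈⟨ fromℕ-* M e ⟩
      fromℕ M * fromℕ e         ∎) ⟩
    fromℕ e                     ∎
    where open ≤R

  square-over-n : ∀ {n a b e} .{{_ : NonZero n}} → a ℕ.* (a ℕ.* b) ℕ.≤ n ℕ.* e →
                  fromℕ a ^ 2 / fromℕ n * fromℕ b ≤ fromℕ e
  square-over-n {n} {a} {b} {e} aab≤ne = begin
    fromℕ a * (fromℕ a * 1#) * w * fromℕ b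
      ≈⟨ solve 3 (λ a b w → a :* (a :* con (pos 1)) :* w :* b := w :* (a :* (a :* b))) refl (fromℕ a) (fromℕ b) w ⟩
    w * (fromℕ a * (fromℕ a * fromℕ b))       ≤⟨ ⁻¹*-≤ (0<fromℕ n) (begin
      fromℕ a * (fromℕ a * fromℕ b)           ≈⟨ trans (fromℕ-* a (a ℕ.* b)) (*-congˡ (fromℕ-* a b)) ⟨
      fromℕ (a ℕ.* (a ℕ.* b))                 ≤⟨ fromℕ-mono aab≤ne ⟩
      fromℕ (n ℕ.* e)                         ≈⟨ fromℕ-* n e ⟩
      fromℕ n * fromℕ e                       ∎) ⟩
    fromℕ e                                   ∎
    where
    open ≤R
    w = fromℕ n ⁻¹

  real-bound₂ : ∀ {n a b e} .{{_ : NonZero n}} → a ℕ.* (a ℕ.* b) ℕ.≤ M ℕ.* n ℕ.* e →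
                c * (fromℕ a ^ 2 / fromℕ n) * fromℕ b ≤ fromℕ e
  real-bound₂ {n} {a} {b} {e} aab≤Mne = begin
    c * (fromℕ a ^ 2 / fromℕ n) * fromℕ b     ≈⟨ *-assoc _ _ _ ⟩
    c * (fromℕ a ^ 2 / fromℕ n * fromℕ b)    
        ≤⟨ ⁻¹*-≤ 0<M (≤-trans (square-over-n {n} {a} {b} (ℕₚ.≤-trans aab≤Mne (ℕₚ.≤-reflexive
      (≡.trans (≡.cong (ℕ._* e) (ℕₚ.*-comm M n)) (ℕₚ.*-assoc n M e))))) (≤-reflexive (fromℕ-* M e))) ⟩
    fromℕ e                                   ∎
    where open ≤R

  real-ratio : ∀ {n a b b′} .{{_ : NonZero n}} → a ℕ.* b ℕ.≤ M₂ ℕ.* n ℕ.* b′ →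
               c′ * (c * (fromℕ a ^ 2 / fromℕ n) * fromℕ b) ≤ c * fromℕ a * fromℕ b′
  real-ratio {n} {a} {b} {b′} ab≤M₂nb′ = begin
    c′ * (c * s * fromℕ b)                    ≈⟨ solve 4 (λ c′ c s b → c′ :* (c :* s :* b)
        := c :* (c′ :* (s :* b))) refl c′ c s (fromℕ b) ⟩
    c * (c′ * (s * fromℕ b))                  ≤⟨ *-monoˡ-≤ (proj₁ 0<c) (⁻¹*-≤ 0<M₂ (≤-trans
      (square-over-n {n} {a} {b} {M₂ ℕ.* (a ℕ.* b′)} (ℕₚ.≤-trans (ℕₚ.*-monoʳ-≤ a ab≤M₂nb′) (ℕₚ.≤-reflexive
        (solveℕ 4 (λ a m n b → a ⊗ (m ⊗ n ⊗ b) ⊜ n ⊗ (m ⊗ (a ⊗ b))) ≡.refl a M₂ n b′))))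
      (≤-reflexive (trans (fromℕ-* M₂ (a ℕ.* b′)) (*-congˡ (fromℕ-* a b′)))))) ⟩
    c * (fromℕ a * fromℕ b′)                  ≈⟨ *-assoc _ _ _ ⟨
    c * fromℕ a * fromℕ b′                    ∎
    where
    open ≤R
    s = fromℕ a ^ 2 / fromℕ n

  M₁≤M : ∀ e → M₁ ℕ.* e ℕ.≤ M ℕ.* e
  M₁≤M e = ℕₚ.*-monoˡ-≤ e (ℕₚ.m≤m*n M₁ M₂ {{ℕₚ.m*n≢0 κ₁ (κ ℕ.* 240) {{κ₁≢0}} {{ℕₚ.m*n≢0 κ 240 {{κ≢0}}}}}})

  combined-bound : ∀ {degF degf D degFf n} → degF ℕ.* D ℕ.≤ M₁ ℕ.* degFf → degF ℕ.* degf ℕ.≤ M₂ ℕ.* n ℕ.* D →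
                   degF ℕ.* (degF ℕ.* degf) ℕ.≤ M ℕ.* n ℕ.* degFf
  combined-bound {degF} {degf} {D} {degFf} {n} first second = begin
    degF ℕ.* (degF ℕ.* degf)      ≤⟨ ℕₚ.*-monoʳ-≤ degF second ⟩
    degF ℕ.* (M₂ ℕ.* n ℕ.* D)     ≡⟨ solveℕ 4 (λ a m n b → a ⊗ (m ⊗ n ⊗ b) ⊜ m ⊗ n ⊗ (a ⊗ b)) ≡.refl degF M₂ n D ⟩
    M₂ ℕ.* n ℕ.* (degF ℕ.* D)     ≤⟨ ℕₚ.*-monoʳ-≤ (M₂ ℕ.* n) first ⟩
    M₂ ℕ.* n ℕ.* (M₁ ℕ.* degFf)   ≡⟨ solveℕ 4 (λ a m n b → a ⊗ n ⊗ (m ⊗ b) ⊜ m ⊗ a ⊗ n ⊗ b) ≡.refl M₂ M₁ n degFf ⟩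
    M ℕ.* n ℕ.* degFf             ∎
    where
    open ℕₚ.≤-Reasoning

  -- The bounds for different functions and for a single one

  module _ {n m : ℕ} .{{_ : NonZero n}} (F : Vec Sign n → Sign) {degF : ℕ} (F-degree : IsDeg cube 1/3 F degF) where

    degF≤ : ∀ {k} → Approximable cube 0‧99 F k → degF ℕ.≤ κ₁ ℕ.* k
    degF≤ approximable = proj₂ F-degree (approximable-F {F = F} approximable)

    different-functions :
      (X : Fin n → FiniteSet m) (f : ∀ i → Element (X i) → Sign) →
      ∀ {degF′ degFf : ℕ} {degf′ degf : Fin n → ℕ} →
      IsDeg cube 0‧99 F degF′ →
      IsDeg (productPoint X) 1/3 (compose {X = X} F f) degFf →
      (∀ i → IsDeg (point (X i)) (1# - noise n degF′) (f i) (degf′ i)) →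
      (∀ i → IsDeg (point (X i)) 1/3 (f i) (degf i)) →
      degF ℕ.* minimum degf′ ℕ.≤ M₁ ℕ.* degFf × degF ℕ.* minimum degf ℕ.≤ M₂ ℕ.* n ℕ.* minimum degf′
    different-functions X f {degF′} {degFf} {degf′} {degf} F-degree′ Ff-degree f-degree′ f-degree =
      first-bound degF≤κ₁degF′ (composition-bound F X f degF′≤n (proj₂ F-degree′)
        (λ i approximable → ℕₚ.≤-trans (minimum≤ degf′ i) (proj₂ (f-degree′ i) approximable)) (proj₁ Ff-degree)) ,
      second degF′ degF′≤n degF≤κ₁degF′ f-degree′ (minimum-attained degf′)
      where
      degF′≤n : degF′ ℕ.≤ n
      degF′≤n = proj₂ F-degree′ (approximable-exact F)
      degF≤κ₁degF′ : degF ℕ.≤ κ₁ ℕ.* degF′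
      degF≤κ₁degF′ = degF≤ (proj₁ F-degree′)
      -- Generalised over `d` to allow a case split: `scaleFor` requires `d` to be nonzero, and for
      -- `d = 0` the bound on `degF` makes the left-hand side zero.
      second : ∀ d → d ℕ.≤ n → degF ℕ.≤ κ₁ ℕ.* d → (∀ i → IsDeg (point (X i)) (1# - noise n d) (f i) (degf′ i)) →
               (∃ λ i → minimum degf′ ≡ degf′ i) → degF ℕ.* minimum degf ℕ.≤ M₂ ℕ.* n ℕ.* minimum degf′
      second zero _ degF≤0 _ _ = ℕₚ.≤-trans
          (ℕₚ.*-monoˡ-≤ (minimum degf) (ℕₚ.≤-trans degF≤0 (ℕₚ.≤-reflexive (ℕₚ.*-zeroʳ κ₁)))) ℕ.z≤n
      second d@(suc _) d≤n degF≤κ₁d f-degree′ (i , min≡) = bound (scaleFor d≤n)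
        where
        bound : (∃ λ J → 60 ℕ.* n ℕ.≤ 2 ℕ.^ J ℕ.* d × 2 ℕ.^ J ℕ.* d ℕ.≤ 120 ℕ.* n) →
                degF ℕ.* minimum degf ℕ.≤ M₂ ℕ.* n ℕ.* minimum degf′
        bound (J , 60n≤2^Jd , 2^Jd≤120n) = second-bound J degF≤κ₁d 2^Jd≤120n
          (ℕₚ.≤-trans (minimum≤ degf i) (ℕₚ.≤-trans
            (proj₂ (f-degree i) (approximable-f {pt = point (X i)} {f i} {n} {d} J 60n≤2^Jd (proj₁ (f-degree′ i))))
            (ℕₚ.≤-reflexive (≡.cong (λ D → κ ℕ.* (2 ℕ.^ suc J ℕ.* D)) (≡.sym min≡)))))

    -- Amplification turns the given degrees into lower bounds for the missing ones: `d` is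
    -- `degF / κ₁` rounded up, and `D` is `degf / (κ 2ᴶ⁺¹)` rounded up, where `J` fits the noise
    -- level of this `d`.
    same-function :
      (X : FiniteSet m) (f : Element X → Sign) → ∀ {degFf degf : ℕ} →
      IsDeg (productPoint {n} (λ _ → X)) 1/3 (compose {X = λ _ → X} F (λ _ → f)) degFf →
      IsDeg (point X) 1/3 f degf →
      degF ℕ.* (degF ℕ.* degf) ℕ.≤ M ℕ.* n ℕ.* degFf
    same-function X f {degFf} {degf} Ff-degree f-degree = outer (ceilingDivision degF κ₁ {{κ₁≢0}})
      where
      Goal : Set
      Goal = degF ℕ.* (degF ℕ.* degf) ℕ.≤ M ℕ.* n ℕ.* degFf

      inner : ∀ {d J} → d ℕ.≤ n → degF ℕ.≤ κ₁ ℕ.* d → (∀ {k} → degF ℕ.≤ κ₁ ℕ.* k → d ℕ.≤ k) →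
              60 ℕ.* n ℕ.≤ 2 ℕ.^ J ℕ.* d → 2 ℕ.^ J ℕ.* d ℕ.≤ 120 ℕ.* n →
              (∃ λ D → degf ℕ.≤ κ ℕ.* 2 ℕ.^ suc J ℕ.* D × (∀ {k} → degf ℕ.≤ κ ℕ.* 2 ℕ.^ suc J ℕ.* k →
                  D ℕ.≤ k)) → Goal
      inner {d} {J} d≤n degF≤κ₁d d-least 60n≤2^Jd 2^Jd≤120n (D , degf≤ , D-least) = combined-bound {degF} {degf} {D}
        (first-bound degF≤κ₁d (composition-bound F (λ _ → X) (λ _ → f) d≤n
            (λ approximable → d-least (degF≤ approximable))
          (λ i {k} approximable → D-least
              (ℕₚ.≤-trans (proj₂ f-degree (approximable-f {pt = point X} {f} {n} {d} J 60n≤2^Jd approximable))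
            (ℕₚ.≤-reflexive (≡.sym (ℕₚ.*-assoc κ (2 ℕ.^ suc J) k)))))
          (proj₁ Ff-degree)))
        (second-bound J degF≤κ₁d 2^Jd≤120n (ℕₚ.≤-trans degf≤ (ℕₚ.≤-reflexive (ℕₚ.*-assoc κ (2 ℕ.^ suc J) D))))

      outer : (∃ λ d → degF ℕ.≤ κ₁ ℕ.* d × (∀ {k} → degF ℕ.≤ κ₁ ℕ.* k → d ℕ.≤ k)) → Goal
      outer (zero , degF≤0 , _) = ℕₚ.≤-trans
        (ℕₚ.*-monoˡ-≤ (degF ℕ.* degf) (ℕₚ.≤-trans degF≤0 (ℕₚ.≤-reflexive (ℕₚ.*-zeroʳ κ₁)))) ℕ.z≤n
      outer (d@(suc _) , degF≤κ₁d , d-least) = atScale (scaleFor d≤n)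
        where
        d≤n : d ℕ.≤ n
        d≤n = d-least (degF≤ (approximable-exact F))
        atScale : (∃ λ J → 60 ℕ.* n ℕ.≤ 2 ℕ.^ J ℕ.* d × 2 ℕ.^ J ℕ.* d ℕ.≤ 120 ℕ.* n) → Goal
        atScale (J , 60n≤2^Jd , 2^Jd≤120n) = inner {d} {J} d≤n degF≤κ₁d d-least 60n≤2^Jd 2^Jd≤120n
          (ceilingDivision degf (κ ℕ.* 2 ℕ.^ suc J) {{ℕₚ.m*n≢0 κ (2 ℕ.^ suc J) {{κ≢0}} {{ℕₚ.m^n≢0 2 (suc J)}}}})

theorem6p6 :
  ∀ {r ℓ} (ℝ : RealNumbers r ℓ) → let open Approximation ℝ in
  ∃ λ (c : Carrier) → 0# < c × ∃ λ (c′ : Carrier) → 0# < c′ ×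
  ( ∀ (n m : ℕ) .{{_ : NonZero n}} .{{_ : NonZero m}}
    (F : Vec Sign n → Sign) → NonConstant F →
    ∀ {degF : ℕ} → IsDeg cube 1/3 F degF →
    ( (X : Fin n → FiniteSet m)
      (f : ∀ i → Element (X i) → Sign) → (∀ i → NonConstant (f i)) →
      ∀ {degF′ degFf : ℕ} {degf′ degf : Fin n → ℕ} →
      IsDeg cube 0‧99 F degF′ →
      IsDeg (productPoint X) 1/3 (compose {X = X} F f) degFf →
      (∀ i → IsDeg (point (X i))
               (1# - fromℕ 1 / fromℕ (30 ℕ.* n) * fromℕ degF′) (f i) (degf′ i)) →
      (∀ i → IsDeg (point (X i)) 1/3 (f i) (degf i)) →
      let bound₁ = c * fromℕ degF * fromℕ (minimum degf′)
          bound₂ = c * (fromℕ degF ^ 2 / fromℕ n) * fromℕ (minimum degf)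
      in bound₁ ≤ fromℕ degFf
       × bound₂ ≤ fromℕ degFf
       × c′ * bound₂ ≤ bound₁ )
    × ( (X : FiniteSet m) (f : Element X → Sign) → NonConstant f →
        ∀ {degFf degf : ℕ} →
        IsDeg (productPoint {n} (λ _ → X)) 1/3
          (compose {X = λ _ → X} F (λ _ → f)) degFf →
        IsDeg (point X) 1/3 f degf →
        c * (fromℕ degF ^ 2 / fromℕ n) * fromℕ degf ≤ fromℕ degFf ) )
theorem6p6 ℝ = c , 0<c , c′ , 0<c′ , λ n m F _ {degF} F-degree →
  (λ X f _ {degF′} {degFf} {degf′} {degf} F-degree′ Ff-degree f-degree′ f-degree →
    let first , second = different-functions F F-degree X f F-degree′ Ff-degree f-degree′ f-degree in
    real-bound₁ {degF} {minimum degf′} (ℕₚ.≤-trans first (M₁≤M degFf)) ,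
    real-bound₂ {n} {degF} {minimum degf} (combined-bound {degF} first second) ,
    real-ratio {n} {degF} {minimum degf} second) ,
  (λ X f _ {degFf} {degf} Ff-degree f-degree →
    real-bound₂ {n} {degF} {degf} (same-function F F-degree X f Ff-degree f-degree))
  where open Composition ℝ
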